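{- Let $k\ge 2$, $p\ge 0$, $m\ge 0$ be integers, and let $G$ be a simple graph that is $k$-weakly $(4kp-2p+2m)$-connected, i.e. for any two disjoint vertex sets $A,B$ with $A\neq\emptyset$ and $A\cup B\subsetneq V(G)$, $d_{G-B}(A)\ge 4kp-2p+2m-k|B|$. Then $G$ has a spanning subgraph $H$ containing a packing (pairwise edge-disjoint collection) of $m$ spanning trees and $p$ spanning $k$-rigid subgraphs such that for each vertex $v$, $$d_H(v)\le\left\lceil\frac{d_G(v)}{2}\right\rceil+kp+m.$$
   Context: Graphs are finite and loopless. $d_{G-B}(A)$ is the number of edges of $G-B$ with exactly one end in $A$; $e_F(X)$ the number of edges of $F$ with both ends in $X$. A graph $H$ is $k$-rigid if it has a spanning subgraph $F$ with $e_F(X)\le k|X|-(2k-1)$ for every $X\subseteq V(H)$ with $|X|\ge 2$ and $|E(F)|=k|V(H)|-(2k-1)$ (i.e. $\ell_{k,2k-1}$-rigid, where $\ell_{k,2k-1}$ is $k$ on singletons and $2k-1$ on sets of at least two vertices). -}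

module Defs where

open import Data.Nat using (ℕ; zero; suc; _+_; _*_; _∸_; _≤_; _<ᵇ_; ⌈_/2⌉)
open import Data.Bool using (Bool; true; false; _∧_; _∨_; _xor_; not; if_then_else_)
open import Data.Fin using (Fin; toℕ)
open import Data.List using (List; []; _∷_; _++_; length; map; allFin)
open import Data.Nat.ListAction using (sum)
open import Data.List.Relation.Unary.Unique.Propositional using (Unique)
open import Data.Vec using (lookup)
open import Data.Fin.Subset using (Subset; ∣_∣; Nonempty; _∪_; ⊤)
open import Data.Product using (Σ; Σ-syntax; _×_)
open import Data.Unit using () renaming (⊤ to Unit)
open import Relation.Binary.PropositionalEquality using (_≡_; _≢_)
open import Relation.Nullary using (¬_)

record Graph (n : ℕ) : Set where
  field
    adj    : Fin n → Fin n → Bool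
    sym    : ∀ u v → adj u v ≡ adj v u
    irrefl : ∀ v → adj v v ≡ false
open Graph public

_⊑_ : ∀ {n} → Graph n → Graph n → Set
F ⊑ G = ∀ u v → adj F u v ≡ true → adj G u v ≡ true

EdgeDisjoint : ∀ {n} → Graph n → Graph n → Set
EdgeDisjoint F G = ∀ u v → ¬ (adj F u v ≡ true × adj G u v ≡ true)

_∈ᵇ_ : ∀ {n} → Fin n → Subset n → Bool
v ∈ᵇ X = lookup X v

countPairs : ∀ {n} → (Fin n → Fin n → Bool) → ℕ
countPairs {n} f =
  sum (map (λ u → sum (map (λ v → if (toℕ u <ᵇ toℕ v) ∧ f u v then 1 else 0)
                             (allFin n)))
           (allFin n))

numEdges : ∀ {n} → Graph n → ℕ
numEdges G = countPairs (adj G)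

degree : ∀ {n} → Graph n → Fin n → ℕ
degree {n} G v = sum (map (λ u → if adj G v u then 1 else 0) (allFin n))

eIn : ∀ {n} → Graph n → Subset n → ℕ
eIn F X = countPairs (λ u v → adj F u v ∧ (u ∈ᵇ X) ∧ (v ∈ᵇ X))

dMinus : ∀ {n} → Graph n → Subset n → Subset n → ℕ
dMinus G B A =
  countPairs (λ u v → adj G u v ∧ not (u ∈ᵇ B) ∧ not (v ∈ᵇ B)
                      ∧ ((u ∈ᵇ A) xor (v ∈ᵇ A)))

Disjoint : ∀ {n} → Subset n → Subset n → Set
Disjoint {n} A B = ∀ (v : Fin n) → ¬ ((v ∈ᵇ A) ≡ true × (v ∈ᵇ B) ≡ true)

WeaklyConnected : ∀ {n} → ℕ → ℕ → Graph n → Set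
WeaklyConnected {n} k l G =
  (A B : Subset n) → Disjoint A B → Nonempty A → (A ∪ B) ≢ ⊤ →
  l ≤ dMinus G B A + k * ∣ B ∣

data Reachable {n} (G : Graph n) : Fin n → Fin n → Set where
  here : ∀ {v} → Reachable G v v
  step : ∀ {u w v} → adj G u w ≡ true → Reachable G w v → Reachable G u v

Connected : ∀ {n} → Graph n → Set
Connected G = ∀ u v → Reachable G u v

Chain : ∀ {n} → Graph n → List (Fin n) → Set
Chain G []            = Unit
Chain G (x ∷ [])      = Unit
Chain G (x ∷ y ∷ r)   = adj G x y ≡ true × Chain G (y ∷ r)

HasCycle : ∀ {n} → Graph n → Set
HasCycle {n} G =
  Σ[ v ∈ Fin n ] Σ[ vs ∈ List (Fin n) ]
    (2 ≤ length vs × Unique (v ∷ vs) × Chain G (v ∷ vs ++ v ∷ []))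

IsSpanningTree : ∀ {n} → Graph n → Set
IsSpanningTree T = Connected T × ¬ HasCycle T

KRigid : ∀ {n} → ℕ → Graph n → Set
KRigid {n} k H =
  Σ[ F ∈ Graph n ]
    (F ⊑ H
    × ((X : Subset n) → 2 ≤ ∣ X ∣ → eIn F X ≤ k * ∣ X ∣ ∸ (2 * k ∸ 1))
    × numEdges F ≡ k * n ∸ (2 * k ∸ 1))

{-# OPTIONS --safe #-}

-- Let c = kp + m, q = (2k − 1)p + m and R = cn − q, the number of edges of a
-- packing of p bases of the (k, 2k − 1)-count matroid and m spanning trees.  The
-- rank of a union of such matroids at an edge set Z is bounded by Φ(Z), the
-- cheapest way of covering Z by vertex sets X of weight k|X| − (2k − 1), once per
-- matroid; Φ is submodular.
--
-- Degrees.  Let h(v) = ⌈d(v)/2⌉ + c.  Suppose that for all U ⊆ V and all Z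
--   (∗)  R + e(V ∖ U) ≤ h(V ∖ U) + Φ(Z) + |E(U) ∖ Z|.
-- The difference of the two sides is submodular in (U, Z), since an edge between
-- U₁ ∖ U₂ and U₂ ∖ U₁ is counted once on each side.  If no edge can be deleted
-- without violating (∗), uncrossing tight pairs shows that (V, ∅) is tight, that
-- is |E| = R.  Then U = V in (∗) says that E is independent in the union, and
-- U = V − v, Z = ∅ says d(v) ≤ h(v).  An independent set is split into
-- independent sets one edge at a time, again by uncrossing.
--
-- Connectivity implies (∗).  Because h(V ∖ U) already pays half of every edge
-- between U and V ∖ U, it remains to bound the covers of a single set U from
-- below.  Merge the cover of one tree matroid to a partition of U and restrict the
-- members X of a cover of one rigidity matroid to its classes.  Members with at
-- most three vertices are replaced by their edges.  For the others, weak
-- connectivity is applied to the vertices of X lying in no other member, with the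
-- remaining vertices of X as B; members without such vertices have at least four
-- shared vertices, which pay for the deficit 2k − 1.
--
-- The argument is classical; it is run under double negation, and the packing is
-- then found by finite search.
module Submission where

open import Defs hiding (sym)
open import Data.Bool using (Bool; true; false; _∧_; _∨_; _xor_; not; if_then_else_; T)
import Data.Bool.Properties as Bool
open import Data.Bool.Properties using (∧-comm; ∧-zeroʳ; ∨-assoc; ∨-comm; ∨-identityʳ; ∨-zeroʳ)
open import Data.Bool.ListAction using (any)
open import Data.Empty using (⊥; ⊥-elim)
open import Data.Fin using (Fin; zero; suc; toℕ)
import Data.Fin.Properties as Fin
open import Data.Fin.Subset using (Subset; ∣_∣; ⊤) renaming (_∪_ to _∪ˢ_)
open import Data.Fin.Subset.Properties using (anySubset?; ∣p∣≤n)
open import Data.List using (List; []; _∷_; _++_; map; tabulate; allFin; cartesianProduct; length)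
open import Data.List.Membership.Propositional using (_∈_; find)
open import Data.List.Membership.Propositional.Properties using (∈-allFin; ∈-map⁻; ∈-map⁺)
open import Data.List.Properties using (length-tabulate; map-tabulate)
open import Data.List.Relation.Unary.All using (All; []; _∷_)
import Data.List.Relation.Unary.All as All
open import Data.List.Relation.Unary.All.Properties using (++⁺)
open import Data.List.Relation.Unary.AllPairs using ([]; _∷_)
open import Data.List.Relation.Unary.Any using (here; there)
import Data.List.Relation.Unary.Any as Any
open import Data.List.Relation.Unary.Unique.Propositional using (Unique)
open import Data.Maybe using (Maybe; just; nothing; is-just)
open import Data.Nat
open import Data.Nat.ListAction using (sum)
open import Data.Nat.Properties
open import Data.Nat.Tactic.RingSolver using (solve-∀)
open import Data.Product using (∃; ∃-syntax; Σ-syntax; _×_; _,_; proj₁; proj₂)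
import Data.Product.Properties as Product
open import Data.Sum using (_⊎_; inj₁; inj₂)
import Data.Sum.Properties as Sum
import Data.Vec as Vec
open Vec using (Vec)
open import Data.Vec.Properties using (lookup∘tabulate; lookup-zipWith; lookup-replicate; lookup⇒[]=)
open import Function using (_∘_; case_of_)
open import Relation.Binary.Definitions using (DecidableEquality)
open import Relation.Binary.PropositionalEquality hiding ([_])
open import Relation.Nullary using (¬_; Dec; yes; no; does; contradiction)
open import Relation.Nullary.Decidable using (_×-dec_; _→-dec_; ¬?; dec-true; decidable-stable; map′)

-- Finite sums and propositional tautologies

-- The required connectivity is 2q, and 2cn = 2R + 2q. All estimates are therefore doubled and count
-- edges as ordered pairs, so that an edge leaving U weighs one, which is what half a degree pays
-- for. The single allowance 2q is spent on a class equal to V, the one set about which weak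
-- connectivity says nothing. All copies of one kind of matroid share the same cover function, so
-- the cheapest of their covers may stand for all of them; this reduces Φ(Z) to one cover of each
-- kind. The obstacle is that members of a cover overlap. Taking the shared vertices as B costs k
-- for each of them, in every member. A vertex lying in a members adds 2a to twice the sum of the
-- sizes but only 2 to 2|W|, and for a ≥ 2 the difference 2a - 2 is at least a. This difference,
-- multiplied by kp, pays for the vertex in all its members. Uncrossing of covers is possible
-- because weights are modular on sets with two common vertices, while sets with fewer have no edge
-- in common. In the deletion argument (V, full) is tight from the start; the work lies in shrinking
-- Z to the empty set.

private
  variable
    A B : Set

∧-true : ∀ {a b} → a ∧ b ≡ true → a ≡ true × b ≡ true
∧-true {true} {true} _ = refl , refl

-- Inequalities between edge counts are proved summand by summand, and a summand depends on finitely
-- many Booleans. Its truth table is evaluated by `valid`, so that `refl` settles the case analysis.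
Pred : ℕ → Set
Pred zero    = Bool
Pred (suc n) = Bool → Pred n

Holds : ∀ n → Pred n → Set
Holds zero    b = b ≡ true
Holds (suc n) φ = ∀ b → Holds n (φ b)

valid : ∀ n → Pred n → Bool
valid zero    b = b
valid (suc n) φ = valid n (φ true) ∧ valid n (φ false)

tautology : ∀ n φ → valid n φ ≡ true → Holds n φ
tautology zero    φ v       = v
tautology (suc n) φ v true  = tautology n (φ true) (proj₁ (∧-true v))
tautology (suc n) φ v false = tautology n (φ false) (proj₂ (∧-true {valid n (φ true)} v))

≤ᵇ-true : ∀ {m n} → (m ≤ᵇ n) ≡ true → m ≤ n
≤ᵇ-true {m} {n} eq = ≤ᵇ⇒≤ m n (subst T (sym eq) _)

≤-tautology₁ : ∀ {f g : Bool → ℕ} → valid 1 (λ a → f a ≤ᵇ g a) ≡ true → ∀ a → f a ≤ g a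
≤-tautology₁ {f} {g} v a = ≤ᵇ-true (tautology 1 (λ a → f a ≤ᵇ g a) v a)

≤-tautology₂ : ∀ {f g : Bool → Bool → ℕ} → valid 2 (λ a b → f a b ≤ᵇ g a b) ≡ true → ∀ a b → f a b ≤ g a b
≤-tautology₂ {f} {g} v a b = ≤ᵇ-true (tautology 2 (λ a b → f a b ≤ᵇ g a b) v a b)

≤-tautology₃ : ∀ {f g : Bool → Bool → Bool → ℕ} → valid 3 (λ a b c → f a b c ≤ᵇ g a b c) ≡ true → ∀ a b c → f a b c ≤ g a b c
≤-tautology₃ {f} {g} v a b c = ≤ᵇ-true (tautology 3 (λ a b c → f a b c ≤ᵇ g a b c) v a b c)

≤-tautology₄ : ∀ {f g : Bool → Bool → Bool → Bool → ℕ} → valid 4 (λ a b c d → f a b c d ≤ᵇ g a b c d) ≡ true → ∀ a b c d → f a b c d ≤ g a b c d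
≤-tautology₄ {f} {g} v a b c d = ≤ᵇ-true (tautology 4 (λ a b c d → f a b c d ≤ᵇ g a b c d) v a b c d)

≤-tautology₅ : ∀ {f g : Bool → Bool → Bool → Bool → Bool → ℕ} → valid 5 (λ a b c d x → f a b c d x ≤ᵇ g a b c d x) ≡ true → ∀ a b c d x → f a b c d x ≤ g a b c d x
≤-tautology₅ {f} {g} v a b c d x = ≤ᵇ-true (tautology 5 (λ a b c d x → f a b c d x ≤ᵇ g a b c d x) v a b c d x)

≤-tautology₆ : ∀ {f g : Bool → Bool → Bool → Bool → Bool → Bool → ℕ} → valid 6 (λ a b c d x y → f a b c d x y ≤ᵇ g a b c d x y) ≡ true → ∀ a b c d x y → f a b c d x y ≤ g a b c d x y
≤-tautology₆ {f} {g} v a b c d x y = ≤ᵇ-true (tautology 6 (λ a b c d x y → f a b c d x y ≤ᵇ g a b c d x y) v a b c d x y)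

≤-tautology₇ : ∀ {f g : Bool → Bool → Bool → Bool → Bool → Bool → Bool → ℕ} → valid 7 (λ a b c d x y z → f a b c d x y z ≤ᵇ g a b c d x y z) ≡ true → ∀ a b c d x y z → f a b c d x y z ≤ g a b c d x y z
≤-tautology₇ {f} {g} v a b c d x y z = ≤ᵇ-true (tautology 7 (λ a b c d x y z → f a b c d x y z ≤ᵇ g a b c d x y z) v a b c d x y z)

-- With a ≤ b a sum of hypotheses and s the slack, an instance of linear
-- arithmetic reduces to a semiring identity.
farkas : ∀ {a b x y} s → a ≤ b → x + b + s ≡ y + a → x ≤ y
farkas {a} {b} {x} {y} s a≤b eq = +-cancelʳ-≤ b x y (begin
  x + b      ≤⟨ m≤m+n (x + b) s ⟩
  x + b + s  ≡⟨ eq ⟩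
  y + a      ≤⟨ +-monoʳ-≤ y a≤b ⟩
  y + b      ∎)
  where open ≤-Reasoning

χ : Bool → ℕ
χ b = if b then 1 else 0

∑ : List A → (A → ℕ) → ℕ
∑ L f = sum (map f L)

∑-cong : ∀ (L : List A) {f g} → (∀ x → f x ≡ g x) → ∑ L f ≡ ∑ L g
∑-cong []      f≡g = refl
∑-cong (x ∷ L) f≡g = cong₂ _+_ (f≡g x) (∑-cong L f≡g)

∑-mono∈ : ∀ (L : List A) {f g} → (∀ {x} → x ∈ L → f x ≤ g x) → ∑ L f ≤ ∑ L g
∑-mono∈ []      f≤g = z≤n
∑-mono∈ (x ∷ L) f≤g = +-mono-≤ (f≤g (here refl)) (∑-mono∈ L (f≤g ∘ there))

∑-mono : ∀ (L : List A) {f g} → (∀ x → f x ≤ g x) → ∑ L f ≤ ∑ L g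
∑-mono L f≤g = ∑-mono∈ L (λ {x} _ → f≤g x)

∑-zero : ∀ (L : List A) → ∑ L (λ _ → 0) ≡ 0
∑-zero []      = refl
∑-zero (x ∷ L) = ∑-zero L

private
  interchange : ∀ a b c d → (a + b) + (c + d) ≡ (a + c) + (b + d)
  interchange = solve-∀

∑-+ : ∀ (L : List A) f g → ∑ L (λ x → f x + g x) ≡ ∑ L f + ∑ L g
∑-+ []      f g = refl
∑-+ (x ∷ L) f g = trans (cong (f x + g x +_) (∑-+ L f g)) (interchange (f x) (g x) (∑ L f) (∑ L g))

∑-*ˡ : ∀ (L : List A) a f → ∑ L (λ x → a * f x) ≡ a * ∑ L f
∑-*ˡ []      a f = sym (*-zeroʳ a)
∑-*ˡ (x ∷ L) a f = trans (cong (a * f x +_) (∑-*ˡ L a f)) (sym (*-distribˡ-+ a (f x) (∑ L f)))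

∑-++ : ∀ (L M : List A) f → ∑ (L ++ M) f ≡ ∑ L f + ∑ M f
∑-++ []      M f = refl
∑-++ (x ∷ L) M f = trans (cong (f x +_) (∑-++ L M f)) (sym (+-assoc (f x) _ _))

∑-map : ∀ (h : A → B) L f → ∑ (map h L) f ≡ ∑ L (f ∘ h)
∑-map h []      f = refl
∑-map h (x ∷ L) f = cong (f (h x) +_) (∑-map h L f)

∑-swap : ∀ (L : List A) (M : List B) (f : A → B → ℕ) →
         ∑ L (λ x → ∑ M (f x)) ≡ ∑ M (λ y → ∑ L (λ x → f x y))
∑-swap []      M f = sym (∑-zero M)
∑-swap (x ∷ L) M f =
  trans (cong (∑ M (f x) +_) (∑-swap L M f)) (sym (∑-+ M (f x) (λ y → ∑ L (λ x → f x y))))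

∑-cartesianProduct : ∀ (L : List A) (M : List B) f →
                     ∑ (cartesianProduct L M) f ≡ ∑ L (λ x → ∑ M (λ y → f (x , y)))
∑-cartesianProduct []      M f = refl
∑-cartesianProduct (x ∷ L) M f =
  trans (∑-++ (map (x ,_) M) (cartesianProduct L M) f)
        (cong₂ _+_ (∑-map (x ,_) M f) (∑-cartesianProduct L M f))

∑-∈ : ∀ {L : List A} {x} f → x ∈ L → f x ≤ ∑ L f
∑-∈ {L = _ ∷ L} f (here refl) = m≤m+n (f _) (∑ L f)
∑-∈ {L = y ∷ L} f (there x∈L) = ≤-trans (∑-∈ f x∈L) (m≤n+m (∑ L f) (f y))

-- Completeness and absence of repetitions in one equation, in the form that makes a sum against a
-- Kronecker delta collapse.
Enumerates : DecidableEquality A → List A → Set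
Enumerates _≟_ L = ∀ a → ∑ L (λ b → χ (does (a ≟ b))) ≡ 1

∑-δ* : ∀ (_≟_ : DecidableEquality A) {L} → Enumerates _≟_ L →
       ∀ a (f : A → ℕ) → ∑ L (λ b → χ (does (a ≟ b)) * f b) ≡ f a
∑-δ* _≟_ {L} enum a f = begin
  ∑ L (λ b → χ (does (a ≟ b)) * f b)  ≡⟨ ∑-cong L pointwise ⟩
  ∑ L (λ b → f a * χ (does (a ≟ b)))  ≡⟨ ∑-*ˡ L (f a) _ ⟩
  f a * ∑ L (λ b → χ (does (a ≟ b)))  ≡⟨ cong (f a *_) (enum a) ⟩
  f a * 1                             ≡⟨ *-identityʳ (f a) ⟩
  f a                                 ∎
  where
  open ≡-Reasoning
  pointwise : ∀ b → χ (does (a ≟ b)) * f b ≡ f a * χ (does (a ≟ b))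
  pointwise b with a ≟ b
  ... | yes refl = *-comm 1 (f a)
  ... | no  _    = sym (*-zeroʳ (f a))

Enumerates-∈ : ∀ {_≟_ : DecidableEquality A} {L} → Enumerates _≟_ L → ∀ a → a ∈ L
Enumerates-∈ {A = A} {_≟_} {L} enum a = occurs L (subst (1 ≤_) (sym (enum a)) ≤-refl)
  where
  occurs : ∀ (M : List A) → 1 ≤ ∑ M (λ b → χ (does (a ≟ b))) → a ∈ M
  occurs (x ∷ M) 1≤ with a ≟ x
  ... | yes refl = here refl
  ... | no  _    = there (occurs M 1≤)

Fin-enumerated : ∀ n → Enumerates Fin._≟_ (allFin n)
Fin-enumerated (suc n) a = trans (cong (χ (does (a Fin.≟ zero)) +_) (tail a)) (total a)
  where
  rest : Fin (suc n) → ℕ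
  rest a = ∑ (allFin n) (λ b → χ (does (a Fin.≟ suc b)))
  tail : ∀ a → sum (map (λ b → χ (does (a Fin.≟ b))) (tabulate suc)) ≡ rest a
  tail a = trans (cong (λ L → ∑ L (λ b → χ (does (a Fin.≟ b)))) (sym (map-tabulate (λ i → i) suc)))
                 (∑-map suc (allFin n) _)
  total : ∀ a → χ (does (a Fin.≟ zero)) + rest a ≡ 1
  total zero    = cong suc (∑-zero (allFin n))
  total (suc a) = Fin-enumerated n a

∑-const : ∀ (L : List A) c → ∑ L (λ _ → c) ≡ length L * c
∑-const []      c = refl
∑-const (x ∷ L) c = cong (c +_) (∑-const L c)

_⊆ᵇ_ : (A → Bool) → (A → Bool) → Set
P ⊆ᵇ Q = ∀ x → P x ≡ true → Q x ≡ true

χ-mono : ∀ {a b} → (a ≡ true → b ≡ true) → χ a ≤ χ b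
χ-mono {false}         a⇒b = z≤n
χ-mono {true}  {true}  a⇒b = s≤s z≤n
χ-mono {true}  {false} a⇒b = case a⇒b refl of λ ()

any-∈ : ∀ {P : A → Bool} {L x} → x ∈ L → P x ≡ true → any P L ≡ true
any-∈ {P = P} {L = x ∷ L} (here refl) px rewrite px = refl
any-∈ {P = P} {L = y ∷ L} (there x∈L) px with P y
... | true  = refl
... | false = any-∈ x∈L px

any-witness : ∀ {P : A → Bool} L → any P L ≡ true → ∃[ x ] (x ∈ L × P x ≡ true)
any-witness {P = P} (x ∷ L) eq with P x in px
... | true  = x , here refl , px
... | false = let y , y∈L , py = any-witness L eq in y , there y∈L , py

bool-contradiction : ∀ {b} {C : Set} → b ≡ true → b ≡ false → C
bool-contradiction refl ()

decide : ∀ b → b ≡ true ⊎ b ≡ false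
decide true  = inj₁ refl
decide false = inj₂ refl

does-sound : ∀ {P : Set} (d : Dec P) → does d ≡ true → P
does-sound (yes p) _ = p

excluded-middle : ∀ {P : Set} → (Dec P → ⊥) → ⊥
excluded-middle k = k (no (k ∘ yes))

-- Degree-bounded bases

∅ : ∀ {A : Set} → A → Bool
∅ _ = false

full : ∀ {A : Set} → A → Bool
full _ = true

_∩_ _∪_ : ∀ {A : Set} → (A → Bool) → (A → Bool) → A → Bool
(X ∩ Y) a = X a ∧ Y a
(X ∪ Y) a = X a ∨ Y a

infixr 7 _∩_
infixr 6 _∪_

-- A submodular set function with values in ℕ, presented by its epigraph: Φ Z c
-- says that the value at Z is at most c.
record Submodular {A : Set} (Φ : (A → Bool) → ℕ → Set) : Set where
  field
    restrict : ∀ {Z Z′ c} → Z′ ⊆ᵇ Z → Φ Z c → Φ Z′ c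
    empty    : Φ ∅ 0
    uncross  : ∀ {Z₁ Z₂ c₁ c₂} → Φ Z₁ c₁ → Φ Z₂ c₂ →
               ∃[ c ] ∃[ d ] (Φ (Z₁ ∪ Z₂) c × Φ (Z₁ ∩ Z₂) d × c + d ≤ c₁ + c₂)

module DegreeBound {A : Set} (_≟_ : DecidableEquality A) (P : List A) (enum : Enumerates _≟_ P)
                   {n : ℕ} (s t : A → Fin n) (h : Fin n → ℕ) (R : ℕ)
                   (Φ : (A → Bool) → ℕ → Set) (sub : Submodular Φ) where
  open Submodular sub

  # : (A → Bool) → ℕ
  # Z = ∑ P (χ ∘ Z)

  _-_ : (A → Bool) → A → A → Bool
  (E - e) a = E a ∧ not (does (e ≟ a))

  outside : (A → Bool) → (Fin n → Bool) → A → Bool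
  outside E U e = E e ∧ not (U (s e)) ∧ not (U (t e))

  free : (A → Bool) → (Fin n → Bool) → (A → Bool) → A → Bool
  free E U Z e = E e ∧ U (s e) ∧ U (t e) ∧ not (Z e)

  capacity : (Fin n → Bool) → ℕ
  capacity U = ∑ (allFin n) (λ v → χ (not (U v)) * h v)

  -- Inequality (∗) of the overview. Quantifying over all bounds `c` on the value at `Z` avoids
  -- computing that value, which is a minimum over covers.
  record Condition (E : A → Bool) : Set where
    constructor condition
    field
      bound : ∀ U {Z c} → Φ Z c → R + # (outside E U) ≤ capacity U + c + # (free E U Z)
  open Condition

  record Tight (E : A → Bool) (U : Fin n → Bool) (Z : A → Bool) (c : ℕ) : Set where
    constructor _,_
    field
      cost : Φ Z c
      attained : capacity U + c + # (free E U Z) ≤ R + # (outside E U)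

  -- Deleting `e` lowers the right side of (∗) only at pairs where `e` is free, so a tight pair of
  -- this kind is the obstruction to the deletion.
  Blocked : (A → Bool) → A → Set
  Blocked E e = ∃[ U ] ∃[ Z ] ∃[ c ] (Tight E U Z c × free E U Z e ≡ true)

  capacity-modular : ∀ U₁ U₂ → capacity (U₁ ∪ U₂) + capacity (U₁ ∩ U₂) ≡ capacity U₁ + capacity U₂
  capacity-modular U₁ U₂ = begin
    capacity (U₁ ∪ U₂) + capacity (U₁ ∩ U₂)
      ≡⟨ ∑-+ (allFin n) _ _ ⟨
    ∑ (allFin n) (λ v → χ (not (U₁ v ∨ U₂ v)) * h v + χ (not (U₁ v ∧ U₂ v)) * h v)
      ≡⟨ ∑-cong (allFin n) (λ v → pointwise (U₁ v) (U₂ v) (h v)) ⟩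
    ∑ (allFin n) (λ v → χ (not (U₁ v)) * h v + χ (not (U₂ v)) * h v)
      ≡⟨ ∑-+ (allFin n) _ _ ⟩
    capacity U₁ + capacity U₂ ∎
    where
    open ≡-Reasoning
    pointwise : ∀ a b x → χ (not (a ∨ b)) * x + χ (not (a ∧ b)) * x ≡ χ (not a) * x + χ (not b) * x
    pointwise true  true  x = refl
    pointwise true  false x = refl
    pointwise false true  x = +-comm 0 _
    pointwise false false x = refl

  ∑-+₄ : ∀ (f₁ f₂ f₃ f₄ : A → ℕ) →
         ∑ P (λ e → f₁ e + f₂ e + f₃ e + f₄ e) ≡ ∑ P f₁ + ∑ P f₂ + ∑ P f₃ + ∑ P f₄
  ∑-+₄ f₁ f₂ f₃ f₄ =
    trans (∑-+ P _ f₄) (cong (_+ ∑ P f₄)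
      (trans (∑-+ P _ f₃) (cong (_+ ∑ P f₃) (∑-+ P f₁ f₂))))

  -- An edge joining U₁ ∖ U₂ to U₂ ∖ U₁ may be counted by the first term; the last
  -- term then pays for it.
  edge-uncrossing : ∀ E U₁ U₂ Z₁ Z₂ →
    # (free E (U₁ ∪ U₂) (Z₁ ∪ Z₂)) + # (free E (U₁ ∩ U₂) (Z₁ ∩ Z₂)) + # (outside E U₁) + # (outside E U₂)
    ≤ # (free E U₁ Z₁) + # (free E U₂ Z₂) + # (outside E (U₁ ∪ U₂)) + # (outside E (U₁ ∩ U₂))
  edge-uncrossing E U₁ U₂ Z₁ Z₂ = subst₂ _≤_ (∑-+₄ _ _ _ _) (∑-+₄ _ _ _ _) (∑-mono P λ e →
    pointwise (E e) (U₁ (s e)) (U₁ (t e)) (U₂ (s e)) (U₂ (t e)) (Z₁ e) (Z₂ e))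
    where
    pointwise : ∀ b s₁ t₁ s₂ t₂ z₁ z₂ →
      χ (b ∧ (s₁ ∨ s₂) ∧ (t₁ ∨ t₂) ∧ not (z₁ ∨ z₂)) + χ (b ∧ (s₁ ∧ s₂) ∧ (t₁ ∧ t₂) ∧ not (z₁ ∧ z₂))
        + χ (b ∧ not s₁ ∧ not t₁) + χ (b ∧ not s₂ ∧ not t₂)
      ≤ χ (b ∧ s₁ ∧ t₁ ∧ not z₁) + χ (b ∧ s₂ ∧ t₂ ∧ not z₂)
        + χ (b ∧ not (s₁ ∨ s₂) ∧ not (t₁ ∨ t₂)) + χ (b ∧ not (s₁ ∧ s₂) ∧ not (t₁ ∧ t₂))
    pointwise = ≤-tautology₇ refl

  -- Submodularity bounds the two right sides together by the two left sides together. Since (∗)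
  -- holds at the union and at the intersection separately, neither has slack.
  tight-uncross : ∀ {E U₁ U₂ Z₁ Z₂ c₁ c₂} → Condition E → Tight E U₁ Z₁ c₁ → Tight E U₂ Z₂ c₂ →
    ∃[ c ] ∃[ d ] (Tight E (U₁ ∪ U₂) (Z₁ ∪ Z₂) c × Tight E (U₁ ∩ U₂) (Z₁ ∩ Z₂) d × c + d ≤ c₁ + c₂)
  tight-uncross {E} {U₁} {U₂} {Z₁} {Z₂} {c₁} {c₂} cond (φ₁ , T₁) (φ₂ , T₂)
    with c , d , φ∪ , φ∩ , c+d≤ ← uncross φ₁ φ₂
    = c , d
    , (φ∪ , conclude R (capacity (U₁ ∪ U₂)) c _ _ (capacity (U₁ ∩ U₂)) d _ _
              total (bound cond (U₁ ∩ U₂) φ∩))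
    , (φ∩ , conclude′ R (capacity (U₁ ∪ U₂)) c _ _ (capacity (U₁ ∩ U₂)) d _ _
              total (bound cond (U₁ ∪ U₂) φ∪))
    , c+d≤
    where
    sum-up : ∀ R h₁ c₁ f₁ o₁ h₂ c₂ f₂ o₂ hᵤ cᵤ fᵤ oᵤ hᵢ cᵢ fᵢ oᵢ →
      h₁ + c₁ + f₁ ≤ R + o₁ → h₂ + c₂ + f₂ ≤ R + o₂ → hᵤ + hᵢ ≡ h₁ + h₂ → cᵤ + cᵢ ≤ c₁ + c₂ →
      fᵤ + fᵢ + o₁ + o₂ ≤ f₁ + f₂ + oᵤ + oᵢ →
      (hᵤ + cᵤ + fᵤ) + (hᵢ + cᵢ + fᵢ) ≤ (R + oᵤ) + (R + oᵢ)
    sum-up R h₁ c₁ f₁ o₁ h₂ c₂ f₂ o₂ hᵤ cᵤ fᵤ oᵤ hᵢ cᵢ fᵢ oᵢ p q r u v =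
      farkas 0 (+-mono-≤ (+-mono-≤ (+-mono-≤ p q) (≤-reflexive r)) (+-mono-≤ u v))
        (identity R h₁ c₁ f₁ o₁ h₂ c₂ f₂ o₂ hᵤ cᵤ fᵤ oᵤ hᵢ cᵢ fᵢ oᵢ)
      where
      identity : ∀ R h₁ c₁ f₁ o₁ h₂ c₂ f₂ o₂ hᵤ cᵤ fᵤ oᵤ hᵢ cᵢ fᵢ oᵢ →
        (hᵤ + cᵤ + fᵤ) + (hᵢ + cᵢ + fᵢ)
          + ((R + o₁) + (R + o₂) + (h₁ + h₂) + ((c₁ + c₂) + (f₁ + f₂ + oᵤ + oᵢ))) + 0
        ≡ (R + oᵤ) + (R + oᵢ)
          + ((h₁ + c₁ + f₁) + (h₂ + c₂ + f₂) + (hᵤ + hᵢ) + ((cᵤ + cᵢ) + (fᵤ + fᵢ + o₁ + o₂)))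
      identity = solve-∀
    conclude : ∀ R hᵤ cᵤ fᵤ oᵤ hᵢ cᵢ fᵢ oᵢ →
      (hᵤ + cᵤ + fᵤ) + (hᵢ + cᵢ + fᵢ) ≤ (R + oᵤ) + (R + oᵢ) → R + oᵢ ≤ hᵢ + cᵢ + fᵢ →
      hᵤ + cᵤ + fᵤ ≤ R + oᵤ
    conclude R hᵤ cᵤ fᵤ oᵤ hᵢ cᵢ fᵢ oᵢ tot low =
      +-cancelʳ-≤ (R + oᵢ) _ _ (≤-trans (+-monoʳ-≤ (hᵤ + cᵤ + fᵤ) low) tot)
    conclude′ : ∀ R hᵤ cᵤ fᵤ oᵤ hᵢ cᵢ fᵢ oᵢ →
      (hᵤ + cᵤ + fᵤ) + (hᵢ + cᵢ + fᵢ) ≤ (R + oᵤ) + (R + oᵢ) → R + oᵤ ≤ hᵤ + cᵤ + fᵤ →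
      hᵢ + cᵢ + fᵢ ≤ R + oᵢ
    conclude′ R hᵤ cᵤ fᵤ oᵤ hᵢ cᵢ fᵢ oᵢ tot low =
      +-cancelˡ-≤ (R + oᵤ) _ _ (≤-trans (+-monoˡ-≤ (hᵢ + cᵢ + fᵢ) low) tot)
    total = sum-up R (capacity U₁) c₁ _ _ (capacity U₂) c₂ _ _ (capacity (U₁ ∪ U₂)) c _ _ (capacity (U₁ ∩ U₂)) d _ _
              T₁ T₂ (capacity-modular U₁ U₂) c+d≤ (edge-uncrossing E U₁ U₂ Z₁ Z₂)

  #-strict : ∀ {Z Z′ e} → Z′ ⊆ᵇ Z → Z e ≡ true → Z′ e ≡ false → suc (# Z′) ≤ # Z
  #-strict {Z} {Z′} {e} Z′⊆Z Ze Z′e = begin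
    suc (# Z′)                                              ≡⟨ cong (_+ # Z′) (enum e) ⟨
    ∑ P (λ a → χ (does (e ≟ a))) + # Z′                     ≡⟨ ∑-+ P _ _ ⟨
    ∑ P (λ a → χ (does (e ≟ a)) + χ (Z′ a))                 ≤⟨ ∑-mono P pointwise ⟩
    # Z                                                     ∎
    where
    open ≤-Reasoning
    pointwise : ∀ a → χ (does (e ≟ a)) + χ (Z′ a) ≤ χ (Z a)
    pointwise a with e ≟ a
    ... | yes refl rewrite Ze | Z′e = ≤-refl
    ... | no  _    = χ-mono (Z′⊆Z a)

  free-delete : ∀ E U Z e → # (free E U Z) ≤ # (free (E - e) U Z) + χ (free E U Z e)
  free-delete E U Z e = begin
    # (free E U Z)
      ≤⟨ ∑-mono P pointwise ⟩
    ∑ P (λ a → χ (free (E - e) U Z a) + χ (does (e ≟ a)) * χ (free E U Z a))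
      ≡⟨ ∑-+ P _ _ ⟩
    # (free (E - e) U Z) + ∑ P (λ a → χ (does (e ≟ a)) * χ (free E U Z a))
      ≡⟨ cong (# (free (E - e) U Z) +_) (∑-δ* _≟_ {P} enum e (χ ∘ free E U Z)) ⟩
    # (free (E - e) U Z) + χ (free E U Z e) ∎
    where
    open ≤-Reasoning
    pointwise : ∀ a → χ (free E U Z a) ≤ χ (free (E - e) U Z a) + χ (does (e ≟ a)) * χ (free E U Z a)
    pointwise a = go (E a) (U (s a)) (U (t a)) (Z a) (does (e ≟ a))
      where
      go : ∀ x u v z d → χ (x ∧ u ∧ v ∧ not z) ≤ χ ((x ∧ not d) ∧ u ∧ v ∧ not z) + χ d * χ (x ∧ u ∧ v ∧ not z)
      go = ≤-tautology₅ refl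

  outside-delete : ∀ E U e → # (outside (E - e) U) ≤ # (outside E U)
  outside-delete E U e = ∑-mono P λ a → go (E a) (U (s a)) (U (t a)) (does (e ≟ a))
    where
    go : ∀ x u v d → χ ((x ∧ not d) ∧ not u ∧ not v) ≤ χ (x ∧ not u ∧ not v)
    go = ≤-tautology₄ refl

  -- The right side drops by at most one, and not at all where `e` is not free. A failure of (∗)
  -- after the deletion thus happens at a pair that was tight before and has `e` free.
  unblocked-deletable : ∀ {E e} → Condition E → ¬ Blocked E e → Condition (E - e)
  unblocked-deletable {E} {e} cond unblocked = condition deleted
    where
    deleted : ∀ U {Z c} → Φ Z c → R + # (outside (E - e) U) ≤ capacity U + c + # (free (E - e) U Z)
    deleted U {Z} {c} φ
      with R + # (outside (E - e) U) ≤? capacity U + c + # (free (E - e) U Z)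
    ... | yes ok = ok
    ... | no  fails with free E U Z e in fr
    ...   | true = ⊥-elim (unblocked (U , Z , c , (φ , tight) , fr))
      where
      open ≤-Reasoning
      tight : capacity U + c + # (free E U Z) ≤ R + # (outside E U)
      tight = begin
        capacity U + c + # (free E U Z)              ≤⟨ +-monoʳ-≤ (capacity U + c) (free-delete E U Z e) ⟩
        capacity U + c + (# (free (E - e) U Z) + χ (free E U Z e))  ≡⟨ cong (λ b → capacity U + c + (# (free (E - e) U Z) + χ b)) fr ⟩
        capacity U + c + (# (free (E - e) U Z) + 1)  ≡⟨ +-assoc (capacity U + c) _ 1 ⟨
        capacity U + c + # (free (E - e) U Z) + 1    ≡⟨ +-comm _ 1 ⟩
        suc (capacity U + c + # (free (E - e) U Z))  ≤⟨ ≰⇒> fails ⟩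
        R + # (outside (E - e) U)                    ≤⟨ +-monoʳ-≤ R (outside-delete E U e) ⟩
        R + # (outside E U)                          ∎
    ...   | false = contradiction (begin
        R + # (outside (E - e) U)              ≤⟨ +-monoʳ-≤ R (outside-delete E U e) ⟩
        R + # (outside E U)                    ≤⟨ bound cond U φ ⟩
        capacity U + c + # (free E U Z)        ≤⟨ +-monoʳ-≤ (capacity U + c) (free-delete E U Z e) ⟩
        capacity U + c + (# (free (E - e) U Z) + χ (free E U Z e))  ≡⟨ cong (λ b → capacity U + c + (# (free (E - e) U Z) + χ b)) fr ⟩
        capacity U + c + (# (free (E - e) U Z) + 0)  ≡⟨ cong (capacity U + c +_) (+-identityʳ _) ⟩
        capacity U + c + # (free (E - e) U Z)  ∎) fails
      where open ≤-Reasoning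

  module _ {E : A → Bool} (cond : Condition E) (blocked : ∀ e → E e ≡ true → ¬ ¬ Blocked E e) where

    core : (Fin n → Bool) → (A → Bool) → A → Bool
    core U Z e = E e ∧ U (s e) ∧ U (t e) ∧ Z e

    -- State of a scan through the edges: the core edges met so far lie inside one vertex set `U′`
    -- that is tight with `∅`. The first alternative is there because the empty vertex set need not
    -- be tight.
    Absorbed : (Fin n → Bool) → (A → Bool) → List A → Set
    Absorbed U Z L =
      (∀ {e} → e ∈ L → core U Z e ≡ false) ⊎
      ∃[ U′ ] (U′ ⊆ᵇ U × Tight E U′ ∅ 0 × (∀ {e} → e ∈ L → core U Z e ≡ true → U′ (s e) ∧ U′ (t e) ≡ true))

    tight-∪ : ∀ {U₁ U₂} → Tight E U₁ ∅ 0 → Tight E U₂ ∅ 0 → Tight E (U₁ ∪ U₂) ∅ 0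
    tight-∪ {U₁} {U₂} T₁ T₂ = at-zero _ _ (proj₁ (proj₂ (proj₂ w))) (proj₂ (proj₂ (proj₂ (proj₂ w))))
      where
      w = tight-uncross cond T₁ T₂
      at-zero : ∀ c d → Tight E (U₁ ∪ U₂) ∅ c → c + d ≤ 0 → Tight E (U₁ ∪ U₂) ∅ 0
      at-zero zero d T _ = T

    absorb-edge : ∀ U Z {L e U₂} → Absorbed U Z L → U₂ ⊆ᵇ U → Tight E U₂ ∅ 0 → U₂ (s e) ∧ U₂ (t e) ≡ true →
                  Absorbed U Z (e ∷ L)
    absorb-edge U Z {U₂ = U₂} (inj₁ none) U₂⊆U T₂ e∈U₂ = inj₂ (U₂ , U₂⊆U , T₂ , λ where
      (here refl) _ → e∈U₂
      (there a∈L) c → bool-contradiction c (none a∈L))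
    absorb-edge U Z {e = e} {U₂ = U₂} (inj₂ (U′ , U′⊆U , T′ , cov)) U₂⊆U T₂ e∈U₂ =
      inj₂ (U′ ∪ U₂ , (λ v → within v (decide (U′ v))) , tight-∪ T′ T₂ , λ where
        (here refl) _ → right (U′ (s e)) (U₂ (s e)) (U′ (t e)) (U₂ (t e)) e∈U₂
        {a} (there a∈L) c → left (U′ (s a)) (U₂ (s a)) (U′ (t a)) (U₂ (t a)) (cov a∈L c))
      where
      within : ∀ v → U′ v ≡ true ⊎ U′ v ≡ false → (U′ ∪ U₂) v ≡ true → _
      within v (inj₁ p) _ = U′⊆U v p
      within v (inj₂ p) q rewrite p = U₂⊆U v q
      left : ∀ a b c d → a ∧ c ≡ true → (a ∨ b) ∧ (c ∨ d) ≡ true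
      left true b true d _ = refl
      right : ∀ a b c d → b ∧ d ≡ true → (a ∨ b) ∧ (c ∨ d) ≡ true
      right true  true true  true _ = refl
      right true  true false true _ = refl
      right false true true  true _ = refl
      right false true false true _ = refl

    -- Replacing `Z` by `∅` saves the cost `c` and frees the core edges. Tightness of `(U′, ∅)`
    -- against (∗) at `(U′, Z)` shows that at most `c` edges become free inside `U′`, and `U′` spans
    -- every core edge of `U`.
    absorbed-tight : ∀ {U Z c} → Tight E U Z c → Absorbed U Z P → Tight E U ∅ 0
    absorbed-tight {U} {Z} {c} (φ , T) (inj₁ none) = empty , ≤-trans (+-mono-≤ (+-monoʳ-≤ (capacity U) z≤n)
      (∑-mono∈ P λ {e} e∈P → go (E e) (U (s e)) (U (t e)) (Z e) (none e∈P))) T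
      where
      go : ∀ x u v z → x ∧ u ∧ v ∧ z ≡ false → χ (x ∧ u ∧ v ∧ not false) ≤ χ (x ∧ u ∧ v ∧ not z)
      go true  true  true  false _ = ≤-refl
      go true  true  false z     _ = ≤-refl
      go true  false v     z     _ = ≤-refl
      go false u     v     z     _ = ≤-refl
    absorbed-tight {U} {Z} {c} (φ , T) (inj₂ (U′ , U′⊆U , (_ , T′) , cov)) = empty ,
      combine (capacity U) (capacity U′) R c _ _ _ _ _ _ T T′ (bound cond U′ φ) exchange
      where
      combine : ∀ h h′ R c f f₀ f′ f₀′ o o′ → h + c + f ≤ R + o → h′ + 0 + f₀′ ≤ R + o′ →
                R + o′ ≤ h′ + c + f′ → f₀ + f′ ≤ f + f₀′ → h + 0 + f₀ ≤ R + o
      combine h h′ R c f f₀ f′ f₀′ o o′ p q r u =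
        farkas 0 (+-mono-≤ (+-mono-≤ p q) (+-mono-≤ r u)) (identity h h′ R c f f₀ f′ f₀′ o o′)
        where
        identity : ∀ h h′ R c f f₀ f′ f₀′ o o′ →
          h + 0 + f₀ + ((R + o) + (R + o′) + ((h′ + c + f′) + (f + f₀′))) + 0
          ≡ R + o + ((h + c + f) + (h′ + 0 + f₀′) + ((R + o′) + (f₀ + f′)))
        identity = solve-∀
      exchange : # (free E U ∅) + # (free E U′ Z) ≤ # (free E U Z) + # (free E U′ ∅)
      exchange = subst₂ _≤_ (∑-+ P _ _) (∑-+ P _ _) (∑-mono∈ P λ {e} e∈P →
        go (E e) (U (s e)) (U (t e)) (Z e) (U′ (s e)) (U′ (t e)) (U′⊆U (s e)) (U′⊆U (t e)) (cov e∈P))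
        where
        go : ∀ x u v z u′ v′ → (u′ ≡ true → u ≡ true) → (v′ ≡ true → v ≡ true) →
             (x ∧ u ∧ v ∧ z ≡ true → u′ ∧ v′ ≡ true) →
             χ (x ∧ u ∧ v ∧ true) + χ (x ∧ u′ ∧ v′ ∧ not z) ≤ χ (x ∧ u ∧ v ∧ not z) + χ (x ∧ u′ ∧ v′ ∧ true)
        go false u v z u′ v′ p q r = ≤-refl
        go true u v false u′ v′ p q r = ≤-refl
        go true true true true u′ v′ p q r = χ-cover u′ v′ (r refl)
          where
          χ-cover : ∀ a b → a ∧ b ≡ true → 1 + χ (a ∧ b ∧ false) ≤ χ (a ∧ b ∧ true)
          χ-cover true true _ = ≤-refl
        go true true false true u′ v′ p q r = ≤-tautology₂ {λ a b → χ (a ∧ b ∧ false)} {λ a b → χ (a ∧ b ∧ true)} refl u′ v′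
        go true false v true u′ v′ p q r = ≤-tautology₂ {λ a b → χ (a ∧ b ∧ false)} {λ a b → χ (a ∧ b ∧ true)} refl u′ v′

    SmallerTight : (A → Bool) → Set
    SmallerTight Z = ∀ {U′ Z′ c′} → # Z′ < # Z → Tight E U′ Z′ c′ → ¬ ¬ Tight E U′ ∅ 0

    -- The pair blocking `e` is intersected with `(U, Z)`. As `e` belongs to `Z` but not to `Zₑ`,
    -- the edge set shrinks and induction empties it; both ends of `e` stay in the vertex set.
    absorb-blocked : ∀ {U Z c L e} → SmallerTight Z → Tight E U Z c → core U Z e ≡ true →
                     Absorbed U Z L → Blocked E e → ¬ ¬ Absorbed U Z (e ∷ L)
    absorb-blocked {U} {Z} {c} {L} {e} smaller T ce rec (Uₑ , Zₑ , cₑ , Tₑ , fr) k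
      = smaller (#-strict {Z} {Z ∩ Zₑ} {e} (λ a q → proj₁ (∧-true q)) Ze (cong₂ _∧_ Ze ze))
          (proj₁ (proj₂ (proj₂ (proj₂ (tight-uncross cond T Tₑ))))) λ T₀ →
            k (absorb-edge U Z rec (λ v q → proj₁ (∧-true q)) T₀ (cong₂ _∧_ (cong₂ _∧_ Us us) (cong₂ _∧_ Ut ut)))
      where
      split : ∀ x u v z → x ∧ u ∧ v ∧ z ≡ true → u ≡ true × v ≡ true × z ≡ true
      split true true true z q = refl , refl , q
      not-true : ∀ {z} → not z ≡ true → z ≡ false
      not-true {false} _ = refl
      inner = split (E e) (U (s e)) (U (t e)) (Z e) ce
      outer = split (E e) (Uₑ (s e)) (Uₑ (t e)) (not (Zₑ e)) fr
      Us = proj₁ inner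
      Ut = proj₁ (proj₂ inner)
      Ze = proj₂ (proj₂ inner)
      us = proj₁ outer
      ut = proj₁ (proj₂ outer)
      ze = not-true (proj₂ (proj₂ outer))

    absorb : ∀ {U Z c} → SmallerTight Z → Tight E U Z c → ∀ L → ¬ ¬ Absorbed U Z L
    absorb smaller T [] k = k (inj₁ λ ())
    absorb {U} {Z} smaller T (e ∷ L) k = absorb smaller T L λ rec → extend rec (decide (core U Z e))
      where
      extend : Absorbed U Z L → core U Z e ≡ true ⊎ core U Z e ≡ false → ⊥
      extend rec (inj₁ ce) = blocked e (proj₁ (∧-true ce)) λ b → absorb-blocked smaller T ce rec b k
      extend (inj₁ none) (inj₂ ce) = k (inj₁ λ { (here refl) → ce ; (there a∈L) → none a∈L })
      extend (inj₂ (U′ , U′⊆U , T′ , cov)) (inj₂ ce) =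
        k (inj₂ (U′ , U′⊆U , T′ , λ { (here refl) c → bool-contradiction c ce ; (there a∈L) → cov a∈L }))

    tight-∅ : ∀ z {U Z c} → # Z ≤ z → Tight E U Z c → ¬ ¬ Tight E U ∅ 0
    tight-∅ zero Z≤z T k =
      absorb (λ {U′} {Z′} lt → contradiction (≤-trans lt Z≤z) λ ()) T P (k ∘ absorbed-tight T)
    tight-∅ (suc z) Z≤z T k =
      absorb (λ {U′} {Z′} lt → tight-∅ z (s≤s⁻¹ (≤-trans lt Z≤z))) T P (k ∘ absorbed-tight T)

    -- Covering everything costs `R` and leaves no free edge, so `(full, full)` is tight. At
    -- `(full, ∅)` every edge is free, and tightness becomes a bound on their number.
    blocked-size : Φ full R → ¬ ¬ (# E ≤ R)
    blocked-size φ k = tight-∅ (# full) {full} {full} {R} ≤-refl (φ , whole) λ (_ , T) → k (begin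
      # E                          ≤⟨ ∑-mono P (λ e → go (E e)) ⟩
      # (free E full ∅)            ≤⟨ m≤n+m _ (capacity full + 0) ⟩
      capacity full + 0 + # (free E full ∅)  ≤⟨ T ⟩
      R + # (outside E full)       ≡⟨ cong (R +_) (trans (∑-cong P (λ e → go′ (E e))) (∑-zero P)) ⟩
      R + 0                        ≡⟨ +-identityʳ R ⟩
      R                            ∎)
      where
      open ≤-Reasoning
      go : ∀ x → χ x ≤ χ (x ∧ true)
      go = ≤-tautology₁ refl
      go′ : ∀ x → χ (x ∧ false) ≡ 0
      go′ x = n≤0⇒n≡0 (≤-tautology₁ {λ x → χ (x ∧ false)} refl x)
      whole : capacity full + R + # (free E full full) ≤ R + # (outside E full)
      whole = begin
        capacity full + R + # (free E full full)
          ≡⟨ cong₂ (λ a b → a + R + b) (∑-zero (allFin n)) (trans (∑-cong P (λ e → go′ (E e))) (∑-zero P)) ⟩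
        R + 0                        ≤⟨ +-monoʳ-≤ R z≤n ⟩
        R + # (outside E full)       ∎

  delete-⊆ : ∀ E e → (E - e) ⊆ᵇ E
  delete-⊆ E e a q = proj₁ (∧-true q)

  #-delete : ∀ E {e} → E e ≡ true → # (E - e) < # E
  #-delete E {e} Ee = #-strict (delete-⊆ E e) Ee (go (E e))
    where
    go : ∀ x → x ∧ not (does (e ≟ e)) ≡ false
    go x rewrite dec-true (e ≟ e) refl = ∧-zeroʳ x

  -- `z` is fuel for the deletions. Stopping at `# E ≤ R` is enough, because (∗) at `(full, ∅)`
  -- forces the reverse inequality.
  spanning-subset : Φ full R → ∀ z E → # E ≤ z → Condition E →
                    ¬ ¬ (∃[ H ] (H ⊆ᵇ E × Condition H × # H ≤ R))
  spanning-subset φ zero    E E≤z cond k = k (E , (λ _ q → q) , cond , ≤-trans E≤z z≤n)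
  spanning-subset φ (suc z) E E≤z cond k with # E ≤? R
  ... | yes E≤R = k (E , (λ _ q → q) , cond , E≤R)
  ... | no  E≰R = excluded-middle {P = ∃[ e ] (E e ≡ true × Condition (E - e))} λ where
    (yes (e , Ee , cond′)) →
      spanning-subset φ z (E - e) (s≤s⁻¹ (≤-trans (#-delete E Ee) E≤z)) cond′
        λ (H , H⊆ , rest) → k (H , (λ a q → delete-⊆ E e a (H⊆ a q)) , rest)
    (no stuck) →
      blocked-size {E} cond (λ e Ee ¬b → stuck (e , Ee , unblocked-deletable cond ¬b)) φ E≰R

-- Matroid union

module Packing {A I : Set} (_≟_ : DecidableEquality A) (P : List A) (enum : Enumerates _≟_ P)
               (_≟ᵢ_ : DecidableEquality I) (Is : List I) (enumᵢ : Enumerates _≟ᵢ_ Is)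
               (F : I → (A → Bool) → ℕ → Set) (sub : ∀ i → Submodular (F i)) where
  open module Sub i = Submodular (sub i)

  Total : (A → Bool) → ℕ → Set
  Total Z c = Σ[ f ∈ (I → ℕ) ] ((∀ i → F i Z (f i)) × ∑ Is f ≡ c)

  Total-submodular : Submodular Total
  Total-submodular = record
    { restrict = λ Z′⊆Z (f , Ff , eq) → f , (λ i → restrict i Z′⊆Z (Ff i)) , eq
    ; empty    = (λ _ → 0) , empty , ∑-zero Is
    ; uncross  = λ (f , Ff , eq) (g , Fg , eq′) →
        let w i = uncross i (Ff i) (Fg i)
            c i = proj₁ (w i)
            d i = proj₁ (proj₂ (w i))
        in ∑ Is c , ∑ Is d
         , (c , (λ i → proj₁ (proj₂ (proj₂ (w i)))) , refl)
         , (d , (λ i → proj₁ (proj₂ (proj₂ (proj₂ (w i))))) , refl)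
         , subst₂ _≤_ (∑-+ Is c d) (trans (∑-+ Is f g) (cong₂ _+_ eq eq′))
             (∑-mono Is (λ i → proj₂ (proj₂ (proj₂ (proj₂ (w i))))))
    }

  # : (A → Bool) → ℕ
  # Z = ∑ P (χ ∘ Z)

  label-is : Maybe I → I → Bool
  label-is nothing  i = false
  label-is (just j) i = does (j ≟ᵢ i)

  class : (A → Maybe I) → I → A → Bool
  class asg i a = label-is (asg a) i

  assigned : (A → Maybe I) → A → Bool
  assigned asg a = is-just (asg a)

  assign : A → I → (A → Maybe I) → A → Maybe I
  assign e i asg a = if does (e ≟ a) then just i else asg a

  ∑-class : ∀ asg → ∑ Is (λ i → # (class asg i)) ≡ # (assigned asg)
  ∑-class asg = trans (∑-swap Is P _) (∑-cong P (λ a → pointwise (asg a)))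
    where
    pointwise : ∀ x → ∑ Is (λ i → χ (label-is x i)) ≡ χ (is-just x)
    pointwise nothing  = ∑-zero Is
    pointwise (just j) = enumᵢ j

  module _ (E : A → Bool) where

    Unassigned : (A → Maybe I) → (A → Bool) → Set
    Unassigned asg Y = ∀ a → Y a ≡ true → E a ≡ true × asg a ≡ nothing

    -- Edmonds' partition condition for the unassigned elements in the matroids contracted by their
    -- classes. The class sizes are moved to the left side, where they add up to `# (assigned asg)`,
    -- so no contraction has to be formed.
    record Extendable (asg : A → Maybe I) : Set where
      constructor extendable
      field
        bound : ∀ Y → Unassigned asg Y → ∀ c → (∀ i → F i (Y ∪ class asg i) (c i)) →
                # Y + # (assigned asg) ≤ ∑ Is c
    open Extendable

    -- For a single copy in `J` this is the failure of `Extendable` once `e` is assigned to that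
    -- copy: one more assigned element would exceed the costs. Sets `J` of several copies arise by
    -- uncrossing.
    record Violation (asg : A → Maybe I) (e : A) (J : I → Bool) : Set where
      constructor violation
      field
        Y     : A → Bool
        c     : I → ℕ
        Y⊆    : Unassigned asg Y
        e∉Y   : Y e ≡ false
        costs : ∀ i → F i (λ a → Y a ∨ class asg i a ∨ (J i ∧ does (e ≟ a))) (c i)
        small : ∑ Is c ≤ # Y + # (assigned asg)

    #-∪∩ : ∀ (Y₁ Y₂ : A → Bool) → # (Y₁ ∪ Y₂) + # (Y₁ ∩ Y₂) ≡ # Y₁ + # Y₂
    #-∪∩ Y₁ Y₂ = trans (sym (∑-+ P _ _)) (trans (∑-cong P (λ a → pointwise (Y₁ a) (Y₂ a))) (∑-+ P _ _))
      where
      pointwise : ∀ x y → χ (x ∨ y) + χ (x ∧ y) ≡ χ x + χ y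
      pointwise true  y = refl
      pointwise false y = +-identityʳ (χ y)

    violation-∪ : ∀ {asg e J₁ J₂} → Extendable asg → Violation asg e J₁ → Violation asg e J₂ →
                  Violation asg e (J₁ ∪ J₂)
    violation-∪ {asg} {e} {J₁} {J₂} ext (violation Y₁ c₁ Y₁⊆ e∉Y₁ costs₁ small₁) (violation Y₂ c₂ Y₂⊆ e∉Y₂ costs₂ small₂) =
      violation (Y₁ ∪ Y₂) c ∪-unassigned (cong₂ _∨_ e∉Y₁ e∉Y₂)
        (λ i → restrict i (λ a → on-union (Y₁ a) (Y₂ a) (class asg i a) (J₁ i) (J₂ i) (does (e ≟ a)))
                 (proj₁ (proj₂ (proj₂ (w i)))))
        (combine (∑ Is c) (∑ Is d) (∑ Is c₁) (∑ Is c₂) (# (Y₁ ∪ Y₂)) (# (Y₁ ∩ Y₂)) (# Y₁) (# Y₂) (# (assigned asg))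
          total small₁ small₂ (#-∪∩ Y₁ Y₂)
          (bound ext (Y₁ ∩ Y₂) (λ a q → Y₁⊆ a (proj₁ (∧-true q))) d (λ i →
            restrict i (λ a → on-meet (Y₁ a) (Y₂ a) (class asg i a) (J₁ i ∧ does (e ≟ a)) (J₂ i ∧ does (e ≟ a)))
              (proj₁ (proj₂ (proj₂ (proj₂ (w i))))))))
      where
      w : ∀ i → _
      w i = uncross i (costs₁ i) (costs₂ i)
      c d : I → ℕ
      c i = proj₁ (w i)
      d i = proj₁ (proj₂ (w i))
      ∪-unassigned : Unassigned asg (Y₁ ∪ Y₂)
      ∪-unassigned a q with Y₁ a in y₁
      ... | true  = Y₁⊆ a y₁
      ... | false = Y₂⊆ a q
      on-union : ∀ y₁ y₂ x j₁ j₂ d → (y₁ ∨ y₂) ∨ x ∨ ((j₁ ∨ j₂) ∧ d) ≡ true →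
                 (y₁ ∨ x ∨ (j₁ ∧ d)) ∨ (y₂ ∨ x ∨ (j₂ ∧ d)) ≡ true
      on-union true  y₂    x     j₁    j₂    d    _ = refl
      on-union false y₂    true  j₁    j₂    d    _ = refl
      on-union false y₂    false true  j₂    true _ = refl
      on-union false true  false j₁    j₂    d    _ with j₁ ∧ d
      ... | true  = refl
      ... | false = refl
      on-union false false false false true  true _ = refl
      on-union false false false true  true  false ()
      on-meet : ∀ y₁ y₂ x u v → (y₁ ∧ y₂) ∨ x ≡ true → (y₁ ∨ x ∨ u) ∧ (y₂ ∨ x ∨ v) ≡ true
      on-meet true  true  x    u v _ = refl
      on-meet true  false true u v _ = refl
      on-meet false true  true u v _ = refl
      on-meet false false true u v _ = refl
      total : ∑ Is c + ∑ Is d ≤ ∑ Is c₁ + ∑ Is c₂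
      total = subst₂ _≤_ (∑-+ Is c d) (∑-+ Is c₁ c₂) (∑-mono Is (λ i → proj₂ (proj₂ (proj₂ (proj₂ (w i))))))
      combine : ∀ c d c₁ c₂ u i y₁ y₂ z → c + d ≤ c₁ + c₂ → c₁ ≤ y₁ + z → c₂ ≤ y₂ + z → u + i ≡ y₁ + y₂ →
                i + z ≤ d → c ≤ u + z
      combine c d c₁ c₂ u i y₁ y₂ z p q r s t =
        farkas 0 (+-mono-≤ (+-mono-≤ p q) (+-mono-≤ (+-mono-≤ r (≤-reflexive (sym s))) t))
          (identity c d c₁ c₂ u i y₁ y₂ z)
        where
        identity : ∀ c d c₁ c₂ u i y₁ y₂ z →
          c + ((c₁ + c₂) + (y₁ + z) + ((y₂ + z) + (u + i) + d)) + 0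
          ≡ u + z + ((c + d) + c₁ + (c₂ + (y₁ + y₂) + (i + z)))
        identity = solve-∀

    #-singleton-∪ : ∀ {Y e} → Y e ≡ false → # (λ a → Y a ∨ does (e ≟ a)) ≡ suc (# Y)
    #-singleton-∪ {Y} {e} e∉Y =
      trans (∑-cong P pointwise) (trans (∑-+ P _ _) (cong (_+ # Y) (enum e)))
      where
      pointwise : ∀ a → χ (Y a ∨ does (e ≟ a)) ≡ χ (does (e ≟ a)) + χ (Y a)
      pointwise a with e ≟ a
      ... | yes refl rewrite e∉Y = refl
      ... | no  _    = cong χ (∨-identityʳ (Y a))

    -- When every copy has received `e`, the edge may as well be added to `Y`: the costs do not
    -- change, but the left side of `Extendable` grows by one.
    total-violation : ∀ {asg e J} → Extendable asg → E e ≡ true → asg e ≡ nothing → (∀ i → J i ≡ true) →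
                      ¬ Violation asg e J
    total-violation {asg} {e} {J} ext Ee free all (violation Y c Y⊆ e∉Y costs small) =
      <-irrefl refl (≤-trans (s≤s small)
        (subst (λ x → x + # (assigned asg) ≤ ∑ Is c) (#-singleton-∪ e∉Y)
          (bound ext (λ a → Y a ∨ does (e ≟ a)) unassigned c
            (λ i → restrict i (λ a q → regroup (Y a) (class asg i a) (does (e ≟ a)) (J i) (all i) q) (costs i)))))
      where
      unassigned : Unassigned asg (λ a → Y a ∨ does (e ≟ a))
      unassigned a q with Y a in y | e ≟ a
      ... | true  | _        = Y⊆ a y
      ... | false | yes refl = Ee , free
      regroup : ∀ y x d j → j ≡ true → (y ∨ d) ∨ x ≡ true → y ∨ x ∨ (j ∧ d) ≡ true
      regroup true  x     d    j    _    _ = refl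
      regroup false true  d    j    _    _ = refl
      regroup false false true true refl _ = refl

    assigned-assign : ∀ {asg e} i → asg e ≡ nothing → # (assigned (assign e i asg)) ≡ suc (# (assigned asg))
    assigned-assign {asg} {e} i free = trans (∑-cong P pointwise) (#-singleton-∪ (cong is-just free))
      where
      pointwise : ∀ a → χ (assigned (assign e i asg) a) ≡ χ (assigned asg a ∨ does (e ≟ a))
      pointwise a with e ≟ a
      ... | yes refl rewrite free = refl
      ... | no  _    = cong χ (sym (∨-identityʳ (assigned asg a)))

    unviolated-extendable : ∀ {asg e} i → E e ≡ true → asg e ≡ nothing → ¬ Violation asg e (λ j → does (i ≟ᵢ j)) →
                            Extendable (assign e i asg)
    unviolated-extendable {asg} {e} i Ee free ¬viol = extendable extended
      where
      extended : ∀ Y → Unassigned (assign e i asg) Y → ∀ c → (∀ j → F j (Y ∪ class (assign e i asg) j) (c j)) →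
                 # Y + # (assigned (assign e i asg)) ≤ ∑ Is c
      extended Y Y⊆ c costs with # Y + # (assigned (assign e i asg)) ≤? ∑ Is c
      ... | yes ok = ok
      ... | no fails = ⊥-elim (¬viol (violation Y c Y⊆′ e∉Y
              (λ j → restrict j (λ a → relabel j a) (costs j))
              (s≤s⁻¹ (subst (∑ Is c <_) (trans (cong (# Y +_) (assigned-assign i free)) (+-suc _ _)) (≰⇒> fails)))))
        where
        Y⊆′ : Unassigned asg Y
        Y⊆′ a q with e ≟ a | Y⊆ a q
        ... | no _     | Ea , eq = Ea , eq
        e∉Y : Y e ≡ false
        e∉Y with Y e in y
        ... | false = refl
        ... | true with e ≟ e | Y⊆ e y
        ...   | no e≢e | _ = contradiction refl e≢e
        relabel : ∀ j a → Y a ∨ class asg j a ∨ (does (i ≟ᵢ j) ∧ does (e ≟ a)) ≡ true →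
                  Y a ∨ class (assign e i asg) j a ≡ true
        relabel j a q with Y a | e ≟ a
        ... | true  | _        = refl
        ... | false | yes refl rewrite free with i ≟ᵢ j
        ...   | yes _ = refl
        relabel j a q | false | no _ with class asg j a | i ≟ᵢ j
        ...   | true  | _     = refl
        ...   | false | yes _ = q
        ...   | false | no  _ = q

    extend-by-one : ∀ {asg e} → Extendable asg → E e ≡ true → asg e ≡ nothing →
                    ¬ ¬ (∃[ i ] Extendable (assign e i asg))
    extend-by-one {asg} {e} ext Ee free k = collect Is finish
      where
      listed : List I → I → Bool
      listed []      j = false
      listed (i ∷ L) j = does (i ≟ᵢ j) ∨ listed L j
      widen : ∀ {i} → Violation asg e (λ j → does (i ≟ᵢ j)) → Violation asg e (listed (i ∷ []))
      widen (violation Y c Y⊆ e∉Y costs small) = violation Y c Y⊆ e∉Y (λ j → restrict j (λ a →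
        subst (λ b → Y a ∨ class asg j a ∨ (b ∧ does (e ≟ a)) ≡ true) (∨-identityʳ _)) (costs j)) small
      collect : ∀ L → ¬ ¬ (L ≡ [] ⊎ Violation asg e (listed L))
      collect []      k′ = k′ (inj₁ refl)
      collect (i ∷ L) k′ = collect L λ rec → excluded-middle λ where
        (no ¬viol) → k (i , unviolated-extendable i Ee free ¬viol)
        (yes viol) → case rec of λ where
          (inj₁ refl) → k′ (inj₂ (widen viol))
          (inj₂ rest) → k′ (inj₂ (violation-∪ ext viol rest))
      listed-∈ : ∀ {L i} → i ∈ L → listed L i ≡ true
      listed-∈ {i ∷ L} (here refl) = cong (_∨ listed L i) (dec-true (i ≟ᵢ i) refl)
      listed-∈ {j ∷ L} {i} (there i∈L) with j ≟ᵢ i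
      ... | yes _ = refl
      ... | no  _ = listed-∈ i∈L
      finish : Is ≡ [] ⊎ Violation asg e (listed Is) → ⊥
      finish (inj₂ viol) = total-violation ext Ee free (λ i → listed-∈ {Is} (Enumerates-∈ {_≟_ = _≟ᵢ_} enumᵢ i)) viol
      -- Without copies the empty witness is already total, and `Extendable` fails at `e` alone.
      finish (inj₁ eq) = total-violation {J = ∅} ext Ee free (λ i → none i)
        (violation ∅ (λ _ → 0) (λ _ ()) refl (λ i → none i) (subst (λ L → ∑ L (λ _ → 0) ≤ # ∅ + # (assigned asg)) (sym eq) z≤n))
        where
        none : ∀ {C : Set} → I → C
        none i with () ← subst (i ∈_) eq (Enumerates-∈ {_≟_ = _≟ᵢ_} enumᵢ i)

    record Complete : Set where
      constructor complete
      field
        asg      : A → Maybe I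
        ext      : Extendable asg
        covered  : ∀ a → E a ≡ true → assigned asg a ≡ true
        within   : ∀ a → assigned asg a ≡ true → E a ≡ true

    complete-packing : ∀ L asg → Extendable asg → (∀ a → assigned asg a ≡ true → E a ≡ true) →
                       (∀ a → E a ≡ true → asg a ≡ nothing → a ∈ L) → ¬ ¬ Complete
    complete-packing [] asg ext within todo k = k (complete asg ext covered within)
      where
      covered : ∀ a → E a ≡ true → assigned asg a ≡ true
      covered a Ea with asg a in eq
      ... | just _  = refl
      ... | nothing with () ← todo a Ea eq
    complete-packing (e ∷ L) asg ext within todo k with E e in Ee | asg e in eq
    ... | false | _ = complete-packing L asg ext within todo′ k
      where
      todo′ : ∀ a → E a ≡ true → asg a ≡ nothing → a ∈ L
      todo′ a Ea free with todo a Ea free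
      ... | here refl = bool-contradiction Ea Ee
      ... | there a∈L = a∈L
    ... | true | just _ = complete-packing L asg ext within todo′ k
      where
      todo′ : ∀ a → E a ≡ true → asg a ≡ nothing → a ∈ L
      todo′ a Ea free with todo a Ea free
      ... | here refl = case trans (sym eq) free of λ ()
      ... | there a∈L = a∈L
    ... | true | nothing = extend-by-one ext Ee eq λ (i , ext′) →
            complete-packing L (assign e i asg) ext′ (within′ i) (todo′ i) k
      where
      within′ : ∀ i a → assigned (assign e i asg) a ≡ true → E a ≡ true
      within′ i a q with e ≟ a
      ... | yes refl = Ee
      ... | no  _    = within a q
      todo′ : ∀ i a → E a ≡ true → assign e i asg a ≡ nothing → a ∈ L
      todo′ i a Ea free with e ≟ a
      ... | no e≢a with todo a Ea free
      ...   | here refl = contradiction refl e≢a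
      ...   | there a∈L = a∈L

    -- All other copies are charged exactly the size of their class, which `trivial` permits.
    -- `Extendable` at the empty `Y` then leaves the inequality for copy `i`.
    class-bound : ∀ {asg} → Extendable asg → (∀ i → F i (class asg i) (# (class asg i))) →
                  ∀ {i c} → F i (class asg i) c → # (class asg i) ≤ c
    class-bound {asg} ext trivial {i} {c} Fc = finish (∑ Is size) (∑ Is f) (size i) c total balance
      where
      size f : I → ℕ
      size j = # (class asg j)
      f j with i ≟ᵢ j
      ... | yes _ = c
      ... | no  _ = size j
      costs : ∀ j → F j (class asg j) (f j)
      costs j with i ≟ᵢ j
      ... | yes refl = Fc
      ... | no  _    = trivial j
      total : ∑ Is size ≤ ∑ Is f
      total = subst (_≤ ∑ Is f) (sym (∑-class asg))
        (≤-trans (m≤n+m _ (# ∅)) (bound ext ∅ (λ _ ()) f costs))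
      balance : ∑ Is f + size i ≡ ∑ Is size + c
      balance = begin
        ∑ Is f + size i
          ≡⟨ cong (∑ Is f +_) (∑-δ* _≟ᵢ_ {Is} enumᵢ i size) ⟨
        ∑ Is f + ∑ Is (λ j → χ (does (i ≟ᵢ j)) * size j)
          ≡⟨ ∑-+ Is _ _ ⟨
        ∑ Is (λ j → f j + χ (does (i ≟ᵢ j)) * size j)
          ≡⟨ ∑-cong Is pointwise ⟩
        ∑ Is (λ j → size j + χ (does (i ≟ᵢ j)) * c)
          ≡⟨ ∑-+ Is _ _ ⟩
        ∑ Is size + ∑ Is (λ j → χ (does (i ≟ᵢ j)) * c)
          ≡⟨ cong (∑ Is size +_) (∑-δ* _≟ᵢ_ {Is} enumᵢ i (λ _ → c)) ⟩
        ∑ Is size + c ∎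
        where
        open ≡-Reasoning
        pointwise : ∀ j → f j + χ (does (i ≟ᵢ j)) * size j ≡ size j + χ (does (i ≟ᵢ j)) * c
        pointwise j with i ≟ᵢ j
        ... | yes _ = trans (+-comm c _) (cong₂ _+_ (+-identityʳ (size j)) (sym (+-identityʳ c)))
        ... | no  _ = refl
      finish : ∀ S T x c → S ≤ T → T + x ≡ S + c → x ≤ c
      finish S T x c S≤T eq = +-cancelˡ-≤ S x c (≤-trans (+-monoˡ-≤ x S≤T) (≤-reflexive eq))

-- Count matroids

VertexSet : ℕ → Set
VertexSet n = Fin n → Bool

card : ∀ {n} → VertexSet n → ℕ
card {n} X = ∑ (allFin n) (χ ∘ X)

card-∪∩ : ∀ {n} (X Y : VertexSet n) → card (X ∪ Y) + card (X ∩ Y) ≡ card X + card Y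
card-∪∩ {n} X Y =
  trans (sym (∑-+ (allFin n) _ _)) (trans (∑-cong (allFin n) (λ v → pointwise (X v) (Y v))) (∑-+ (allFin n) _ _))
  where
  pointwise : ∀ x y → χ (x ∨ y) + χ (x ∧ y) ≡ χ x + χ y
  pointwise true  y = refl
  pointwise false y = +-identityʳ (χ y)

card-mono : ∀ {n} {X Y : VertexSet n} → X ⊆ᵇ Y → card X ≤ card Y
card-mono {n} X⊆Y = ∑-mono (allFin n) (λ v → χ-mono (X⊆Y v))

card-full : ∀ n → card {n} full ≡ n
card-full n = trans (∑-const (allFin n) 1) (trans (*-identityʳ _) (length-tabulate {n = n} (λ i → i)))

card-complement : ∀ {n} (X : VertexSet n) → card X + card (not ∘ X) ≡ n
card-complement {n} X = trans (sym (∑-+ (allFin n) _ _)) (trans (∑-cong (allFin n) (λ v → pointwise (X v))) (card-full n))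
  where
  pointwise : ∀ b → χ b + χ (not b) ≡ 1
  pointwise true  = refl
  pointwise false = refl

pair : ∀ {n} → Fin n → Fin n → VertexSet n
pair u v w = does (u Fin.≟ w) ∨ does (v Fin.≟ w)

card-pair : ∀ {n} {u v : Fin n} → u ≢ v → card (pair u v) ≡ 2
card-pair {n} {u} {v} u≢v = begin
  card (pair u v)                                                   ≡⟨ ∑-cong (allFin n) pointwise ⟩
  ∑ (allFin n) (λ w → χ (does (u Fin.≟ w)) + χ (does (v Fin.≟ w)))  ≡⟨ ∑-+ (allFin n) _ _ ⟩
  _                                                                 ≡⟨ cong₂ _+_ (Fin-enumerated n u) (Fin-enumerated n v) ⟩
  2                                                                 ∎
  where
  open ≡-Reasoning
  pointwise : ∀ w → χ (pair u v w) ≡ χ (does (u Fin.≟ w)) + χ (does (v Fin.≟ w))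
  pointwise w with u Fin.≟ w | v Fin.≟ w
  ... | yes refl | yes refl = contradiction refl u≢v
  ... | yes _    | no  _    = refl
  ... | no  _    | yes _    = refl
  ... | no  _    | no  _    = refl

card-distinct : ∀ {n} {X : VertexSet n} {u v} → u ≢ v → X u ∧ X v ≡ true → 2 ≤ card X
card-distinct {n} {X} {u} {v} u≢v q = subst (_≤ card X) (card-pair u≢v) (card-mono member)
  where
  member : pair u v ⊆ᵇ X
  member w r with u Fin.≟ w | v Fin.≟ w
  ... | yes refl | _        = proj₁ (∧-true q)
  ... | no  _    | yes refl = proj₂ (∧-true {X u} q)

-- k|X| − (2k − 1) for |X| ≥ 2.
weight : ∀ {n} → ℕ → VertexSet n → ℕ
weight k X = k * (card X ∸ 2) + 1

cost : ∀ {n} → ℕ → List (VertexSet n) → ℕ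
cost k 𝓧 = ∑ 𝓧 (weight k)

AtLeast₂ : ∀ {n} → List (VertexSet n) → Set
AtLeast₂ = All (λ X → 2 ≤ card X)

covers : ∀ {n} → List (VertexSet n) → Fin n → Fin n → Bool
covers 𝓧 u v = any (λ X → X u ∧ X v) 𝓧

-- `card` is modular, and since all four sets have at least two vertices the truncated subtraction
-- is exact and the constant 2k - 1 occurs twice on each side.
weight-uncross : ∀ {n} k (X Y : VertexSet n) → 2 ≤ card X → 2 ≤ card Y → 2 ≤ card (X ∩ Y) →
                 weight k (X ∪ Y) + weight k (X ∩ Y) ≡ weight k X + weight k Y
weight-uncross k X Y 2≤X 2≤Y 2≤∩ =
  arithmetic (≤-trans 2≤X (card-mono {X = X} {X ∪ Y} (λ v → left (X v) (Y v)))) 2≤∩ 2≤X 2≤Y (card-∪∩ X Y)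
  where
  left : ∀ x y → x ≡ true → x ∨ y ≡ true
  left true y _ = refl
  factor : ∀ k a b → (k * a + 1) + (k * b + 1) ≡ k * (a + b) + 2
  factor = solve-∀
  arithmetic : ∀ {a b c d} → 2 ≤ a → 2 ≤ b → 2 ≤ c → 2 ≤ d → a + b ≡ c + d →
               (k * (a ∸ 2) + 1) + (k * (b ∸ 2) + 1) ≡ (k * (c ∸ 2) + 1) + (k * (d ∸ 2) + 1)
  arithmetic {suc (suc a)} {suc (suc b)} {suc (suc c)} {suc (suc d)} (s≤s (s≤s _)) (s≤s (s≤s _)) (s≤s (s≤s _)) (s≤s (s≤s _)) eq =
    trans (factor k a b) (trans (cong (λ x → k * x + 2) (shift a b c d eq)) (sym (factor k c d)))
    where
    shift : ∀ a b c d → 2 + (a + (2 + b)) ≡ 2 + (c + (2 + d)) → a + b ≡ c + d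
    shift a b c d eq = +-cancelˡ-≡ 4 _ _ (trans (move a b) (trans eq (sym (move c d))))
      where
      move : ∀ a b → 4 + (a + b) ≡ 2 + (a + (2 + b))
      move = solve-∀

-- Only pairs of distinct vertices are tracked. Members with at most one common vertex share no such
-- pair and can be left alone, although their weights would not uncross; hence `costs` is even an
-- equation.
record Uncrossing {n} (k total : ℕ) (X∪𝓨 X∩𝓨 : Fin n → Fin n → Bool) : Set where
  constructor uncrossing
  field
    𝓟 𝓠  : List (VertexSet n)
    ≥₂𝓟  : AtLeast₂ 𝓟
    ≥₂𝓠  : AtLeast₂ 𝓠
    costs : cost k 𝓟 + cost k 𝓠 ≡ total
    join  : ∀ {u v} → u ≢ v → X∪𝓨 u v ≡ true → covers 𝓟 u v ≡ true
    meet  : ∀ {u v} → u ≢ v → X∩𝓨 u v ≡ true → covers 𝓠 u v ≡ true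

-- Sets meeting X in at least two vertices are merged into it one after the
-- other, and the intersections are collected in 𝓠.
insert : ∀ {n} k (X : VertexSet n) 𝓨 → 2 ≤ card X → AtLeast₂ 𝓨 →
         Uncrossing k (weight k X + cost k 𝓨) (λ u v → (X u ∧ X v) ∨ covers 𝓨 u v)
                                              (λ u v → (X u ∧ X v) ∧ covers 𝓨 u v)
insert k X [] 2≤X [] = uncrossing (X ∷ []) [] (2≤X ∷ []) [] (+-identityʳ _) (λ _ q → q)
  (λ {u} {v} _ q → proj₂ (∧-true {X u ∧ X v} q))
insert k X (Y ∷ 𝓨) 2≤X (2≤Y ∷ 2≤𝓨) with 2 ≤? card (X ∩ Y)
... | yes 2≤∩ with uncrossing 𝓟 𝓠 ≥₂𝓟 ≥₂𝓠 eq join meet ←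
        insert k (X ∪ Y) 𝓨 (≤-trans 2≤X (card-mono {X = X} {X ∪ Y} (λ v q → cong (_∨ Y v) q))) 2≤𝓨
      = uncrossing 𝓟 (X ∩ Y ∷ 𝓠) ≥₂𝓟 (2≤∩ ∷ ≥₂𝓠) total
          (λ {u} {v} u≢v q → join u≢v (absorb (X u) (Y u) (X v) (Y v) (covers 𝓨 u v) q))
          (λ {u} {v} u≢v q → collect u≢v q (decide (Y u ∧ Y v)))
  where
  open ≡-Reasoning
  total : cost k 𝓟 + (weight k (X ∩ Y) + cost k 𝓠) ≡ weight k X + (weight k Y + cost k 𝓨)
  total = begin
    cost k 𝓟 + (weight k (X ∩ Y) + cost k 𝓠)                ≡⟨ rotate (cost k 𝓟) (weight k (X ∩ Y)) (cost k 𝓠) ⟩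
    weight k (X ∩ Y) + (cost k 𝓟 + cost k 𝓠)                ≡⟨ cong (weight k (X ∩ Y) +_) eq ⟩
    weight k (X ∩ Y) + (weight k (X ∪ Y) + cost k 𝓨)        ≡⟨ swap (weight k (X ∩ Y)) (weight k (X ∪ Y)) (cost k 𝓨) ⟩
    weight k (X ∪ Y) + weight k (X ∩ Y) + cost k 𝓨          ≡⟨ cong (_+ cost k 𝓨) (weight-uncross k X Y 2≤X 2≤Y 2≤∩) ⟩
    weight k X + weight k Y + cost k 𝓨                      ≡⟨ +-assoc (weight k X) _ _ ⟩
    weight k X + (weight k Y + cost k 𝓨)                    ∎
    where
    rotate : ∀ a b c → a + (b + c) ≡ b + (a + c)
    rotate = solve-∀
    swap : ∀ a b c → a + (b + c) ≡ b + a + c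
    swap = solve-∀
  absorb : ∀ xu yu xv yv c → (xu ∧ xv) ∨ (yu ∧ yv) ∨ c ≡ true → ((xu ∨ yu) ∧ (xv ∨ yv)) ∨ c ≡ true
  absorb true  yu    true  yv   c _ = refl
  absorb true  true  false true c _ = refl
  absorb true  false false yv   c q rewrite q = ∨-zeroʳ yv
  absorb true  true  false false c q = q
  absorb false true  true  true  c _ = refl
  absorb false true  false true  c _ = refl
  absorb false true  true  false c q = refl
  absorb false true  false false c q = q
  absorb false false xv    yv    c q = q
  widen : ∀ xu yu xv yv c → (xu ∧ xv) ∧ c ≡ true → ((xu ∨ yu) ∧ (xv ∨ yv)) ∧ c ≡ true
  widen true yu true yv c q = q
  collect : ∀ {u v} → u ≢ v → (X u ∧ X v) ∧ ((Y u ∧ Y v) ∨ covers 𝓨 u v) ≡ true →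
            Y u ∧ Y v ≡ true ⊎ Y u ∧ Y v ≡ false → covers (X ∩ Y ∷ 𝓠) u v ≡ true
  collect {u} {v} u≢v q (inj₁ y) = cong (_∨ covers 𝓠 u v) (both (X u) (Y u) (X v) (Y v) (proj₁ (∧-true q)) y)
    where
    both : ∀ xu yu xv yv → xu ∧ xv ≡ true → yu ∧ yv ≡ true → (xu ∧ yu) ∧ (xv ∧ yv) ≡ true
    both true true true true _ _ = refl
  collect {u} {v} u≢v q (inj₂ y) rewrite y =
    trans (cong (_ ∨_) (meet u≢v (widen (X u) (Y u) (X v) (Y v) (covers 𝓨 u v) q))) (∨-zeroʳ _)
... | no 2≰∩ with uncrossing 𝓟 𝓠 ≥₂𝓟 ≥₂𝓠 eq join meet ← insert k X 𝓨 2≤X 2≤𝓨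
      = uncrossing (Y ∷ 𝓟) 𝓠 (2≤Y ∷ ≥₂𝓟) ≥₂𝓠
          (trans (+-assoc (weight k Y) _ _) (trans (cong (weight k Y +_) eq) (rotate (weight k Y) (weight k X) (cost k 𝓨))))
          (λ {u} {v} u≢v q → keep u≢v q (decide (Y u ∧ Y v)))
          (λ {u} {v} u≢v q → meet u≢v (avoid u≢v q (decide (Y u ∧ Y v))))
  where
  rotate : ∀ a b c → a + (b + c) ≡ b + (a + c)
  rotate = solve-∀
  both : ∀ xu yu xv yv → xu ∧ xv ≡ true → yu ∧ yv ≡ true → (xu ∧ yu) ∧ (xv ∧ yv) ≡ true
  both true true true true _ _ = refl
  keep : ∀ {u v} → u ≢ v → (X u ∧ X v) ∨ (Y u ∧ Y v) ∨ covers 𝓨 u v ≡ true →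
         Y u ∧ Y v ≡ true ⊎ Y u ∧ Y v ≡ false → (Y u ∧ Y v) ∨ covers 𝓟 u v ≡ true
  keep u≢v q (inj₁ y) rewrite y = refl
  keep u≢v q (inj₂ y) rewrite y = join u≢v q
  avoid : ∀ {u v} → u ≢ v → (X u ∧ X v) ∧ ((Y u ∧ Y v) ∨ covers 𝓨 u v) ≡ true →
          Y u ∧ Y v ≡ true ⊎ Y u ∧ Y v ≡ false → (X u ∧ X v) ∧ covers 𝓨 u v ≡ true
  avoid {u} {v} u≢v q (inj₁ y) =
    contradiction (card-distinct {X = X ∩ Y} u≢v (both (X u) (Y u) (X v) (Y v) (proj₁ (∧-true q)) y)) 2≰∩
  avoid u≢v q (inj₂ y) rewrite y = q

covers-++ : ∀ {n} (𝓧 𝓨 : List (VertexSet n)) u v → covers (𝓧 ++ 𝓨) u v ≡ covers 𝓧 u v ∨ covers 𝓨 u v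
covers-++ []      𝓨 u v = refl
covers-++ (X ∷ 𝓧) 𝓨 u v = trans (cong (_ ∨_) (covers-++ 𝓧 𝓨 u v)) (sym (∨-assoc (X u ∧ X v) _ _))

-- Whatever `𝓨` covers stays covered by the first family after each insertion, so a pair covered on
-- both sides is caught when its member of `𝓧` is inserted.
insert-all : ∀ {n} k (𝓧 𝓨 : List (VertexSet n)) → AtLeast₂ 𝓧 → AtLeast₂ 𝓨 →
             Uncrossing k (cost k 𝓧 + cost k 𝓨) (λ u v → covers 𝓧 u v ∨ covers 𝓨 u v)
                                                (λ u v → covers 𝓧 u v ∧ covers 𝓨 u v)
insert-all k []      𝓨 _ ≥₂𝓨 = uncrossing 𝓨 [] ≥₂𝓨 [] (+-identityʳ _) (λ _ q → q) (λ _ ())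
insert-all k (X ∷ 𝓧) 𝓨 (2≤X ∷ ≥₂𝓧) ≥₂𝓨
  with uncrossing 𝓟₁ 𝓠₁ ≥₂𝓟₁ ≥₂𝓠₁ eq₁ join₁ meet₁ ← insert k X 𝓨 2≤X ≥₂𝓨
  with uncrossing 𝓟 𝓠 ≥₂𝓟 ≥₂𝓠 eq join meet ← insert-all k 𝓧 𝓟₁ ≥₂𝓧 ≥₂𝓟₁
  = uncrossing 𝓟 (𝓠₁ ++ 𝓠) ≥₂𝓟 (++⁺ ≥₂𝓠₁ ≥₂𝓠) total
      (λ {u} {v} u≢v q → join u≢v (joins u≢v (X u ∧ X v) (covers 𝓧 u v) (covers 𝓨 u v) q (join₁ u≢v)))
      (λ {u} {v} u≢v q → trans (covers-++ 𝓠₁ 𝓠 u v)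
         (meets (X u ∧ X v) (covers 𝓧 u v) (covers 𝓨 u v) q (meet₁ u≢v) (join₁ u≢v) (meet u≢v)))
  where
  total : cost k 𝓟 + cost k (𝓠₁ ++ 𝓠) ≡ weight k X + cost k 𝓧 + cost k 𝓨
  total = trans (cong (cost k 𝓟 +_) (∑-++ 𝓠₁ 𝓠 _))
    (arithmetic (cost k 𝓟) (cost k 𝓠₁) (cost k 𝓠) (cost k 𝓧) (cost k 𝓟₁) (weight k X) (cost k 𝓨) eq eq₁)
    where
    arithmetic : ∀ p q₁ q x p₁ w y → p + q ≡ x + p₁ → p₁ + q₁ ≡ w + y → p + (q₁ + q) ≡ w + x + y
    arithmetic p q₁ q x p₁ w y a b =
      trans (move₁ p q₁ q) (trans (cong (_+ q₁) a) (trans (+-assoc x p₁ q₁) (trans (cong (x +_) b) (move₂ x w y))))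
      where
      move₁ : ∀ p q₁ q → p + (q₁ + q) ≡ p + q + q₁
      move₁ = solve-∀
      move₂ : ∀ x w y → x + (w + y) ≡ w + x + y
      move₂ = solve-∀
  joins : ∀ {u v} → u ≢ v → ∀ a b c → (a ∨ b) ∨ c ≡ true →
          (a ∨ c ≡ true → covers 𝓟₁ u v ≡ true) → b ∨ covers 𝓟₁ u v ≡ true
  joins u≢v a     true  c    q f = refl
  joins u≢v true  false c    q f = f refl
  joins u≢v false false true q f = f refl
  meets : ∀ a b c {q₁ p₁ q₂ : Bool} → (a ∨ b) ∧ c ≡ true → (a ∧ c ≡ true → q₁ ≡ true) →
          (a ∨ c ≡ true → p₁ ≡ true) → (b ∧ p₁ ≡ true → q₂ ≡ true) → q₁ ∨ q₂ ≡ true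
  meets true  b    true {q₂ = q₂} _ f g h = cong (_∨ q₂) (f refl)
  meets false true true {q₁ = q₁} _ f g h = trans (cong (q₁ ∨_) (h (g refl))) (∨-zeroʳ q₁)

module Covers {A : Set} {n : ℕ} (s t : A → Fin n) where

  -- The proviso `s a ≢ t a` exempts loops, about which uncrossing says nothing.
  Covered : ℕ → (A → Bool) → ℕ → Set
  Covered k Z c = ∃[ 𝓧 ] (AtLeast₂ 𝓧 × (∀ a → Z a ≡ true → s a ≢ t a → covers 𝓧 (s a) (t a) ≡ true) × cost k 𝓧 ≤ c)

  Covered-submodular : ∀ k → Submodular (Covered k)
  Covered-submodular k = record
    { restrict = λ Z′⊆Z (𝓧 , ≥₂ , cov , le) → 𝓧 , ≥₂ , (λ a q → cov a (Z′⊆Z a q)) , le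
    ; empty    = [] , [] , (λ _ ()) , z≤n
    ; uncross  = λ {Z₁} {Z₂} (𝓧 , ≥₂𝓧 , covX , leX) (𝓨 , ≥₂𝓨 , covY , leY) →
        let uncrossing 𝓟 𝓠 ≥₂𝓟 ≥₂𝓠 eq join meet = insert-all k 𝓧 𝓨 ≥₂𝓧 ≥₂𝓨
        in cost k 𝓟 , cost k 𝓠
         , (𝓟 , ≥₂𝓟 , (λ a q ne → join ne (either (Z₁ a) (Z₂ a) q (λ r → covX a r ne) (λ r → covY a r ne))) , ≤-refl)
         , (𝓠 , ≥₂𝓠 , (λ a q ne → meet ne (cong₂ _∧_ (covX a (proj₁ (∧-true q)) ne) (covY a (proj₂ (∧-true {Z₁ a} q)) ne))) , ≤-refl)
         , ≤-trans (≤-reflexive eq) (+-mono-≤ leX leY)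
    }
    where
    either : ∀ z₁ z₂ {a b} → z₁ ∨ z₂ ≡ true → (z₁ ≡ true → a ≡ true) → (z₂ ≡ true → b ≡ true) → a ∨ b ≡ true
    either true  z₂   {b = b} _ f g = cong (_∨ b) (f refl)
    either false true {a}     _ f g = trans (cong (a ∨_) (g refl)) (∨-zeroʳ a)

  covered-by-set : ∀ k {X : VertexSet n} {Z} → 2 ≤ card X → (∀ a → Z a ≡ true → X (s a) ∧ X (t a) ≡ true) →
                   Covered k Z (weight k X)
  covered-by-set k {X} 2≤X inside =
    X ∷ [] , 2≤X ∷ [] , (λ a q _ → cong (_∨ false) (inside a q)) , ≤-reflexive (+-identityʳ _)

  -- The two ends of an edge form a set of weight one: in matroid terms, rank is at most size.
  covered-by-pairs : ∀ k {P Z} → (∀ a → Z a ≡ true → a ∈ P × s a ≢ t a) → Covered k Z (∑ P (χ ∘ Z))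
  covered-by-pairs k {P} {Z} proper =
    proj₁ (go P) , proj₁ (proj₂ (go P)) , (λ a q _ → proj₁ (proj₂ (proj₂ (go P))) a q (proj₁ (proper a q))) ,
    proj₂ (proj₂ (proj₂ (go P)))
    where
    go : ∀ L → ∃[ 𝓧 ] (AtLeast₂ 𝓧 × (∀ a → Z a ≡ true → a ∈ L → covers 𝓧 (s a) (t a) ≡ true) × cost k 𝓧 ≤ ∑ L (χ ∘ Z))
    go [] = [] , [] , (λ _ _ ()) , z≤n
    go (e ∷ L) with 𝓧 , ≥₂ , cov , le ← go L with Z e in Ze
    ... | false = 𝓧 , ≥₂ , (λ where
            a q (here refl) → bool-contradiction q Ze
            a q (there a∈L) → cov a q a∈L) , le
    ... | true = pair (s e) (t e) ∷ 𝓧 , ≤-reflexive (sym two) ∷ ≥₂ , (λ where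
            a q (here refl) → cong (_∨ covers 𝓧 (s e) (t e)) (ends (s e) (t e))
            a q (there a∈L) → trans (cong (_ ∨_) (cov a q a∈L)) (∨-zeroʳ _)) ,
            +-mono-≤ (≤-reflexive unit) le
      where
      two : card (pair (s e) (t e)) ≡ 2
      two = card-pair (proj₂ (proper e Ze))
      unit : weight k (pair (s e) (t e)) ≡ 1
      unit = trans (cong (λ c → k * (c ∸ 2) + 1) two) (cong (_+ 1) (*-zeroʳ k))
      ends : ∀ u v → pair u v u ∧ pair u v v ≡ true
      ends u v with u Fin.≟ u | v Fin.≟ v
      ... | no u≢u | _      = contradiction refl u≢u
      ... | _      | no v≢v = contradiction refl v≢v
      ... | yes _  | yes _  = ∨-zeroʳ _

-- Covers and weak connectivity

mult : ∀ {n} → List (VertexSet n) → Fin n → ℕ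
mult 𝓨 v = ∑ 𝓨 (λ Y → χ (Y v))

mult-∈ : ∀ {n} {𝓨 : List (VertexSet n)} {Y v} → Y ∈ 𝓨 → Y v ≡ true → 1 ≤ mult 𝓨 v
mult-∈ {v = v} Y∈𝓨 Yv = ≤-trans (≤-reflexive (cong χ (sym Yv))) (∑-∈ (λ Y → χ (Y v)) Y∈𝓨)

unique-member : ∀ {n} {𝓨 : List (VertexSet n)} {Y Y′ v} → mult 𝓨 v ≤ 1 → Y ∈ 𝓨 → Y′ ∈ 𝓨 →
                Y v ≡ true → Y′ v ≡ true → Y ≡ Y′
unique-member _  (here refl)  (here refl) _  _   = refl
unique-member le (here refl)  (there Y′∈) Yv Y′v rewrite Yv = contradiction (≤-trans (s≤s (mult-∈ Y′∈ Y′v)) le) λ { (s≤s ()) }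
unique-member le (there Y∈)   (here refl) Yv Y′v rewrite Y′v = contradiction (≤-trans (s≤s (mult-∈ Y∈ Yv)) le) λ { (s≤s ()) }
unique-member {𝓨 = X ∷ 𝓨} {v = v} le (there Y∈) (there Y′∈) Yv Y′v =
  unique-member (≤-trans (m≤n+m (mult 𝓨 v) (χ (X v))) le) Y∈ Y′∈ Yv Y′v

unique-cover : ∀ {n} {𝓨 : List (VertexSet n)} {Y u v} → mult 𝓨 v ≤ 1 → Y ∈ 𝓨 → Y v ≡ true →
               covers 𝓨 v u ≡ true → Y u ≡ true
unique-cover {𝓨 = 𝓨} {Y} {u} {v} le Y∈ Yv cov with Y′ , Y′∈ , both ← any-witness 𝓨 cov =
  subst (λ X → X u ≡ true) (unique-member le Y′∈ Y∈ (proj₁ (∧-true both)) Yv) (proj₂ (∧-true {Y′ v} both))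

covered-mult : ∀ {n} (𝓨 : List (VertexSet n)) {u v} → covers 𝓨 v u ≡ true → 1 ≤ mult 𝓨 v
covered-mult 𝓨 cov with Y , Y∈ , both ← any-witness 𝓨 cov = mult-∈ Y∈ (proj₁ (∧-true both))

any-Fin : ∀ {n} (X : VertexSet n) v → X v ≡ true → any X (allFin n) ≡ true
any-Fin X v Xv = any-∈ {P = X} (∈-allFin v) Xv

mult-witness : ∀ {n} (𝓨 : List (VertexSet n)) {v} → 1 ≤ mult 𝓨 v → ∃[ Y ] (Y ∈ 𝓨 × Y v ≡ true)
mult-witness (Y ∷ 𝓨) {v} le with Y v in Yv
... | true  = Y , here refl , Yv
... | false = let Y′ , Y′∈ , Y′v = mult-witness 𝓨 le in Y′ , there Y′∈ , Y′v

missing : ∀ {n} → VertexSet n → Bool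
missing {n} X = any (not ∘ X) (allFin n)

missing-witness : ∀ {n} {X : VertexSet n} → missing X ≡ true → ∃[ z ] X z ≡ false
missing-witness {n} {X} eq with z , _ , q ← any-witness (allFin n) eq with X z in Xz
... | false = z , Xz

missing-intro : ∀ {n} {X : VertexSet n} {z} → X z ≡ false → missing X ≡ true
missing-intro {X = X} {z} Xz = any-Fin (not ∘ X) z (cong not Xz)

not-missing : ∀ {n} {X : VertexSet n} → missing X ≡ false → ∀ v → X v ≡ true
not-missing {X = X} eq v with X v in Xv
... | true  = refl
... | false = bool-contradiction (missing-intro {X = X} Xv) eq

-- Marks the whole vertex set, to which weak connectivity cannot be applied and which is paid for
-- separately.
fullness : ∀ {n} → VertexSet n → ℕ
fullness X = χ (not (missing X))

-- Weak connectivity inside one vertex set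

module Local {n : ℕ} (adj : Fin n → Fin n → Bool) (k₁ m : ℕ) where

  V : List (Fin n)
  V = allFin n

  k : ℕ
  k = suc k₁

  boundary : VertexSet n → VertexSet n → ℕ
  boundary A B = ∑ V (λ v → ∑ V (λ u → χ (A v ∧ adj v u ∧ not (A u) ∧ not (B u))))

  -- 4kp - 2p + 2m for k = k₁ + 1, written as 2((2k - 1)p + m) without subtraction.
  threshold : ℕ → ℕ
  threshold p = 2 * (p * suc (2 * k₁) + m)

  WeaklyConnectedᵇ : ℕ → Set
  WeaklyConnectedᵇ p = ∀ (A B : VertexSet n) {a z} → (∀ v → A v ≡ true → B v ≡ true → ⊥) →
    A a ≡ true → A z ≡ false → B z ≡ false → threshold p ≤ boundary A B + k * card B

  -- Twice the number of edges inside W avoiding the cover c, plus the edges leaving W.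
  uncovered : VertexSet n → (Fin n → Fin n → Bool) → ℕ
  uncovered W c = ∑ V (λ v → ∑ V (λ u → χ (W v ∧ adj v u ∧ not (c v u))))

  -- No member of `𝓨` leaves `W`, so all edges leaving `W` are uncovered; connectivity is applied
  -- with empty `B`.
  uncovered-boundary : ∀ {p} → WeaklyConnectedᵇ p → ∀ {W 𝓨 w z} → W w ≡ true → W z ≡ false →
    (∀ {Y} → Y ∈ 𝓨 → Y ⊆ᵇ W) → threshold p ≤ uncovered W (covers 𝓨)
  uncovered-boundary {p} conn {W} {𝓨} Ww Wz sub = begin
    threshold p                     ≤⟨ conn W ∅ (λ _ _ ()) Ww Wz refl ⟩
    boundary W ∅ + k * card {n} ∅   ≡⟨ cong (boundary W ∅ +_) (trans (cong (k *_) (∑-zero V)) (*-zeroʳ k)) ⟩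
    boundary W ∅ + 0                ≡⟨ +-identityʳ _ ⟩
    boundary W ∅                    ≤⟨ ∑-mono V (λ v → ∑-mono V (λ u → χ-mono (pointwise v u))) ⟩
    uncovered W (covers 𝓨)          ∎
    where
    open ≤-Reasoning
    pointwise : ∀ v u → W v ∧ adj v u ∧ not (W u) ∧ true ≡ true → W v ∧ adj v u ∧ not (covers 𝓨 v u) ≡ true
    pointwise v u q with W v | adj v u | W u in Wu | covers 𝓨 v u in cov
    ... | true | true | false | false = refl
    ... | true | true | false | true with Y , Y∈ , both ← any-witness 𝓨 cov =
      bool-contradiction (sub Y∈ u (proj₂ (∧-true {Y v} both))) Wu

  module Large (p₁ : ℕ) (conn : WeaklyConnectedᵇ (suc p₁)) (v₀ v₁ : Fin n) (v₀≢v₁ : v₀ ≢ v₁)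
               (W : VertexSet n) (𝓨 : List (VertexSet n))
               (within : ∀ {Y} → Y ∈ 𝓨 → Y ⊆ᵇ W) (large : ∀ {Y} → Y ∈ 𝓨 → 4 ≤ card Y) where

    p κ l : ℕ
    p = suc p₁
    κ = suc (2 * k₁)
    l = threshold p

    once none : VertexSet n
    once v = mult 𝓨 v ≡ᵇ 1
    none v = mult 𝓨 v ≡ᵇ 0

    inner border : VertexSet n → VertexSet n
    inner  Y v = Y v ∧ once v
    border Y v = Y v ∧ not (once v)

    has-inner exceptional : VertexSet n → Bool
    has-inner   Y = any (inner Y) V
    exceptional Y = has-inner Y ∧ not (missing Y)

    inner-degree : VertexSet n → ℕ
    inner-degree Y = uncovered (inner Y) (covers 𝓨)

    isolated : VertexSet n
    isolated v = W v ∧ none v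

    ≡ᵇ-sound : ∀ {a b} → (a ≡ᵇ b) ≡ true → a ≡ b
    ≡ᵇ-sound {a} {b} eq = ≡ᵇ⇒≡ a b (subst T (sym eq) _)

    -- An inner vertex lies in no member but `Y`, so its edges leaving `Y` are uncovered. The factor
    -- `p` is a harmless weakening that matches the weight with which borders enter `surplus`.
    inner-degree-bound : ∀ {Y a z} → Y ∈ 𝓨 → inner Y a ≡ true → Y z ≡ false →
                         l ≤ inner-degree Y + k * p * card (border Y)
    inner-degree-bound {Y} {a} {z} Y∈ Ia Yz = begin
      l                                                 ≤⟨ conn (inner Y) (border Y) disjoint Ia (cong (_∧ once z) Yz) (cong (_∧ not (once z)) Yz) ⟩
      boundary (inner Y) (border Y) + k * card (border Y)
        ≤⟨ +-mono-≤ (∑-mono V (λ v → ∑-mono V (λ u → χ-mono (pointwise v u)))) (*-monoˡ-≤ (card (border Y)) (m≤m*n k p)) ⟩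
      inner-degree Y + k * p * card (border Y)          ∎
      where
      open ≤-Reasoning
      disjoint : ∀ v → inner Y v ≡ true → border Y v ≡ true → ⊥
      disjoint v i b with Y v | once v
      disjoint v () b | true | false
      disjoint v i () | true | true
      pointwise : ∀ v u → inner Y v ∧ adj v u ∧ not (inner Y u) ∧ not (border Y u) ≡ true →
                  inner Y v ∧ adj v u ∧ not (covers 𝓨 v u) ≡ true
      pointwise v u q with Y v in Yv | once v in ov | adj v u | Y u in Yu | once u | covers 𝓨 v u in cov
      ... | true | true | true | _     | _     | false = refl
      ... | true | true | true | false | _     | true  =
        bool-contradiction (unique-cover (≤-reflexive (≡ᵇ-sound ov)) Y∈ Yv cov) Yu
      ... | true | true | true | true  | true  | true with () ← q
      ... | true | true | true | true  | false | true with () ← q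

    border-bound : ∀ {Y} → Y ∈ 𝓨 → has-inner Y ≡ false → 4 ≤ card (border Y)
    border-bound {Y} Y∈ no-inner = ≤-trans (large Y∈) (card-mono pointwise)
      where
      pointwise : Y ⊆ᵇ border Y
      pointwise v Yv with once v in ov
      ... | false rewrite Yv = refl
      ... | true = bool-contradiction (any-Fin (inner Y) v (cong₂ _∧_ Yv ov)) no-inner

    -- 2p(2k − 1) is the deficit of Y; the four border vertices pay for it when
    -- Y has no inner vertex.
    deficit : 2 * (p * κ) ≤ k * p * 4
    deficit = farkas (2 * p) (≤-refl {0}) (identity k₁ p)
      where
      identity : ∀ k₁ p → 2 * (p * suc (2 * k₁)) + 0 + 2 * p ≡ suc k₁ * p * 4 + 0
      identity = solve-∀

    -- The bonus `2 * m` is tied to an inner vertex, since only then does connectivity have a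
    -- nonempty set to act on. If `Y` is the whole vertex set, no vertex is left outside and `l` is
    -- charged instead.
    member-bound : ∀ {Y} → Y ∈ 𝓨 → 2 * (p * κ) + 2 * m * χ (has-inner Y)
                   ≤ inner-degree Y + k * p * card (border Y) + l * χ (exceptional Y)
    member-bound {Y} Y∈ with has-inner Y in hi
    ... | false = begin
      2 * (p * κ) + 2 * m * 0       ≡⟨ trans (cong (2 * (p * κ) +_) (*-zeroʳ (2 * m))) (+-identityʳ _) ⟩
      2 * (p * κ)                   ≤⟨ deficit ⟩
      k * p * 4                     ≤⟨ *-monoʳ-≤ (k * p) (border-bound Y∈ hi) ⟩
      k * p * card (border Y)       ≤⟨ m≤n+m _ (inner-degree Y) ⟩
      inner-degree Y + k * p * card (border Y)  ≤⟨ m≤m+n _ _ ⟩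
      _                             ∎
      where open ≤-Reasoning
    ... | true with missing Y in mis
    ...   | false = begin
      2 * (p * κ) + 2 * m * 1   ≡⟨ expand p κ m ⟩
      l * 1                     ≤⟨ m≤n+m _ (inner-degree Y + k * p * card (border Y)) ⟩
      _                         ∎
      where
      open ≤-Reasoning
      expand : ∀ p κ m → 2 * (p * κ) + 2 * m * 1 ≡ 2 * (p * κ + m) * 1
      expand = solve-∀
    ...   | true with a , _ , Ia ← any-witness V hi | z , Yz ← missing-witness {X = Y} mis = begin
      2 * (p * κ) + 2 * m * 1   ≡⟨ expand p κ m ⟩
      l                         ≤⟨ inner-degree-bound Y∈ Ia Yz ⟩
      inner-degree Y + k * p * card (border Y)  ≤⟨ m≤m+n _ _ ⟩
      _                         ∎
      where
      open ≤-Reasoning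
      expand : ∀ p κ m → 2 * (p * κ) + 2 * m * 1 ≡ 2 * (p * κ + m)
      expand = solve-∀

    ∑-restrict : ∀ b v → ∑ 𝓨 (λ Y → χ (Y v ∧ b)) ≡ χ b * mult 𝓨 v
    ∑-restrict b v = trans (∑-cong 𝓨 (λ Y → pointwise (Y v) b)) (∑-*ˡ 𝓨 (χ b) _)
      where
      pointwise : ∀ x b → χ (x ∧ b) ≡ χ b * χ x
      pointwise true  true  = refl
      pointwise true  false = refl
      pointwise false true  = refl
      pointwise false false = refl

    -- Vertex by vertex: one in a ≥ 2 members is a border vertex a times, and a + 2 ≤ 2a. A vertex
    -- of `W` in one member, or in none, gives equality.
    border-count : ∑ 𝓨 (λ Y → card (border Y)) + 2 * card W ≤ 2 * ∑ 𝓨 card + 2 * card isolated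
    border-count = subst₂ _≤_ left right (∑-mono V pointwise)
      where
      left : ∑ V (λ v → ∑ 𝓨 (λ Y → χ (border Y v)) + 2 * χ (W v)) ≡ ∑ 𝓨 (λ Y → card (border Y)) + 2 * card W
      left = trans (∑-+ V _ _) (cong₂ _+_ (∑-swap V 𝓨 _) (∑-*ˡ V 2 _))
      right : ∑ V (λ v → 2 * mult 𝓨 v + 2 * χ (isolated v)) ≡ 2 * ∑ 𝓨 card + 2 * card isolated
      right = trans (∑-+ V _ _) (cong₂ _+_ (trans (∑-*ˡ V 2 _) (cong (2 *_) (∑-swap V 𝓨 _))) (∑-*ˡ V 2 _))
      pointwise : ∀ v → ∑ 𝓨 (λ Y → χ (border Y v)) + 2 * χ (W v) ≤ 2 * mult 𝓨 v + 2 * χ (isolated v)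
      pointwise v rewrite ∑-restrict (not (once v)) v = by-mult (mult 𝓨 v) (W v)
        where
        by-mult : ∀ a w → χ (not (a ≡ᵇ 1)) * a + 2 * χ w ≤ 2 * a + 2 * χ (w ∧ (a ≡ᵇ 0))
        by-mult 0             true  = ≤-refl
        by-mult 0             false = ≤-refl
        by-mult 1             true  = ≤-refl
        by-mult 1             false = z≤n
        by-mult (suc (suc a)) w     = farkas (a + 2 * χ (not w)) (≤-refl {0}) (identity a w)
          where
          identity₁ : ∀ a → 1 * suc (suc a) + 2 * 1 + 0 + (a + 2 * 0) ≡ 2 * suc (suc a) + 2 * 0 + 0
          identity₁ = solve-∀
          identity₀ : ∀ a → 1 * suc (suc a) + 2 * 0 + 0 + (a + 2 * 1) ≡ 2 * suc (suc a) + 2 * 0 + 0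
          identity₀ = solve-∀
          identity : ∀ a w → 1 * suc (suc a) + 2 * χ w + 0 + (a + 2 * χ (not w)) ≡ 2 * suc (suc a) + 2 * χ (w ∧ false) + 0
          identity a true  = identity₁ a
          identity a false = identity₀ a

    -- Inner sets of different members are disjoint, and they avoid the isolated vertices, so no
    -- ordered pair is counted twice.
    degree-count : ∑ 𝓨 inner-degree + uncovered isolated (covers 𝓨) ≤ uncovered W (covers 𝓨)
    degree-count = subst (_≤ uncovered W (covers 𝓨)) left (∑-mono V λ v → ∑-mono V λ u → pointwise v u)
      where
      r : Fin n → Fin n → Bool
      r v u = adj v u ∧ not (covers 𝓨 v u)
      left : ∑ V (λ v → ∑ V (λ u → ∑ 𝓨 (λ Y → χ (inner Y v ∧ r v u)) + χ (isolated v ∧ r v u)))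
             ≡ ∑ 𝓨 inner-degree + uncovered isolated (covers 𝓨)
      left = trans (∑-cong V (λ v → ∑-+ V _ _)) (trans (∑-+ V _ _)
        (cong (_+ uncovered isolated (covers 𝓨))
          (trans (∑-cong V (λ v → ∑-swap V 𝓨 _)) (∑-swap V 𝓨 _))))
      pointwise : ∀ v u → ∑ 𝓨 (λ Y → χ (inner Y v ∧ r v u)) + χ (isolated v ∧ r v u) ≤ χ (W v ∧ r v u)
      pointwise v u = subst (λ x → x + χ (isolated v ∧ r v u) ≤ χ (W v ∧ r v u))
        (sym (trans (∑-cong 𝓨 (λ Y → cong χ (∧-regroup (Y v) (once v) (r v u)))) (∑-restrict (once v ∧ r v u) v)))
        (by-mult (mult 𝓨 v) (W v) (r v u) λ le → let Y , Y∈ , Yv = mult-witness 𝓨 le in within Y∈ v Yv)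
        where
        ∧-regroup : ∀ a b c → (a ∧ b) ∧ c ≡ a ∧ (b ∧ c)
        ∧-regroup true  b c = refl
        ∧-regroup false b c = refl
        by-mult : ∀ a w r → (1 ≤ a → w ≡ true) →
                  χ ((a ≡ᵇ 1) ∧ r) * a + χ ((w ∧ (a ≡ᵇ 0)) ∧ r) ≤ χ (w ∧ r)
        by-mult 0             true  r     _ = ≤-refl
        by-mult 0             false r     _ = z≤n
        by-mult 1             true  true  _ = ≤-refl
        by-mult 1             true  false _ = z≤n
        by-mult 1             false r     f = case f ≤-refl of λ ()
        by-mult (suc (suc a)) true  r     _ = z≤n
        by-mult (suc (suc a)) false r     _ = z≤n

    -- Connectivity at a single vertex makes every degree at least `l`, and no edge at an isolated
    -- vertex is covered. One of `v₀` and `v₁` serves as the required vertex outside the singleton.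
    isolated-bound : card isolated * l ≤ uncovered isolated (covers 𝓨)
    isolated-bound = subst (_≤ uncovered isolated (covers 𝓨))
      (trans (trans (∑-cong V (λ v → *-comm (χ (isolated v)) l)) (∑-*ˡ V l _)) (*-comm l _)) (∑-mono V pointwise)
      where
      open ≤-Reasoning
      single : Fin n → VertexSet n
      single v u = does (v Fin.≟ u)
      other : ∀ v → ∃[ z ] single v z ≡ false
      other v with v Fin.≟ v₀ in eq
      ... | no  _    = v₀ , cong does eq
      ... | yes refl with v Fin.≟ v₁ in eq₁
      ...   | no  _    = v₁ , cong does eq₁
      ...   | yes refl = contradiction refl v₀≢v₁
      degree-bound : ∀ v → l ≤ ∑ V (λ u → χ (adj v u))
      degree-bound v = begin
        l
          ≤⟨ conn (single v) ∅ (λ _ _ ()) (dec-true (v Fin.≟ v) refl) (proj₂ (other v)) refl ⟩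
        boundary (single v) ∅ + k * card {n} ∅
          ≡⟨ trans (cong (boundary (single v) ∅ +_) (trans (cong (k *_) (∑-zero V)) (*-zeroʳ k))) (+-identityʳ _) ⟩
        boundary (single v) ∅
          ≤⟨ ∑-mono V (λ w → begin
               ∑ V (λ u → χ (single v w ∧ adj w u ∧ not (single v u) ∧ true))
                 ≤⟨ ∑-mono V (λ u → drop (single v w) (adj w u) (single v u)) ⟩
               ∑ V (λ u → χ (single v w) * χ (adj w u))
                 ≡⟨ ∑-*ˡ V (χ (single v w)) _ ⟩
               χ (single v w) * ∑ V (λ u → χ (adj w u)) ∎) ⟩
        ∑ V (λ w → χ (single v w) * ∑ V (λ u → χ (adj w u)))
          ≡⟨ ∑-δ* Fin._≟_ {V} (Fin-enumerated n) v (λ w → ∑ V (λ u → χ (adj w u))) ⟩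
        ∑ V (λ u → χ (adj v u)) ∎
        where
        drop : ∀ a b c → χ (a ∧ b ∧ not c ∧ true) ≤ χ a * χ b
        drop = ≤-tautology₃ refl
      pointwise : ∀ v → χ (isolated v) * l ≤ ∑ V (λ u → χ (isolated v ∧ adj v u ∧ not (covers 𝓨 v u)))
      pointwise v with W v | none v in nv
      ... | false | _     = z≤n
      ... | true  | false = z≤n
      ... | true  | true  = ≤-trans (≤-reflexive (+-identityʳ l)) (≤-trans (degree-bound v)
        (∑-mono V λ u → χ-mono λ q → cong₂ _∧_ q (cong not (nothing-covers u))))
        where
        nothing-covers : ∀ u → covers 𝓨 v u ≡ false
        nothing-covers u with covers 𝓨 v u in cov
        ... | false = refl
        ... | true  = contradiction (subst (1 ≤_) (≡ᵇ-sound nv) (covered-mult 𝓨 cov)) λ ()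

    -- Every exceptional member contains all vertices, among them one that lies in a single member;
    -- so there is at most one. Being contained in `W`, it makes `W` full.
    exceptional-count : ∑ 𝓨 (χ ∘ exceptional) ≤ fullness W
    exceptional-count with any exceptional 𝓨 in ex
    ... | false = ≤-trans (∑-mono∈ 𝓨 {g = λ _ → 0} (λ {Y} Y∈ → χ-mono {b = false} λ q →
                    bool-contradiction (any-∈ {P = exceptional} Y∈ q) ex)) (≤-trans (≤-reflexive (∑-zero 𝓨)) z≤n)
    ... | true with Y , Y∈ , eY ← any-witness 𝓨 ex with a , _ , Ia ← any-witness V (proj₁ (∧-true eY)) = begin
      ∑ 𝓨 (χ ∘ exceptional)   ≤⟨ ∑-mono 𝓨 (λ Y′ → χ-mono λ q → spans {Y′} (proj₂ (∧-true {has-inner Y′} q)) a) ⟩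
      mult 𝓨 a                ≡⟨ ≡ᵇ-sound (proj₂ (∧-true {Y a} Ia)) ⟩
      1                       ≡⟨ cong χ W-full ⟨
      fullness W              ∎
      where
      open ≤-Reasoning
      spans : ∀ {Y′ : VertexSet n} → not (missing Y′) ≡ true → ∀ v → Y′ v ≡ true
      spans {Y′} q with missing Y′ in mis
      ... | false = not-missing mis
      W-full : not (missing W) ≡ true
      W-full with missing W in mis
      ... | false = refl
      ... | true with z , Wz ← missing-witness {X = W} mis =
        bool-contradiction (within Y∈ z (spans {Y} (proj₂ (∧-true {has-inner Y} eY)) z)) Wz

    size-count : 2 * (k * p) * ∑ 𝓨 card ≤ 2 * p * cost k 𝓨 + ∑ 𝓨 (λ _ → 2 * (p * κ))
    size-count = subst₂ _≤_ (∑-*ˡ 𝓨 (2 * (k * p)) card) (trans (∑-+ 𝓨 _ _) (cong (_+ ∑ 𝓨 (λ _ → 2 * (p * κ))) (∑-*ˡ 𝓨 (2 * p) (weight k))))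
      (∑-mono∈ 𝓨 λ {Y} Y∈ → by-card (card Y) (≤-trans (s≤s (s≤s z≤n)) (large Y∈)))
      where
      identity : ∀ k₁ p c → 2 * (suc k₁ * p) * suc (suc c) ≡ 2 * p * (suc k₁ * c + 1) + 2 * (p * suc (2 * k₁))
      identity = solve-∀
      by-card : ∀ c → 2 ≤ c → 2 * (k * p) * c ≤ 2 * p * (k * (c ∸ 2) + 1) + 2 * (p * κ)
      by-card (suc zero) (s≤s ())
      by-card (suc (suc c)) _ = ≤-reflexive (identity k₁ p c)

    member-count : ∑ 𝓨 (λ _ → 2 * (p * κ)) + 2 * m * ∑ 𝓨 (χ ∘ has-inner)
                   ≤ ∑ 𝓨 inner-degree + k * p * ∑ 𝓨 (λ Y → card (border Y)) + l * ∑ 𝓨 (χ ∘ exceptional)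
    member-count = subst₂ _≤_
      (trans (∑-+ 𝓨 (λ _ → 2 * (p * κ)) _) (cong (∑ 𝓨 (λ _ → 2 * (p * κ)) +_) (∑-*ˡ 𝓨 (2 * m) (χ ∘ has-inner))))
      (trans (∑-+ 𝓨 _ (λ Y → l * χ (exceptional Y))) (cong₂ _+_
        (trans (∑-+ 𝓨 inner-degree _) (cong (∑ 𝓨 inner-degree +_) (∑-*ˡ 𝓨 (k * p) (card ∘ border))))
        (∑-*ˡ 𝓨 l (χ ∘ exceptional))))
      (∑-mono∈ 𝓨 member-bound)

    -- An isolated vertex brings `l` in uncovered edges and uses 2kp of it for its place in `W`. The
    -- rest is at least `2 * m`, so it earns the same bonus as a member with an inner vertex.
    surplus : 2 * (k * p) * card W + 2 * m * (∑ 𝓨 (χ ∘ has-inner) + card isolated)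
              ≤ 2 * p * cost k 𝓨 + uncovered W (covers 𝓨) + l * ∑ 𝓨 (χ ∘ exceptional)
    surplus = arithmetic k₁ p m (∑ 𝓨 (λ _ → 2 * (p * κ))) _ _ _ _ (cost k 𝓨) _ _ _ _ (card W)
      member-count (*-monoʳ-≤ (k * p) border-count) degree-count isolated-bound size-count
      where
      arithmetic : ∀ k₁ p m S a dg bd x C cd z₀ D₀ D w →
        S + 2 * m * a ≤ dg + suc k₁ * p * bd + 2 * (p * suc (2 * k₁) + m) * x →
        suc k₁ * p * (bd + 2 * w) ≤ suc k₁ * p * (2 * cd + 2 * z₀) →
        dg + D₀ ≤ D → z₀ * (2 * (p * suc (2 * k₁) + m)) ≤ D₀ → 2 * (suc k₁ * p) * cd ≤ 2 * p * C + S →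
        2 * (suc k₁ * p) * w + 2 * m * (a + z₀) ≤ 2 * p * C + D + 2 * (p * suc (2 * k₁) + m) * x
      arithmetic k₁ p m S a dg bd x C cd z₀ D₀ D w h₁ h₂ h₃ h₄ h₅ =
        -- The slack is l - 2kp - 2m = 2p(k - 1) for each isolated vertex.
        farkas (2 * p * k₁ * z₀) (+-mono-≤ (+-mono-≤ h₁ h₂) (+-mono-≤ (+-mono-≤ h₃ h₄) h₅))
          (identity k₁ p m S a dg bd x C cd z₀ D₀ D w)
        where
        identity : ∀ k₁ p m S a dg bd x C cd z₀ D₀ D w →
          2 * (suc k₁ * p) * w + 2 * m * (a + z₀)
          + ((dg + suc k₁ * p * bd + 2 * (p * suc (2 * k₁) + m) * x + suc k₁ * p * (2 * cd + 2 * z₀))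
             + (D + D₀ + (2 * p * C + S))) + 2 * p * k₁ * z₀
          ≡ 2 * p * C + D + 2 * (p * suc (2 * k₁) + m) * x
          + ((S + 2 * m * a + suc k₁ * p * (bd + 2 * w))
             + (dg + D₀ + z₀ * (2 * (p * suc (2 * k₁) + m)) + 2 * (suc k₁ * p) * cd))
        identity = solve-∀

    -- If all members consist of border vertices, their deficits are paid without any uncovered
    -- edge, which leaves those edges available for the bonus `2 * m`.
    all-border : ∑ 𝓨 (χ ∘ has-inner) + card isolated ≡ 0 → 2 * (k * p) * card W ≤ 2 * p * cost k 𝓨
    all-border zero-sum = arithmetic k₁ p (∑ 𝓨 (λ _ → 2 * (p * κ))) _ (cost k 𝓨) (∑ 𝓨 card) (card W) members
      (*-monoʳ-≤ (k * p) (subst (λ z → ∑ 𝓨 (λ Y → card (border Y)) + 2 * card W ≤ 2 * ∑ 𝓨 card + 2 * z) (m+n≡0⇒n≡0 (∑ 𝓨 (χ ∘ has-inner)) zero-sum) border-count))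
      size-count
      where
      no-inner : ∀ {Y} → Y ∈ 𝓨 → has-inner Y ≡ false
      no-inner {Y} Y∈ with has-inner Y in hi
      ... | false = refl
      ... | true  = contradiction (≤-trans (subst (λ b → χ b ≤ ∑ 𝓨 (χ ∘ has-inner)) hi (∑-∈ (χ ∘ has-inner) Y∈))
                      (≤-reflexive (m+n≡0⇒m≡0 _ zero-sum))) λ ()
      members : ∑ 𝓨 (λ _ → 2 * (p * κ)) ≤ k * p * ∑ 𝓨 (λ Y → card (border Y))
      members = subst (∑ 𝓨 (λ _ → 2 * (p * κ)) ≤_) (∑-*ˡ 𝓨 (k * p) _)
        (∑-mono∈ 𝓨 λ Y∈ → ≤-trans deficit (*-monoʳ-≤ (k * p) (border-bound Y∈ (no-inner Y∈))))
      arithmetic : ∀ k₁ p S bd C cd w → S ≤ suc k₁ * p * bd →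
        suc k₁ * p * (bd + 2 * w) ≤ suc k₁ * p * (2 * cd + 2 * 0) → 2 * (suc k₁ * p) * cd ≤ 2 * p * C + S →
        2 * (suc k₁ * p) * w ≤ 2 * p * C
      arithmetic k₁ p S bd C cd w h₁ h₂ h₃ =
        farkas 0 (+-mono-≤ h₁ (+-mono-≤ h₂ h₃)) (identity k₁ p S bd C cd w)
        where
        identity : ∀ k₁ p S bd C cd w →
          2 * (suc k₁ * p) * w + (suc k₁ * p * bd + (suc k₁ * p * (2 * cd + 2 * 0) + (2 * p * C + S))) + 0
          ≡ 2 * p * C + (S + (suc k₁ * p * (bd + 2 * w) + 2 * (suc k₁ * p) * cd))
        identity = solve-∀

    -- One bonus suffices. A member with an inner vertex or an isolated vertex provides it; if
    -- neither exists, it comes from the boundary of `W`, or from `l` when `W` is full.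
    large-bound : ∀ {w} → W w ≡ true →
                  2 * (k * p) * card W + 2 * m ≤ 2 * p * cost k 𝓨 + uncovered W (covers 𝓨) + l * fullness W
    large-bound Ww with ∑ 𝓨 (χ ∘ has-inner) + card isolated in eq
    ... | suc j = begin
      2 * (k * p) * card W + 2 * m             ≤⟨ +-monoʳ-≤ (2 * (k * p) * card W) (m≤m*n (2 * m) (suc j)) ⟩
      2 * (k * p) * card W + 2 * m * suc j     ≡⟨ cong (λ x → 2 * (k * p) * card W + 2 * m * x) eq ⟨
      _                                        ≤⟨ surplus ⟩
      _                                        ≤⟨ +-monoʳ-≤ (2 * p * cost k 𝓨 + uncovered W (covers 𝓨)) (*-monoʳ-≤ l exceptional-count) ⟩
      _                                        ∎
      where open ≤-Reasoning
    ... | zero = ≤-trans (+-mono-≤ (all-border eq) pays) (≤-reflexive (sym (+-assoc (2 * p * cost k 𝓨) _ _)))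
      where
      2m≤l : 2 * m ≤ l
      2m≤l = *-monoʳ-≤ 2 (m≤n+m m (p * κ))
      pays : 2 * m ≤ uncovered W (covers 𝓨) + l * fullness W
      pays with missing W in mis
      ... | false = ≤-trans 2m≤l (≤-trans (≤-reflexive (sym (*-identityʳ l))) (m≤n+m _ _))
      ... | true with z , Wz ← missing-witness {X = W} mis =
        ≤-trans 2m≤l (≤-trans (uncovered-boundary {p} conn {W} {𝓨} Ww Wz within) (m≤m+n _ _))

-- Merging a cover to a partition

∨-left : ∀ {a} b → a ≡ true → a ∨ b ≡ true
∨-left b refl = refl

∨-right : ∀ a {b} → b ≡ true → a ∨ b ≡ true
∨-right a refl = ∨-zeroʳ a

∨-elim : ∀ a {b} {C : Set} → a ∨ b ≡ true → (a ≡ true → C) → (b ≡ true → C) → C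
∨-elim true  q f g = f refl
∨-elim false q f g = g q

card-nonempty : ∀ {n} {X : VertexSet n} {v} → X v ≡ true → 1 ≤ card X
card-nonempty {n} {X} {v} Xv = ≤-trans (≤-reflexive (cong χ (sym Xv))) (∑-∈ (χ ∘ X) (∈-allFin v))

merge : ∀ {n} → VertexSet n → List (VertexSet n) → List (VertexSet n)
merge X []      = X ∷ []
merge {n} X (W ∷ 𝓟) = if any (X ∩ W) (allFin n) then merge (X ∪ W) 𝓟 else W ∷ merge X 𝓟

-- A single pass is enough: a member passed over misses the current `X`, and `X` grows only by
-- members disjoint from it. The formula also records that the result is again a disjoint family.
merge-mult : ∀ {n} (X : VertexSet n) 𝓟 → (∀ v → mult 𝓟 v ≤ 1) →
             ∀ v → mult (merge X 𝓟) v ≡ χ (X v ∨ any (λ W → W v) 𝓟)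
merge-mult X [] _ v = trans (+-identityʳ _) (cong χ (sym (∨-identityʳ (X v))))
merge-mult {n} X (W ∷ 𝓟) disjoint v with any (X ∩ W) (allFin n) in hit
... | true  = trans (merge-mult (X ∪ W) 𝓟 (λ v → ≤-trans (m≤n+m _ (χ (W v))) (disjoint v)) v)
                    (cong χ (∨-assoc (X v) (W v) _))
... | false rewrite merge-mult X 𝓟 (λ v → ≤-trans (m≤n+m _ (χ (W v))) (disjoint v)) v
    with W v in Wv | X v in Xv | any (λ W → W v) 𝓟 in anyP
...   | false | _     | _     = refl
...   | true  | true  | _     = bool-contradiction (any-Fin (X ∩ W) v (cong₂ _∧_ Xv Wv)) hit
...   | true  | false | false = refl
...   | true  | false | true  with W′ , W′∈ , W′v ← any-witness 𝓟 anyP =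
        contradiction (≤-trans (+-mono-≤ (≤-reflexive (cong χ (sym Wv))) (mult-∈ W′∈ W′v)) (disjoint v)) λ { (s≤s ()) }

Nonempty-sets : ∀ {n} → List (VertexSet n) → Set
Nonempty-sets 𝓟 = ∀ {W} → W ∈ 𝓟 → ∃[ w ] W w ≡ true

merge-nonempty : ∀ {n} (X : VertexSet n) 𝓟 → (∃[ x ] X x ≡ true) → Nonempty-sets 𝓟 → Nonempty-sets (merge X 𝓟)
merge-nonempty X [] Xne _ (here refl) = Xne
merge-nonempty {n} X (W ∷ 𝓟) (x , Xx) ne W′∈ with any (X ∩ W) (allFin n)
... | true  = merge-nonempty (X ∪ W) 𝓟 (x , cong (_∨ W x) Xx) (ne ∘ there) W′∈
... | false with W′∈
...   | here refl  = ne (here refl)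
...   | there W′∈′ = merge-nonempty X 𝓟 (x , Xx) (ne ∘ there) W′∈′

merge-covers : ∀ {n} (X : VertexSet n) 𝓟 u v → (X u ∧ X v) ∨ covers 𝓟 u v ≡ true → covers (merge X 𝓟) u v ≡ true
merge-covers X [] u v q = q
merge-covers {n} X (W ∷ 𝓟) u v q with any (X ∩ W) (allFin n)
... | true  = merge-covers (X ∪ W) 𝓟 u v (widen (X u) (W u) (X v) (W v) (covers 𝓟 u v) q)
  where
  widen : ∀ xu yu xv yv c → (xu ∧ xv) ∨ (yu ∧ yv) ∨ c ≡ true → ((xu ∨ yu) ∧ (xv ∨ yv)) ∨ c ≡ true
  widen xu yu xv yv c q = ∨-elim (xu ∧ xv) q
    (λ r → ∨-left c (cong₂ _∧_ (∨-left yu (proj₁ (∧-true r))) (∨-left yv (proj₂ (∧-true {xu} r)))))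
    (λ q′ → ∨-elim (yu ∧ yv) q′
      (λ r → ∨-left c (cong₂ _∧_ (∨-right xu (proj₁ (∧-true r))) (∨-right xv (proj₂ (∧-true {yu} r)))))
      (∨-right ((xu ∨ yu) ∧ (xv ∨ yv))))
... | false = ∨-elim (X u ∧ X v) q
    (λ r → ∨-right (W u ∧ W v) (merge-covers X 𝓟 u v (∨-left _ r)))
    (λ q′ → ∨-elim (W u ∧ W v) q′ (∨-left _)
      (λ r → ∨-right (W u ∧ W v) (merge-covers X 𝓟 u v (∨-right (X u ∧ X v) r))))

excess : ∀ {n} → List (VertexSet n) → ℕ
excess 𝓟 = ∑ 𝓟 (λ W → card W ∸ 1)

-- Two sets are joined only if they share a vertex, so the union has at most |X| + |W| - 1 vertices.
merge-excess : ∀ {n} (X : VertexSet n) 𝓟 → excess (merge X 𝓟) ≤ (card X ∸ 1) + excess 𝓟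
merge-excess X [] = ≤-refl
merge-excess {n} X (W ∷ 𝓟) with any (X ∩ W) (allFin n) in hit
... | false = ≤-trans (+-monoʳ-≤ (card W ∸ 1) (merge-excess X 𝓟))
                (≤-reflexive (rotate (card W ∸ 1) (card X ∸ 1) (excess 𝓟)))
  where
  rotate : ∀ a b c → a + (b + c) ≡ b + (a + c)
  rotate = solve-∀
... | true with z , _ , q ← any-witness (allFin n) hit = begin
  excess (merge (X ∪ W) 𝓟)                   ≤⟨ merge-excess (X ∪ W) 𝓟 ⟩
  (card (X ∪ W) ∸ 1) + excess 𝓟              ≤⟨ +-monoˡ-≤ (excess 𝓟)
    (arithmetic (card-nonempty {X = X} (proj₁ (∧-true q))) (card-nonempty {X = W} (proj₂ (∧-true {X z} q)))
                (card-nonempty {X = X ∩ W} q) (card-∪∩ X W)) ⟩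
  (card X ∸ 1) + (card W ∸ 1) + excess 𝓟     ≡⟨ +-assoc (card X ∸ 1) _ _ ⟩
  (card X ∸ 1) + ((card W ∸ 1) + excess 𝓟)   ∎
  where
  open ≤-Reasoning
  arithmetic : ∀ {x w a i} → 1 ≤ x → 1 ≤ w → 1 ≤ i → a + i ≡ x + w → a ∸ 1 ≤ (x ∸ 1) + (w ∸ 1)
  arithmetic {suc x} {suc w} {a} {suc i} _ _ _ eq = ∸-monoˡ-≤ 1
    (≤-trans (m≤m+n a i) (≤-reflexive (suc-injective (trans (sym (+-suc a i)) (trans eq (+-suc (suc x) w))))))

-- As the parts are nonempty and disjoint, `excess parts` is |U| minus their number, the size of a
-- spanning forest; `small` compares this graphic rank with the cost of the cover.
record Partition {n} (U : VertexSet n) (𝓦 : List (VertexSet n)) : Set where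
  constructor partition
  field
    parts    : List (VertexSet n)
    exact    : ∀ v → mult parts v ≡ χ (U v)
    nonempty : Nonempty-sets parts
    together : ∀ u v → U u ≡ true → U v ≡ true → covers 𝓦 u v ≡ true → covers parts u v ≡ true
    small    : excess parts ≤ cost 1 𝓦

singletons : ∀ {n} → VertexSet n → List (Fin n) → List (VertexSet n)
singletons U []      = []
singletons U (v ∷ L) = if U v then (λ w → does (v Fin.≟ w)) ∷ singletons U L else singletons U L

singleton-partition : ∀ {n} (U : VertexSet n) → Partition U []
singleton-partition {n} U = partition (singletons U (allFin n)) exact (nonempty (allFin n)) (λ _ _ _ _ ())
                              (≤-reflexive (excess-zero (allFin n)))
  where
  flip-≟ : ∀ (v w : Fin n) → does (v Fin.≟ w) ≡ does (w Fin.≟ v)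
  flip-≟ v w with v Fin.≟ w | w Fin.≟ v
  ... | yes _    | yes _   = refl
  ... | no  _    | no  _   = refl
  ... | yes refl | no  w≢w = contradiction refl w≢w
  ... | no  v≢v  | yes refl = contradiction refl v≢v
  count : ∀ L w → mult (singletons U L) w ≡ ∑ L (λ v → χ (does (w Fin.≟ v)) * χ (U v))
  count []      w = refl
  count (v ∷ L) w with U v
  ... | true  = cong₂ _+_ (trans (cong χ (flip-≟ v w)) (sym (*-identityʳ _))) (count L w)
  ... | false = cong₂ _+_ (sym (*-zeroʳ (χ (does (w Fin.≟ v))))) (count L w)
  exact : ∀ v → mult (singletons U (allFin n)) v ≡ χ (U v)
  exact v = trans (count (allFin n) v) (∑-δ* Fin._≟_ {allFin n} (Fin-enumerated n) v (χ ∘ U))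
  nonempty : ∀ L → Nonempty-sets (singletons U L)
  nonempty (v ∷ L) W∈ with U v
  nonempty (v ∷ L) (here refl) | true  = v , dec-true (v Fin.≟ v) refl
  nonempty (v ∷ L) (there W∈)  | true  = nonempty L W∈
  nonempty (v ∷ L) W∈          | false = nonempty L W∈
  excess-zero : ∀ L → excess (singletons U L) ≡ 0
  excess-zero []      = refl
  excess-zero (v ∷ L) with U v
  ... | true  = cong₂ _+_ (cong (_∸ 1) (Fin-enumerated n v)) (excess-zero L)
  ... | false = excess-zero L

components : ∀ {n} (U : VertexSet n) 𝓦 → AtLeast₂ 𝓦 → Partition U 𝓦
components U [] _ = singleton-partition U
components {n} U (X ∷ 𝓦) (2≤X ∷ ≥₂𝓦) with partition 𝓟 exact nonempty together small ← components U 𝓦 ≥₂𝓦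
  with any (X ∩ U) (allFin n) in hit
-- A member missing `U` is skipped, since merging its empty trace would create an empty part.
... | false = partition 𝓟 exact nonempty together′ (≤-trans small (m≤n+m _ (weight 1 X)))
  where
  together′ : ∀ u v → U u ≡ true → U v ≡ true → (X u ∧ X v) ∨ covers 𝓦 u v ≡ true → covers 𝓟 u v ≡ true
  together′ u v Uu Uv q = ∨-elim (X u ∧ X v) q
    (λ r → bool-contradiction (any-Fin (X ∩ U) u (cong₂ _∧_ (proj₁ (∧-true r)) Uu)) hit)
    (together u v Uu Uv)
... | true with x , _ , Xx ← any-witness (allFin n) hit =
  partition (merge (X ∩ U) 𝓟) exact′ (merge-nonempty (X ∩ U) 𝓟 (x , Xx) nonempty) together′
    (≤-trans (merge-excess (X ∩ U) 𝓟) (+-mono-≤ paid small))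
  where
  at-most-one : ∀ v → mult 𝓟 v ≤ 1
  at-most-one v = ≤-trans (≤-reflexive (exact v)) (χ-mono {b = true} (λ _ → refl))
  exact′ : ∀ v → mult (merge (X ∩ U) 𝓟) v ≡ χ (U v)
  exact′ v = trans (merge-mult (X ∩ U) 𝓟 at-most-one v) (cong χ same)
    where
    same : (X v ∧ U v) ∨ any (λ W → W v) 𝓟 ≡ U v
    same with U v in Uv | any (λ W → W v) 𝓟 in anyP
    ... | true  | true  = ∨-zeroʳ _
    ... | false | false = cong (_∨ false) (∧-zeroʳ (X v))
    ... | true  | false with W , W∈ , Wv ← mult-witness 𝓟 {v} (≤-reflexive (sym (trans (exact v) (cong χ Uv)))) =
          bool-contradiction (any-∈ {P = λ W → W v} W∈ Wv) anyP
    ... | false | true with W , W∈ , Wv ← any-witness 𝓟 anyP =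
          contradiction (≤-trans (mult-∈ W∈ Wv) (≤-reflexive (trans (exact v) (cong χ Uv)))) λ ()
  together′ : ∀ u v → U u ≡ true → U v ≡ true → (X u ∧ X v) ∨ covers 𝓦 u v ≡ true →
              covers (merge (X ∩ U) 𝓟) u v ≡ true
  together′ u v Uu Uv q = merge-covers (X ∩ U) 𝓟 u v (∨-elim (X u ∧ X v) q
    (λ r → ∨-left _ (cong₂ _∧_ (cong₂ _∧_ (proj₁ (∧-true {X u} r)) Uu) (cong₂ _∧_ (proj₂ (∧-true {X u} r)) Uv)))
    (λ r → ∨-right ((X ∩ U) u ∧ (X ∩ U) v) (together u v Uu Uv r)))
  paid : card (X ∩ U) ∸ 1 ≤ weight 1 X
  paid = ≤-trans (∸-monoˡ-≤ 1 (card-mono {X = X ∩ U} {X} (λ v q → proj₁ (∧-true q)))) (by-card (card X) 2≤X)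
    where
    identity : ∀ c → suc c ≡ 1 * c + 1
    identity = solve-∀
    by-card : ∀ c → 2 ≤ c → c ∸ 1 ≤ 1 * (c ∸ 2) + 1
    by-card (suc zero) (s≤s ())
    by-card (suc (suc c)) _ = ≤-reflexive (identity c)

-- Summation over the classes of a partition

module Global {n : ℕ} (adj : Fin n → Fin n → Bool) (irreflexive : ∀ v → adj v v ≡ false)
              (k₁ : ℕ) (1≤k₁ : 1 ≤ k₁) (m : ℕ) (v₀ v₁ : Fin n) (v₀≢v₁ : v₀ ≢ v₁) where
  open Local adj k₁ m

  -- Agrees with `weight` from two vertices on, but vanishes below, where `weight` is still 1.
  -- Traces of a member on the parts can be that small and must then be free of charge.
  rank : ℕ → ℕ
  rank 0             = 0
  rank 1             = 0
  rank (suc (suc c)) = k * c + 1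

  rank-weight : ∀ {X : VertexSet n} → 2 ≤ card X → rank (card X) ≡ weight k X
  rank-weight {X} 2≤X with card X
  rank-weight (s≤s ()) | 1
  rank-weight _ | suc (suc c) = refl

  rank-mono : ∀ {c d} → c ≤ d → rank c ≤ rank d
  rank-mono {0}           _ = z≤n
  rank-mono {1}           _ = z≤n
  rank-mono {suc (suc c)} (s≤s (s≤s c≤d)) = +-monoˡ-≤ 1 (*-monoʳ-≤ k c≤d)

  -- Two separate sets lose the constant 2k - 1 twice, their union only once; this difference is the
  -- slack in the last case.
  rank-superadditive : ∀ c d → rank c + rank d ≤ rank (c + d)
  rank-superadditive 0 d = ≤-refl
  rank-superadditive 1 d = rank-mono (n≤1+n d)
  rank-superadditive (suc (suc c)) 0 = ≤-reflexive (trans (+-identityʳ _) (cong (λ x → k * x + 1) (sym (+-identityʳ c))))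
  rank-superadditive (suc (suc c)) 1 =
    ≤-trans (≤-reflexive (+-identityʳ _)) (+-monoˡ-≤ 1 (*-monoʳ-≤ k (m≤m+n c 1)))
  rank-superadditive (suc (suc c)) (suc (suc d)) = farkas (suc (2 * k₁)) (≤-refl {0}) (identity k₁ c d)
    where
    identity : ∀ k₁ c d → (suc k₁ * c + 1) + (suc k₁ * d + 1) + 0 + suc (2 * k₁) ≡ suc k₁ * (c + suc (suc d)) + 1 + 0
    identity = solve-∀

  rank-∑ : ∀ {A : Set} (L : List A) f → ∑ L (rank ∘ f) ≤ rank (∑ L f)
  rank-∑ []      f = z≤n
  rank-∑ (a ∷ L) f = ≤-trans (+-monoʳ-≤ (rank (f a)) (rank-∑ L f)) (rank-superadditive (f a) (∑ L f))

  inside : VertexSet n → ℕ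
  inside Y = ∑ V (λ v → ∑ V (λ u → χ (Y v ∧ adj v u ∧ Y u)))

  inside-bound : ∀ Y → inside Y ≤ card Y * (card Y ∸ 1)
  inside-bound Y = begin
    inside Y                                ≤⟨ ∑-mono V pointwise ⟩
    ∑ V (λ v → (card Y ∸ 1) * χ (Y v))      ≡⟨ ∑-*ˡ V (card Y ∸ 1) _ ⟩
    (card Y ∸ 1) * card Y                   ≡⟨ *-comm (card Y ∸ 1) (card Y) ⟩
    card Y * (card Y ∸ 1)                   ∎
    where
    open ≤-Reasoning
    pointwise : ∀ v → ∑ V (λ u → χ (Y v ∧ adj v u ∧ Y u)) ≤ (card Y ∸ 1) * χ (Y v)
    pointwise v with Y v in Yv
    ... | false = ≤-trans (≤-reflexive (∑-zero V)) z≤n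
    ... | true  = begin
      ∑ V (λ u → χ (adj v u ∧ Y u))          ≡⟨ m+n∸m≡n 1 _ ⟨
      1 + ∑ V (λ u → χ (adj v u ∧ Y u)) ∸ 1  ≤⟨ ∸-monoˡ-≤ 1 one-less ⟩
      card Y ∸ 1                             ≡⟨ *-identityʳ _ ⟨
      (card Y ∸ 1) * 1                       ∎
      where
      at : ∀ u → χ (does (v Fin.≟ u)) + χ (adj v u ∧ Y u) ≤ χ (Y u)
      at u with v Fin.≟ u
      ... | yes refl rewrite irreflexive v | Yv = ≤-refl
      ... | no  _    = χ-mono (λ q → proj₂ (∧-true {adj v u} q))
      one-less : 1 + ∑ V (λ u → χ (adj v u ∧ Y u)) ≤ card Y
      one-less = ≤-trans (≤-reflexive (trans (cong (_+ ∑ V (λ u → χ (adj v u ∧ Y u))) (sym (Fin-enumerated n v))) (sym (∑-+ V _ _))))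
                   (∑-mono V at)

  -- This is where simplicity of the graph and k ≥ 2 are needed: a triangle has 3 ≤ k + 1 edges.
  small-inside : ∀ Y → ¬ (4 ≤ card Y) → inside Y ≤ 2 * rank (card Y)
  small-inside Y small = ≤-trans (inside-bound Y) (by-card (card Y) small)
    where
    two : ∀ k → 2 ≡ 2 * (k * 0 + 1)
    two = solve-∀
    three : ∀ k → 6 + 2 * k ≡ 2 * (suc (suc k) * 1 + 1)
    three = solve-∀
    three′ : ∀ {k₁} → 1 ≤ k₁ → 6 ≤ 2 * (suc k₁ * 1 + 1)
    three′ {suc j} _ = ≤-trans (m≤m+n 6 (2 * j)) (≤-reflexive (three j))
    by-card : ∀ c → ¬ (4 ≤ c) → c * (c ∸ 1) ≤ 2 * rank c
    by-card 0 _ = z≤n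
    by-card 1 _ = z≤n
    by-card 2 _ = ≤-reflexive (two k)
    by-card 3 _ = three′ 1≤k₁
    by-card (suc (suc (suc (suc c)))) ¬4≤ = contradiction (s≤s (s≤s (s≤s (s≤s z≤n)))) ¬4≤

  large-sets : List (VertexSet n) → List (VertexSet n)
  large-sets [] = []
  large-sets (Y ∷ 𝓨) with 4 ≤? card Y
  ... | yes _ = Y ∷ large-sets 𝓨
  ... | no  _ = large-sets 𝓨

  large-sets-∈ : ∀ 𝓨 {Y} → Y ∈ large-sets 𝓨 → Y ∈ 𝓨 × 4 ≤ card Y
  large-sets-∈ (X ∷ 𝓨) Y∈ with 4 ≤? card X
  large-sets-∈ (X ∷ 𝓨) (here refl) | yes 4≤ = here refl , 4≤
  large-sets-∈ (X ∷ 𝓨) (there Y∈)  | yes _  = let i , l = large-sets-∈ 𝓨 Y∈ in there i , l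
  large-sets-∈ (X ∷ 𝓨) Y∈          | no _   = let i , l = large-sets-∈ 𝓨 Y∈ in there i , l

  -- `b` collects the pairs covered by the large members already passed. Dropping a small member
  -- uncovers at most `2 * rank (card Y)` ordered pairs, and its saved cost enters with the factor
  -- `2 * p`, where p ≥ 1.
  drop-small : ∀ p₁ W (b : Fin n → Fin n → Bool) 𝓨 →
    2 * suc p₁ * cost k (large-sets 𝓨) + uncovered W (λ v u → b v u ∨ covers (large-sets 𝓨) v u)
    ≤ 2 * suc p₁ * ∑ 𝓨 (rank ∘ card) + uncovered W (λ v u → b v u ∨ covers 𝓨 v u)
  drop-small p₁ W b [] = ≤-refl
  drop-small p₁ W b (Y ∷ 𝓨) with 4 ≤? card Y
  ... | yes 4≤ = begin
    2 * p * (weight k Y + cost k (large-sets 𝓨)) + uncovered W (λ v u → b v u ∨ (Y v ∧ Y u) ∨ covers (large-sets 𝓨) v u)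
      ≡⟨ cong₂ (λ r x → 2 * p * (r + cost k (large-sets 𝓨)) + x) (sym (rank-weight {Y} (≤-trans (s≤s (s≤s z≤n)) 4≤))) (regroup (large-sets 𝓨)) ⟩
    2 * p * (rank (card Y) + cost k (large-sets 𝓨)) + uncovered W (λ v u → b′ v u ∨ covers (large-sets 𝓨) v u)
      ≡⟨ distribute (2 * p) (rank (card Y)) _ _ ⟩
    2 * p * rank (card Y) + (2 * p * cost k (large-sets 𝓨) + uncovered W (λ v u → b′ v u ∨ covers (large-sets 𝓨) v u))
      ≤⟨ +-monoʳ-≤ (2 * p * rank (card Y)) (drop-small p₁ W b′ 𝓨) ⟩
    2 * p * rank (card Y) + (2 * p * ∑ 𝓨 (rank ∘ card) + uncovered W (λ v u → b′ v u ∨ covers 𝓨 v u))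
      ≡⟨ distribute (2 * p) (rank (card Y)) _ _ ⟨
    2 * p * (rank (card Y) + ∑ 𝓨 (rank ∘ card)) + uncovered W (λ v u → b′ v u ∨ covers 𝓨 v u)
      ≡⟨ cong (2 * p * (rank (card Y) + ∑ 𝓨 (rank ∘ card)) +_) (regroup 𝓨) ⟨
    2 * p * (rank (card Y) + ∑ 𝓨 (rank ∘ card)) + uncovered W (λ v u → b v u ∨ (Y v ∧ Y u) ∨ covers 𝓨 v u) ∎
    where
    open ≤-Reasoning
    p = suc p₁
    b′ : Fin n → Fin n → Bool
    b′ v u = b v u ∨ (Y v ∧ Y u)
    distribute : ∀ a r c x → a * (r + c) + x ≡ a * r + (a * c + x)
    distribute = solve-∀
    regroup : ∀ 𝓩 → uncovered W (λ v u → b v u ∨ (Y v ∧ Y u) ∨ covers 𝓩 v u) ≡ uncovered W (λ v u → b′ v u ∨ covers 𝓩 v u)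
    regroup 𝓩 = ∑-cong V λ v → ∑-cong V λ u →
      cong (λ x → χ (W v ∧ adj v u ∧ not x)) (sym (∨-assoc (b v u) (Y v ∧ Y u) (covers 𝓩 v u)))
  ... | no small = begin
    2 * p * cost k (large-sets 𝓨) + uncovered W (λ v u → b v u ∨ covers (large-sets 𝓨) v u)
      ≤⟨ drop-small p₁ W b 𝓨 ⟩
    2 * p * ∑ 𝓨 (rank ∘ card) + uncovered W (λ v u → b v u ∨ covers 𝓨 v u)
      ≤⟨ +-monoʳ-≤ (2 * p * ∑ 𝓨 (rank ∘ card)) uncover ⟩
    2 * p * ∑ 𝓨 (rank ∘ card) + (uncovered W (λ v u → b v u ∨ (Y v ∧ Y u) ∨ covers 𝓨 v u) + 2 * p * rank (card Y))
      ≡⟨ collect (2 * p) (rank (card Y)) _ _ ⟩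
    2 * p * (rank (card Y) + ∑ 𝓨 (rank ∘ card)) + uncovered W (λ v u → b v u ∨ (Y v ∧ Y u) ∨ covers 𝓨 v u) ∎
    where
    open ≤-Reasoning
    p = suc p₁
    collect : ∀ a r c x → a * c + (x + a * r) ≡ a * (r + c) + x
    collect = solve-∀
    pointwise : ∀ w a b y y′ c → χ (w ∧ a ∧ not (b ∨ c)) ≤ χ (w ∧ a ∧ not (b ∨ (y ∧ y′) ∨ c)) + χ (y ∧ a ∧ y′)
    pointwise = ≤-tautology₆ refl
    uncover : uncovered W (λ v u → b v u ∨ covers 𝓨 v u)
              ≤ uncovered W (λ v u → b v u ∨ (Y v ∧ Y u) ∨ covers 𝓨 v u) + 2 * p * rank (card Y)
    uncover = begin
      uncovered W (λ v u → b v u ∨ covers 𝓨 v u)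
        ≤⟨ ∑-mono V (λ v → ∑-mono V (λ u → pointwise (W v) (adj v u) (b v u) (Y v) (Y u) (covers 𝓨 v u))) ⟩
      ∑ V (λ v → ∑ V (λ u → χ (W v ∧ adj v u ∧ not (b v u ∨ (Y v ∧ Y u) ∨ covers 𝓨 v u)) + χ (Y v ∧ adj v u ∧ Y u)))
        ≡⟨ trans (∑-cong V (λ v → ∑-+ V _ _)) (∑-+ V _ _) ⟩
      uncovered W (λ v u → b v u ∨ (Y v ∧ Y u) ∨ covers 𝓨 v u) + inside Y
        ≤⟨ +-monoʳ-≤ _ (≤-trans (small-inside Y small) (*-monoˡ-≤ (rank (card Y)) (*-monoʳ-≤ 2 (s≤s {0} {p₁} z≤n)))) ⟩
      uncovered W (λ v u → b v u ∨ (Y v ∧ Y u) ∨ covers 𝓨 v u) + 2 * p * rank (card Y) ∎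

  local-bound : ∀ p → WeaklyConnectedᵇ p → ∀ W 𝓨 {w} → W w ≡ true → (∀ {Y} → Y ∈ 𝓨 → Y ⊆ᵇ W) →
    2 * (k * p) * card W + 2 * m
    ≤ 2 * p * ∑ 𝓨 (rank ∘ card) + uncovered W (covers 𝓨) + threshold p * fullness W
  -- For p = 0 only `2 * m` has to be found, and this is `threshold 0`.
  local-bound zero conn W 𝓨 Ww sub = ≤-trans (≤-reflexive (cong (λ x → 2 * x * card W + 2 * m) (*-zeroʳ k))) pays
    where
    pays : 2 * m ≤ uncovered W (covers 𝓨) + threshold 0 * fullness W
    pays with missing W in mis
    ... | false = ≤-trans (≤-reflexive (sym (*-identityʳ (2 * m)))) (m≤n+m _ _)
    ... | true with z , Wz ← missing-witness {X = W} mis =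
      ≤-trans (uncovered-boundary {0} conn {W} {𝓨} Ww Wz sub) (m≤m+n _ _)
  local-bound (suc p₁) conn W 𝓨 Ww sub =
    ≤-trans (large-bound Ww) (+-monoˡ-≤ (threshold (suc p₁) * fullness W) (drop-small p₁ W (λ _ _ → false) 𝓨))
    where
    open Large p₁ conn v₀ v₁ v₀≢v₁ W (large-sets 𝓨)
      (λ Y∈ → sub (proj₁ (large-sets-∈ 𝓨 Y∈))) (λ Y∈ → proj₂ (large-sets-∈ 𝓨 Y∈))

  module _ (p : ℕ) (conn : WeaklyConnectedᵇ p) (U : VertexSet n) (𝓧 𝓦 : List (VertexSet n))
           (≥₂𝓧 : AtLeast₂ 𝓧) (≥₂𝓦 : AtLeast₂ 𝓦) where
    open Partition (components U 𝓦 ≥₂𝓦)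

    at-most-one : ∀ v → mult parts v ≤ 1
    at-most-one v = ≤-trans (≤-reflexive (exact v)) (χ-mono {b = true} (λ _ → refl))

    in-part : VertexSet n → List (VertexSet n)
    in-part W = map (_∩ W) 𝓧

    in-part-⊆ : ∀ {W Y} → Y ∈ in-part W → Y ⊆ᵇ W
    in-part-⊆ {W} Y∈ v Yv with X , _ , refl ← ∈-map⁻ (_∩ W) Y∈ = proj₂ (∧-true {X v} Yv)

    covers-in-part : ∀ (W : VertexSet n) 𝓧 {v u} → W v ≡ true → W u ≡ true → covers 𝓧 v u ≡ true →
                     covers (map (_∩ W) 𝓧) v u ≡ true
    covers-in-part W (X ∷ 𝓧) {v} {u} Wv Wu q = ∨-elim (X v ∧ X u) q
      (λ r → ∨-left _ (cong₂ _∧_ (cong₂ _∧_ (proj₁ (∧-true {X v} r)) Wv) (cong₂ _∧_ (proj₂ (∧-true {X v} r)) Wu)))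
      (λ r → ∨-right _ (covers-in-part W 𝓧 Wv Wu r))

    doubly-uncovered : ℕ
    doubly-uncovered = ∑ V (λ v → ∑ V (λ u → χ (U v ∧ adj v u ∧ not (U u ∧ covers 𝓧 v u ∧ covers 𝓦 v u))))

    card-parts : ∑ parts card ≡ card U
    card-parts = trans (∑-swap parts V _) (∑-cong V exact)

    -- The traces of `X` on the parts are disjoint, so superadditivity and monotonicity of `rank`
    -- bound them by `X` itself.
    rank-parts : ∑ parts (λ W → ∑ (in-part W) (rank ∘ card)) ≤ cost k 𝓧
    rank-parts = begin
      ∑ parts (λ W → ∑ (in-part W) (rank ∘ card))        ≡⟨ ∑-cong parts (λ W → ∑-map (_∩ W) 𝓧 _) ⟩
      ∑ parts (λ W → ∑ 𝓧 (λ X → rank (card (X ∩ W))))    ≡⟨ ∑-swap parts 𝓧 _ ⟩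
      ∑ 𝓧 (λ X → ∑ parts (λ W → rank (card (X ∩ W))))    ≤⟨ ∑-mono∈ 𝓧 pointwise ⟩
      cost k 𝓧                                           ∎
      where
      open ≤-Reasoning
      count : ∀ X → ∑ parts (λ W → card (X ∩ W)) ≤ card X
      count X = begin
        ∑ parts (λ W → card (X ∩ W))                        ≡⟨ ∑-swap parts V _ ⟩
        ∑ V (λ v → ∑ parts (λ W → χ (X v ∧ W v)))           ≡⟨ ∑-cong V (λ v → ∑-cong parts (λ W → ∧-χ (X v) (W v))) ⟩
        ∑ V (λ v → ∑ parts (λ W → χ (X v) * χ (W v)))       ≡⟨ ∑-cong V (λ v → ∑-*ˡ parts (χ (X v)) _) ⟩
        ∑ V (λ v → χ (X v) * mult parts v)                  ≤⟨ ∑-mono V (λ v → *-monoʳ-≤ (χ (X v)) (at-most-one v)) ⟩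
        ∑ V (λ v → χ (X v) * 1)                             ≡⟨ ∑-cong V (λ v → *-identityʳ (χ (X v))) ⟩
        card X                                              ∎
        where
        ∧-χ : ∀ a b → χ (a ∧ b) ≡ χ a * χ b
        ∧-χ true  b = sym (+-identityʳ (χ b))
        ∧-χ false b = refl
      pointwise : ∀ {X} → X ∈ 𝓧 → ∑ parts (λ W → rank (card (X ∩ W))) ≤ weight k X
      pointwise {X} X∈ = ≤-trans (rank-∑ parts (λ W → card (X ∩ W)))
        (≤-trans (rank-mono (count X)) (≤-reflexive (rank-weight {X} (All.lookup ≥₂𝓧 X∈))))

    -- A pair inside `U` covered by `𝓦` stays in one part; if `𝓧` covers it too, so does the trace
    -- of `𝓧` on this part. Hence an uncovered pair of a part leaves `U` or escapes one of the
    -- covers.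
    uncovered-parts : ∑ parts (λ W → uncovered W (covers (in-part W))) ≤ doubly-uncovered
    uncovered-parts = begin
      ∑ parts (λ W → uncovered W (covers (in-part W)))
        ≡⟨ trans (∑-swap parts V _) (∑-cong V (λ v → ∑-swap parts V _)) ⟩
      ∑ V (λ v → ∑ V (λ u → ∑ parts (λ W → χ (W v ∧ adj v u ∧ not (covers (in-part W) v u)))))
        ≤⟨ ∑-mono V (λ v → ∑-mono V (λ u → pointwise v u)) ⟩
      doubly-uncovered ∎
      where
      open ≤-Reasoning
      pointwise : ∀ v u → ∑ parts (λ W → χ (W v ∧ adj v u ∧ not (covers (in-part W) v u)))
                          ≤ χ (U v ∧ adj v u ∧ not (U u ∧ covers 𝓧 v u ∧ covers 𝓦 v u))
      pointwise v u = begin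
        ∑ parts (λ W → χ (W v ∧ adj v u ∧ not (covers (in-part W) v u)))  ≤⟨ ∑-mono∈ parts each ⟩
        ∑ parts (λ W → χ r * χ (W v))                                     ≡⟨ ∑-*ˡ parts (χ r) _ ⟩
        χ r * mult parts v                                                ≡⟨ cong (χ r *_) (exact v) ⟩
        χ r * χ (U v)                                                     ≤⟨ join (U v) r ⟩
        χ (U v ∧ r)                                                       ∎
        where
        r : Bool
        r = adj v u ∧ not (U u ∧ covers 𝓧 v u ∧ covers 𝓦 v u)
        join : ∀ a b → χ b * χ a ≤ χ (a ∧ b)
        join = ≤-tautology₂ refl
        each : ∀ {W} → W ∈ parts → χ (W v ∧ adj v u ∧ not (covers (in-part W) v u)) ≤ χ r * χ (W v)
        each {W} W∈ with W v in Wv | adj v u | U u in Uu | covers 𝓧 v u in c𝓧 | covers 𝓦 v u in c𝓦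
        ... | false | _     | _     | _     | _     = z≤n
        ... | true  | false | _     | _     | _     = z≤n
        ... | true  | true  | false | _     | _     = χ-mono {b = true} λ _ → refl
        ... | true  | true  | true  | false | _     = χ-mono {b = true} λ _ → refl
        ... | true  | true  | true  | true  | false = χ-mono {b = true} λ _ → refl
        ... | true  | true  | true  | true  | true  = ≤-reflexive (cong (χ ∘ not) (covers-in-part W 𝓧 {v} {u} Wv Wu c𝓧))
          where
          Uv : U v ≡ true
          Uv with U v in eq
          ... | true  = refl
          ... | false = contradiction (≤-trans (mult-∈ W∈ Wv) (≤-reflexive (trans (exact v) (cong χ eq)))) λ ()
          Wu : W u ≡ true
          Wu = unique-cover (at-most-one v) W∈ Wv (together v u Uv Uu c𝓦)

    -- Full parts would all contain `v₀`, but the parts are disjoint.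
    full-parts : ∑ parts fullness ≤ 1
    full-parts = ≤-trans (∑-mono parts (λ W → χ-mono (at-v₀ W))) (at-most-one v₀)
      where
      at-v₀ : ∀ W → not (missing W) ≡ true → W v₀ ≡ true
      at-v₀ W q with missing W in mis
      ... | false = not-missing mis v₀

    count-parts : card U ≤ ∑ parts (λ _ → 1) + cost 1 𝓦
    count-parts = begin
      card U                                        ≡⟨ card-parts ⟨
      ∑ parts card                                  ≤⟨ ∑-mono parts (λ W → m≤n+m∸n (card W) 1) ⟩
      ∑ parts (λ W → 1 + (card W ∸ 1))              ≡⟨ ∑-+ parts _ _ ⟩
      ∑ parts (λ _ → 1) + excess parts              ≤⟨ +-monoʳ-≤ (∑ parts (λ _ → 1)) small ⟩
      ∑ parts (λ _ → 1) + cost 1 𝓦                  ∎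
      where open ≤-Reasoning

    -- Every part earns `2 * m`; together with the cost of `𝓦` the parts number at least |U|, which
    -- yields the term 2m|U|. The one `threshold p` is the allowance for a full part.
    global-bound : 2 * (k * p + m) * card U
                   ≤ threshold p + 2 * (p * cost k 𝓧 + m * cost 1 𝓦) + doubly-uncovered
    global-bound = arithmetic (k * p) p m (card U) (∑ parts (λ _ → 1)) (cost k 𝓧) (cost 1 𝓦) _ _ _ _ (threshold p)
      summed rank-parts uncovered-parts (*-monoʳ-≤ (threshold p) full-parts) (*-monoʳ-≤ (2 * m) count-parts)
      where
      summed : 2 * (k * p) * card U + 2 * m * ∑ parts (λ _ → 1)
               ≤ 2 * p * ∑ parts (λ W → ∑ (in-part W) (rank ∘ card))
                 + ∑ parts (λ W → uncovered W (covers (in-part W))) + threshold p * ∑ parts fullness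
      summed = subst₂ _≤_
        (trans (∑-+ parts _ _) (cong₂ _+_ (trans (∑-*ˡ parts (2 * (k * p)) card) (cong (2 * (k * p) *_) card-parts)) (∑-*ˡ parts (2 * m) (λ _ → 1))))
        (trans (∑-+ parts _ (λ W → threshold p * fullness W)) (cong₂ _+_ (trans (∑-+ parts _ _) (cong₂ _+_ (∑-*ˡ parts (2 * p) _) refl)) (∑-*ˡ parts (threshold p) fullness)))
        (∑-mono∈ parts λ {W} W∈ → subst (λ x → 2 * (k * p) * card W + x ≤ 2 * p * ∑ (in-part W) (rank ∘ card) + uncovered W (covers (in-part W)) + threshold p * fullness W) (sym (*-identityʳ (2 * m)))
          (local-bound p conn W (in-part W) (proj₂ (nonempty W∈)) in-part-⊆))
      arithmetic : ∀ kp p m u t X W r d f D l →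
        2 * kp * u + 2 * m * t ≤ 2 * p * r + d + l * f → r ≤ X → d ≤ D → l * f ≤ l * 1 → 2 * m * u ≤ 2 * m * (t + W) →
        2 * (kp + m) * u ≤ l + 2 * (p * X + m * W) + D
      arithmetic kp p m u t X W r d f D l h₁ h₂ h₃ h₄ h₅ =
        farkas 0 (+-mono-≤ (+-mono-≤ h₁ (*-monoʳ-≤ (2 * p) h₂)) (+-mono-≤ (+-mono-≤ h₃ h₄) h₅))
          (identity kp p m u t X W r d f D l)
        where
        identity : ∀ kp p m u t X W r d f D l →
          2 * (kp + m) * u + ((2 * p * r + d + l * f + 2 * p * X) + (D + l * 1 + 2 * m * (t + W))) + 0
          ≡ l + 2 * (p * X + m * W) + D + ((2 * kp * u + 2 * m * t + 2 * p * r) + (d + l * f + 2 * m * u))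
        identity = solve-∀

-- Sparse graphs with n − 1 edges are trees

_<ᶠ_ : ∀ {n} → Fin n → Fin n → Bool
u <ᶠ v = toℕ u <ᵇ toℕ v

<ᶠ-irrefl : ∀ {n} (v : Fin n) → (v <ᶠ v) ≡ false
<ᶠ-irrefl v with v <ᶠ v in lt
... | false = refl
... | true  = contradiction (<ᵇ⇒< (toℕ v) (toℕ v) (subst T (sym lt) _)) (<-irrefl refl)

<ᶠ⇒≢ : ∀ {n} {u v : Fin n} → (u <ᶠ v) ≡ true → u ≢ v
<ᶠ⇒≢ {u = u} lt refl = bool-contradiction lt (<ᶠ-irrefl u)

<ᶠ-connex : ∀ {n} {u v : Fin n} → u ≢ v → χ (u <ᶠ v) + χ (v <ᶠ u) ≡ 1
<ᶠ-connex {u = u} {v} u≢v with u <ᶠ v in uv | v <ᶠ u in vu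
... | true  | false = refl
... | false | true  = refl
... | true  | true  = contradiction (<ᵇ⇒< (toℕ u) (toℕ v) (subst T (sym uv) _))
                        (<-asym (<ᵇ⇒< (toℕ v) (toℕ u) (subst T (sym vu) _)))
... | false | false = contradiction (Fin.toℕ-injective (≤-antisym (≮⇒≥ (not-less vu)) (≮⇒≥ (not-less uv)))) u≢v
  where
  not-less : ∀ {a b} → (a <ᵇ b) ≡ false → ¬ (a < b)
  not-less eq a<b = subst T eq (<⇒<ᵇ a<b)

-- The handshake: passes from ordered pairs, in which degrees and boundaries are counted, to the
-- pairs u < v read by `countPairs`.
∑-unordered : ∀ {n} (g : Fin n → Fin n → ℕ) → (∀ v → g v v ≡ 0) →
  ∑ (allFin n) (λ v → ∑ (allFin n) (g v)) ≡
  ∑ (allFin n) (λ u → ∑ (allFin n) (λ v → χ (u <ᶠ v) * (g u v + g v u)))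
∑-unordered {n} g diagonal = begin
  ∑ V (λ v → ∑ V (g v))
    ≡⟨ ∑-cong V (λ v → ∑-cong V (λ u → split v u)) ⟩
  ∑ V (λ v → ∑ V (λ u → χ (v <ᶠ u) * g v u + χ (u <ᶠ v) * g v u))
    ≡⟨ trans (∑-cong V (λ v → ∑-+ V _ _)) (∑-+ V _ _) ⟩
  ∑ V (λ v → ∑ V (λ u → χ (v <ᶠ u) * g v u)) + ∑ V (λ v → ∑ V (λ u → χ (u <ᶠ v) * g v u))
    ≡⟨ cong (∑ V (λ v → ∑ V (λ u → χ (v <ᶠ u) * g v u)) +_) (∑-swap V V _) ⟩
  ∑ V (λ v → ∑ V (λ u → χ (v <ᶠ u) * g v u)) + ∑ V (λ u → ∑ V (λ v → χ (u <ᶠ v) * g v u))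
    ≡⟨ trans (∑-cong V (λ v → ∑-+ V _ _)) (∑-+ V _ _) ⟨
  ∑ V (λ u → ∑ V (λ v → χ (u <ᶠ v) * g u v + χ (u <ᶠ v) * g v u))
    ≡⟨ ∑-cong V (λ u → ∑-cong V (λ v → *-distribˡ-+ (χ (u <ᶠ v)) (g u v) (g v u))) ⟨
  ∑ V (λ u → ∑ V (λ v → χ (u <ᶠ v) * (g u v + g v u))) ∎
  where
  open ≡-Reasoning
  V = allFin n
  split : ∀ v u → g v u ≡ χ (v <ᶠ u) * g v u + χ (u <ᶠ v) * g v u
  split v u with v Fin.≟ u
  ... | yes refl rewrite diagonal v = sym (trans (cong₂ _+_ (*-zeroʳ (χ (v <ᶠ v))) (*-zeroʳ (χ (v <ᶠ v)))) refl)
  ... | no v≢u = trans (sym (*-identityˡ (g v u))) (trans (cong (_* g v u) (sym (<ᶠ-connex v≢u))) (*-distribʳ-+ (g v u) (χ (v <ᶠ u)) (χ (u <ᶠ v))))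

∣∣≡card : ∀ {n} (X : Subset n) → ∣ X ∣ ≡ card (Vec.lookup X)
∣∣≡card Vec.[] = refl
∣∣≡card {suc n} (b Vec.∷ X) = trans (head b) (cong (χ b +_) (trans (∣∣≡card X) (sym shift)))
  where
  shift : sum (map (χ ∘ Vec.lookup (b Vec.∷ X)) (tabulate suc)) ≡ card (Vec.lookup X)
  shift = trans (cong (λ L → ∑ L (χ ∘ Vec.lookup (b Vec.∷ X))) (sym (map-tabulate (λ i → i) suc))) (∑-map suc (allFin n) _)
  head : ∀ b → ∣ b Vec.∷ X ∣ ≡ χ b + ∣ X ∣
  head true  = refl
  head false = refl

∣tabulate∣ : ∀ {n} (X : VertexSet n) → ∣ Vec.tabulate X ∣ ≡ card X
∣tabulate∣ {n} X = trans (∣∣≡card (Vec.tabulate X)) (∑-cong (allFin n) (λ v → cong χ (lookup∘tabulate X v)))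

countPairs-cong : ∀ {n} {f g : Fin n → Fin n → Bool} → (∀ u v → f u v ≡ g u v) → countPairs f ≡ countPairs g
countPairs-cong {n} f≡g = ∑-cong (allFin n) λ u → ∑-cong (allFin n) λ v → cong (λ b → χ ((u <ᶠ v) ∧ b)) (f≡g u v)

module Tree {n : ℕ} (T : Graph n)
            (sparse : ∀ (X : Subset n) → 2 ≤ ∣ X ∣ → eIn T X ≤ ∣ X ∣ ∸ 1)
            (size : numEdges T ≡ n ∸ 1) where

  V : List (Fin n)
  V = allFin n

  edges-in : VertexSet n → ℕ
  edges-in X = countPairs (λ u v → adj T u v ∧ X u ∧ X v)

  sparse₂ : ∀ X → 2 ≤ card X → edges-in X ≤ card X ∸ 1
  sparse₂ X 2≤ = subst₂ (λ e c → e ≤ c ∸ 1)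
    (countPairs-cong (λ u v → cong (adj T u v ∧_) (cong₂ _∧_ (lookup∘tabulate X u) (lookup∘tabulate X v))))
    (∣tabulate∣ X)
    (sparse (Vec.tabulate X) (subst (2 ≤_) (sym (∣tabulate∣ X)) 2≤))

  sparse₁ : ∀ X → edges-in X ≤ card X ∸ 1
  sparse₁ X with 2 ≤? card X
  ... | yes 2≤ = sparse₂ X 2≤
  ... | no  2≰ = ≤-trans (≤-reflexive (trans (∑-cong V (λ u → trans (∑-cong V (λ v → cong χ (absent u v))) (∑-zero V))) (∑-zero V))) z≤n
    where
    absent : ∀ u v → (u <ᶠ v) ∧ adj T u v ∧ X u ∧ X v ≡ false
    absent u v with u <ᶠ v in lt | adj T u v | X u ∧ X v in both
    ... | false | _     | _     = refl
    ... | true  | false | _     = refl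
    ... | true  | true  | false = refl
    ... | true  | true  | true  = contradiction (card-distinct {X = X} (<ᶠ⇒≢ lt) both) 2≰

  -- Otherwise every edge lies in `C` or in its complement, and sparsity on both sides leaves at
  -- most n - 2 edges.
  closed-full : ∀ (C : VertexSet n) {u} → C u ≡ true → (∀ x y → C x ≡ true → adj T x y ≡ true → C y ≡ true) → ∀ v → C v ≡ true
  closed-full C {u} Cu closed v with C v in Cv
  ... | true  = refl
  ... | false = ⊥-elim (arithmetic (card-nonempty {X = C} Cu) (card-nonempty {X = not ∘ C} (cong not Cv))
                  (card-complement C) (≤-trans (≤-reflexive (sym size)) (≤-trans split (+-mono-≤ (sparse₁ C) (sparse₁ (not ∘ C))))))
    where
    arithmetic : ∀ {c d n} → 1 ≤ c → 1 ≤ d → c + d ≡ n → n ∸ 1 ≤ (c ∸ 1) + (d ∸ 1) → ⊥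
    arithmetic {suc c} {suc d} _ _ refl le = <-irrefl refl (≤-trans (≤-reflexive (sym (+-suc c d))) le)
    pointwise : ∀ u v → χ ((u <ᶠ v) ∧ adj T u v) ≤ χ ((u <ᶠ v) ∧ adj T u v ∧ C u ∧ C v) + χ ((u <ᶠ v) ∧ adj T u v ∧ not (C u) ∧ not (C v))
    pointwise u v with u <ᶠ v | adj T u v in a | C u in Cu | C v in Cv
    ... | false | _     | _     | _     = z≤n
    ... | true  | false | _     | _     = z≤n
    ... | true  | true  | true  | true  = ≤-refl
    ... | true  | true  | false | false = ≤-refl
    ... | true  | true  | true  | false = bool-contradiction (closed u v Cu a) Cv
    ... | true  | true  | false | true  = bool-contradiction (closed v u Cv (trans (Graph.sym T v u) a)) Cu
    split : numEdges T ≤ edges-in C + edges-in (not ∘ C)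
    split = ≤-trans (∑-mono V (λ u → ∑-mono V (λ v → pointwise u v)))
      (≤-reflexive (trans (∑-cong V (λ u → ∑-+ V _ _)) (∑-+ V _ _)))

  reach-snoc : ∀ {u x y} → Reachable T u x → adj T x y ≡ true → Reachable T u y
  reach-snoc here         a = step a here
  reach-snoc (step b r)   a = step b (reach-snoc r a)

  -- Search from `u`: the reached set is enlarged along an edge leaving it until it is closed. `d`
  -- bounds the number of vertices not yet reached.
  grow : ∀ d u (C : VertexSet n) → n ≤ card C + d → C u ≡ true → (∀ w → C w ≡ true → Reachable T u w) → ∀ v → Reachable T u v
  grow d u C fuel Cu reach v with any (λ x → any (λ y → C x ∧ adj T x y ∧ not (C y)) V) V in found
  ... | false = reach v (closed-full C Cu closed v)
    where
    closed : ∀ x y → C x ≡ true → adj T x y ≡ true → C y ≡ true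
    closed x y Cx a with C y in Cy
    ... | true  = refl
    ... | false = bool-contradiction
      (any-Fin (λ x → any (λ y → C x ∧ adj T x y ∧ not (C y)) V) x
        (any-Fin (λ y → C x ∧ adj T x y ∧ not (C y)) y (cong₂ _∧_ Cx (cong₂ _∧_ a (cong not Cy))))) found
  ... | true with x , _ , found′ ← any-witness V found with y , _ , q ← any-witness V found′
    with Cx , q′ ← ∧-true {C x} q with a , ¬Cy ← ∧-true {adj T x y} q′ = continue d fuel
    where
    C′ : VertexSet n
    C′ w = C w ∨ does (y Fin.≟ w)
    bigger : card C′ ≡ suc (card C)
    bigger = trans (∑-cong V pointwise) (trans (∑-+ V _ _) (cong (_+ card C) (Fin-enumerated n y)))
      where
      pointwise : ∀ w → χ (C′ w) ≡ χ (does (y Fin.≟ w)) + χ (C w)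
      pointwise w with y Fin.≟ w
      ... | no  _    = cong χ (∨-identityʳ (C w))
      ... | yes refl = new (C y) ¬Cy
        where
        new : ∀ b → not b ≡ true → χ (b ∨ true) ≡ 1 + χ b
        new false _ = refl
    reach′ : ∀ w → C′ w ≡ true → Reachable T u w
    reach′ w r = ∨-elim (C w) r (reach w) λ eq →
      subst (Reachable T u) (does-sound (y Fin.≟ w) eq) (reach-snoc (reach x Cx) a)
    continue : ∀ d → n ≤ card C + d → Reachable T u v
    continue zero    fuel = contradiction (≤-trans (≤-trans (≤-reflexive (sym bigger)) (≤-trans (card-mono {X = C′} {full} (λ _ _ → refl)) (≤-reflexive (card-full n))))
                              (≤-trans fuel (≤-reflexive (+-identityʳ _)))) (<-irrefl refl)
    continue (suc d) fuel = grow d u C′ (≤-trans fuel (≤-reflexive (trans (+-suc (card C) d) (cong (_+ d) (sym bigger)))))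
                              (∨-left _ Cu) reach′ v

  connected : Connected T
  connected u = grow n u (λ w → does (u Fin.≟ w)) (m≤n+m n _) (dec-true (u Fin.≟ u) refl) reach
    where
    reach : ∀ w → does (u Fin.≟ w) ≡ true → Reachable T u w
    reach w eq with u Fin.≟ w
    ... | yes refl = here

  TwoNeighbours : Fin n → List (Fin n) → Set
  TwoNeighbours x L = ∃[ y ] ∃[ z ] (adj T x y ≡ true × adj T x z ≡ true × y ≢ z × y ∈ L × z ∈ L)

  -- The path is shortened at its front while the closing vertex `v` is kept, so the last vertex
  -- still finds its second neighbour in the list.
  path-neighbours : ∀ v a xs {x} → Chain T (a ∷ xs ++ v ∷ []) → Unique (v ∷ a ∷ xs) → x ∈ xs → TwoNeighbours x (v ∷ a ∷ xs)
  path-neighbours v a (x ∷ []) (ax , xv , _) ((v≢a ∷ _) ∷ _) (here refl) =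
    a , v , trans (Graph.sym T x a) ax , xv , (λ a≡v → v≢a (sym a≡v)) , there (here refl) , here refl
  path-neighbours v a (x ∷ y ∷ r) (ax , xy , _) (_ ∷ (_ ∷ a≢y ∷ _) ∷ _) (here refl) =
    a , y , trans (Graph.sym T x a) ax , xy , a≢y , there (here refl) , there (there (there (here refl)))
  path-neighbours v a (y ∷ r) (_ , chain) ((_ ∷ v≢r) ∷ (_ ∷ unique)) (there x∈r)
    with p , q , xp , xq , p≢q , p∈ , q∈ ← path-neighbours v y r chain (v≢r ∷ unique) x∈r
    = p , q , xp , xq , p≢q , lift p∈ , lift q∈
    where
    lift : ∀ {w} → w ∈ v ∷ y ∷ r → w ∈ v ∷ a ∷ y ∷ r
    lift (here refl) = here refl
    lift (there w∈)  = there (there w∈)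

  path-last : ∀ v a b r → Chain T (a ∷ b ∷ r ++ v ∷ []) → ∃[ z ] (z ∈ b ∷ r × adj T z v ≡ true)
  path-last v a b []      (_ , bv , _)  = b , here refl , bv
  path-last v a b (c ∷ r) (_ , chain) = let z , z∈ , zv = path-last v b c r chain in z , there z∈ , zv

  cycle-neighbours : ∀ v vs {x} → 2 ≤ length vs → Unique (v ∷ vs) → Chain T (v ∷ vs ++ v ∷ []) → x ∈ v ∷ vs →
                     TwoNeighbours x (v ∷ vs)
  cycle-neighbours v (a ∷ []) (s≤s ()) _ _ _
  cycle-neighbours v (a ∷ b ∷ r) _ (_ ∷ (a≢ ∷ _)) (va , chain) (here refl)
    with z , z∈ , zv ← path-last v a b r chain
    = a , z , va , trans (Graph.sym T v z) zv , All.lookup a≢ z∈ , there (here refl) , there (there z∈)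
  cycle-neighbours v (a ∷ b ∷ r) _ ((_ ∷ v≢b ∷ _) ∷ _) (va , ab , _) (there (here refl)) =
    v , b , trans (Graph.sym T a v) va , ab , v≢b , here refl , there (there (here refl))
  cycle-neighbours v (a ∷ b ∷ r) _ unique (va , chain) (there (there x∈)) =
    path-neighbours v a (b ∷ r) chain unique x∈

  -- Each vertex of a cycle has two neighbours on it, so its vertex set X spans at least |X| edges,
  -- one more than sparsity allows.
  acyclic : ¬ HasCycle T
  acyclic (v , vs , 2≤len , unique , chain) = arithmetic (card-nonempty {X = X} (member (here refl)))
    (≤-trans double (≤-trans (≤-reflexive handshake) (*-monoʳ-≤ 2 (sparse₁ X))))
    where
    X : VertexSet n
    X w = any (λ x → does (x Fin.≟ w)) (v ∷ vs)
    member : ∀ {w} → w ∈ v ∷ vs → X w ≡ true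
    member {w} w∈ = any-∈ {P = λ x → does (x Fin.≟ w)} w∈ (dec-true (w Fin.≟ w) refl)
    member⁻ : ∀ {w} → X w ≡ true → w ∈ v ∷ vs
    member⁻ {w} Xw with x , x∈ , eq ← any-witness (v ∷ vs) Xw = subst (_∈ v ∷ vs) (does-sound (x Fin.≟ w) eq) x∈
    inner-degree : ∀ x → 2 * χ (X x) ≤ ∑ V (λ u → χ (X x ∧ adj T x u ∧ X u))
    inner-degree x with X x in Xx
    ... | false = z≤n
    ... | true with y , z , xy , xz , y≢z , y∈ , z∈ ← cycle-neighbours v vs 2≤len unique chain (member⁻ Xx) =
      card-distinct {X = λ u → adj T x u ∧ X u} y≢z
        (cong₂ _∧_ (cong₂ _∧_ xy (member y∈)) (cong₂ _∧_ xz (member z∈)))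
    double : 2 * card X ≤ ∑ V (λ x → ∑ V (λ u → χ (X x ∧ adj T x u ∧ X u)))
    double = ≤-trans (≤-reflexive (sym (∑-*ˡ V 2 (χ ∘ X)))) (∑-mono V inner-degree)
    handshake : ∑ V (λ x → ∑ V (λ u → χ (X x ∧ adj T x u ∧ X u))) ≡ 2 * edges-in X
    handshake = trans (∑-unordered (λ x u → χ (X x ∧ adj T x u ∧ X u)) (λ x → loop x))
      (trans (∑-cong V (λ u → trans (∑-cong V (λ w → pointwise u w)) (∑-*ˡ V 2 _))) (∑-*ˡ V 2 _))
      where
      loop : ∀ x → χ (X x ∧ adj T x x ∧ X x) ≡ 0
      loop x rewrite irrefl T x | ∧-zeroʳ (X x) = refl
      both : ∀ l x a y → χ l * (χ (x ∧ a ∧ y) + χ (y ∧ a ∧ x)) ≡ 2 * χ (l ∧ a ∧ x ∧ y)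
      both false x     a     y     = refl
      both true  true  true  true  = refl
      both true  true  true  false = refl
      both true  true  false true  = refl
      both true  true  false false = refl
      both true  false true  true  = refl
      both true  false true  false = refl
      both true  false false true  = refl
      both true  false false false = refl
      pointwise : ∀ u w → χ (u <ᶠ w) * (χ (X u ∧ adj T u w ∧ X w) + χ (X w ∧ adj T w u ∧ X u))
                          ≡ 2 * χ ((u <ᶠ w) ∧ adj T u w ∧ X u ∧ X w)
      pointwise u w rewrite Graph.sym T w u = both (u <ᶠ w) (X u) (adj T u w) (X w)
    arithmetic : ∀ {c} → 1 ≤ c → 2 * c ≤ 2 * (c ∸ 1) → ⊥
    arithmetic {suc c} _ le = <-irrefl refl (*-cancelˡ-≤ 2 le)

  spanning-tree : IsSpanningTree T
  spanning-tree = connected , acyclic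

-- The packing

Searchable : Set → Set₁
Searchable B = ∀ {Q : B → Set} → (∀ b → Dec (Q b)) → Dec (∃ Q)

searchable-list : ∀ {B : Set} (L : List B) → (∀ b → b ∈ L) → Searchable B
searchable-list L complete Q? with Any.any? Q? L
... | yes found = yes (let b , _ , q = find found in b , q)
... | no  none  = no λ (b , q) → none (Any.map (λ { refl → q }) (complete b))

searchable-Vec : ∀ {B : Set} → Searchable B → ∀ n → Searchable (Vec B n)
searchable-Vec search zero    Q? = map′ (Vec.[] ,_) (λ { (Vec.[] , q) → q }) (Q? Vec.[])
searchable-Vec search (suc n) Q? =
  map′ (λ (b , bs , q) → b Vec.∷ bs , q) (λ { (b Vec.∷ bs , q) → b , bs , q })
    (search λ b → searchable-Vec search n λ bs → Q? (b Vec.∷ bs))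

all-Subset? : ∀ {n} {Q : Subset n → Set} → (∀ X → Dec (Q X)) → Dec (∀ X → Q X)
all-Subset? Q? with anySubset? (λ X → ¬? (Q? X))
... | yes (X , ¬q) = no λ all → ¬q (all X)
... | no  none     = yes λ X → decidable-stable (Q? X) λ ¬q → none (X , ¬q)

all-enumerated? : ∀ {B : Set} {Q : B → Set} (L : List B) → (∀ b → b ∈ L) → (∀ b → Dec (Q b)) → Dec (∀ b → Q b)
all-enumerated? L complete Q? = map′ (λ all b → All.lookup all (complete b)) (λ all → All.tabulate (λ {b} _ → all b)) (All.all? Q? L)

∑-attained : ∀ {B : Set} (L : List B) {f g : B → ℕ} → (∀ b → f b ≤ g b) → ∑ L g ≤ ∑ L f → ∀ {b} → b ∈ L → f b ≡ g b
∑-attained (x ∷ L) {f} {g} f≤g total (here refl) = ≤-antisym (f≤g x)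
  (+-cancelʳ-≤ (∑ L f) (g x) (f x) (≤-trans (+-monoʳ-≤ (g x) (∑-mono L f≤g)) total))
∑-attained (x ∷ L) {f} {g} f≤g total (there b∈) =
  ∑-attained L f≤g (+-cancelˡ-≤ (f x) (∑ L g) (∑ L f) (≤-trans (+-monoˡ-≤ (∑ L g) (f≤g x)) total)) b∈

at-most-average : ∀ {B C : Set} (g : C → ℕ) → C → (L : List B) (f : B → C) → ∃[ c ] length L * g c ≤ ∑ L (g ∘ f)
at-most-average g c₀ []      f = c₀ , z≤n
at-most-average g c₀ (b ∷ L) f with c , le ← at-most-average g c₀ L f with ≤-total (g c) (g (f b))
... | inj₁ c≤ = c , +-mono-≤ c≤ le
... | inj₂ c≥ = f b , +-monoʳ-≤ (g (f b)) (≤-trans (*-monoʳ-≤ (length L) c≥) le)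

-- Edge sets, copies of the matroids, and graphs

pair-≟ : ∀ {n} → DecidableEquality (Fin n × Fin n)
pair-≟ = Product.≡-dec Fin._≟_ Fin._≟_

pairs : ∀ n → List (Fin n × Fin n)
pairs n = cartesianProduct (allFin n) (allFin n)

pairs-enumerated : ∀ n → Enumerates pair-≟ (pairs n)
pairs-enumerated n (a , b) = begin
  ∑ (pairs n) (λ e → χ (does (pair-≟ (a , b) e)))
    ≡⟨ ∑-cartesianProduct V V _ ⟩
  ∑ V (λ c → ∑ V (λ d → χ (does (pair-≟ (a , b) (c , d)))))
    ≡⟨ ∑-cong V (λ c → trans (∑-cong V (factor c)) (∑-*ˡ V (χ (does (a Fin.≟ c))) _)) ⟩
  ∑ V (λ c → χ (does (a Fin.≟ c)) * ∑ V (λ d → χ (does (b Fin.≟ d))))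
    ≡⟨ ∑-δ* Fin._≟_ {V} (Fin-enumerated n) a (λ _ → ∑ V (λ d → χ (does (b Fin.≟ d)))) ⟩
  ∑ V (λ d → χ (does (b Fin.≟ d)))
    ≡⟨ Fin-enumerated n b ⟩
  1 ∎
  where
  open ≡-Reasoning
  V = allFin n
  factor : ∀ c d → χ (does (pair-≟ (a , b) (c , d))) ≡ χ (does (a Fin.≟ c)) * χ (does (b Fin.≟ d))
  factor c d with a Fin.≟ c
  ... | no  _    = refl
  ... | yes refl = sym (+-identityʳ _)

copies : ∀ p m → List (Fin p ⊎ Fin m)
copies p m = map inj₁ (allFin p) ++ map inj₂ (allFin m)

copy-≟ : ∀ {p m} → DecidableEquality (Fin p ⊎ Fin m)
copy-≟ = Sum.≡-dec Fin._≟_ Fin._≟_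

∑-copies : ∀ p m f → ∑ (copies p m) f ≡ ∑ (allFin p) (f ∘ inj₁) + ∑ (allFin m) (f ∘ inj₂)
∑-copies p m f = trans (∑-++ (map inj₁ (allFin p)) _ f) (cong₂ _+_ (∑-map inj₁ (allFin p) f) (∑-map inj₂ (allFin m) f))

copies-enumerated : ∀ p m → Enumerates copy-≟ (copies p m)
copies-enumerated p m (inj₁ i) = trans (∑-copies p m _) (cong₂ _+_ (Fin-enumerated p i) (∑-zero (allFin m)))
copies-enumerated p m (inj₂ i) = trans (∑-copies p m _) (cong₂ _+_ (∑-zero (allFin p)) (Fin-enumerated m i))

-- An edge is represented by its increasing pair; other pairs are ignored, which excludes loops and
-- double counting.
graph-of : ∀ {n} → (Fin n × Fin n → Bool) → Graph n
graph-of C .adj u v    = ((u <ᶠ v) ∧ C (u , v)) ∨ ((v <ᶠ u) ∧ C (v , u))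
graph-of C .Graph.sym u v = ∨-comm ((u <ᶠ v) ∧ C (u , v)) _
graph-of C .irrefl v rewrite <ᶠ-irrefl v = refl

graph-of-elim : ∀ {n} {C : Fin n × Fin n → Bool} {Q : Set} u v → adj (graph-of C) u v ≡ true →
                (C (u , v) ≡ true → Q) → (C (v , u) ≡ true → Q) → Q
graph-of-elim {C = C} u v q f g = ∨-elim ((u <ᶠ v) ∧ C (u , v)) q
  (λ r → f (proj₂ (∧-true {u <ᶠ v} r))) (λ r → g (proj₂ (∧-true {v <ᶠ u} r)))

graph-of-mono : ∀ {n} {C D : Fin n × Fin n → Bool} → C ⊆ᵇ D → graph-of C ⊑ graph-of D
graph-of-mono {C = C} {D} C⊆D u v q = ∨-elim ((u <ᶠ v) ∧ C (u , v)) q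
  (λ r → ∨-left _ (cong₂ _∧_ (proj₁ (∧-true {u <ᶠ v} r)) (C⊆D _ (proj₂ (∧-true {u <ᶠ v} r)))))
  (λ r → ∨-right ((u <ᶠ v) ∧ D (u , v)) (cong₂ _∧_ (proj₁ (∧-true r)) (C⊆D _ (proj₂ (∧-true {v <ᶠ u} r)))))

graph-of-ordered : ∀ {n} (C : Fin n × Fin n → Bool) {u v} → (u <ᶠ v) ≡ true → adj (graph-of C) u v ≡ C (u , v)
graph-of-ordered C {u} {v} lt with u <ᶠ v in uv | v <ᶠ u in vu
... | true | false = ∨-identityʳ (C (u , v))
... | true | true  = contradiction (trans (sym (cong₂ (λ a b → χ a + χ b) uv vu)) (<ᶠ-connex {u = u} {v} (<ᶠ⇒≢ uv))) λ ()

graph-of-disjoint : ∀ {n} {C D : Fin n × Fin n → Bool} → (∀ a → C a ≡ true → D a ≡ true → ⊥) →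
                    EdgeDisjoint (graph-of C) (graph-of D)
graph-of-disjoint {C = C} {D} disjoint u v (c , d) with u <ᶠ v in uv
... | true  = disjoint (u , v) (at C c) (at D d)
  where
  at : ∀ C → C (u , v) ∨ ((v <ᶠ u) ∧ C (v , u)) ≡ true → C (u , v) ≡ true
  at C q = trans (sym (graph-of-ordered C uv)) (trans (cong (λ b → (b ∧ C (u , v)) ∨ ((v <ᶠ u) ∧ C (v , u))) uv) q)
... | false = disjoint (v , u) (proj₂ (∧-true {v <ᶠ u} c)) (proj₂ (∧-true {v <ᶠ u} d))

Ordered : ∀ {n} → (Fin n × Fin n → Bool) → Set
Ordered C = ∀ u v → C (u , v) ≡ true → (u <ᶠ v) ≡ true

graph-of-countPairs : ∀ {n} {C : Fin n × Fin n → Bool} → Ordered C → ∀ (f : Fin n → Fin n → Bool) →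
  countPairs (λ u v → adj (graph-of C) u v ∧ f u v) ≡ ∑ (pairs n) (λ (u , v) → χ (C (u , v) ∧ f u v))
graph-of-countPairs {n} {C} ordered f =
  trans (∑-cong V λ u → ∑-cong V λ v → cong χ (pointwise u v)) (sym (∑-cartesianProduct V V _))
  where
  V = allFin n
  pointwise : ∀ u v → (u <ᶠ v) ∧ adj (graph-of C) u v ∧ f u v ≡ C (u , v) ∧ f u v
  pointwise u v with u <ᶠ v in uv
  ... | true  = cong (_∧ f u v) (trans (cong (λ b → (b ∧ C (u , v)) ∨ ((v <ᶠ u) ∧ C (v , u))) (sym uv)) (graph-of-ordered C uv))
  ... | false with C (u , v) in c
  ...   | false = refl
  ...   | true  = bool-contradiction (ordered u v c) uv

edge-degree : ∀ {n} → (Fin n × Fin n → Bool) → Fin n → ℕ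
edge-degree {n} C v = ∑ (pairs n) (λ (a , b) → χ (does (v Fin.≟ a)) * χ (C (a , b)) + χ (does (v Fin.≟ b)) * χ (C (a , b)))

graph-of-degree : ∀ {n} (C : Fin n × Fin n → Bool) v → degree (graph-of C) v ≤ edge-degree C v
graph-of-degree {n} C v = begin
  degree (graph-of C) v
    ≤⟨ ∑-mono V (λ u → pointwise (v <ᶠ u) (C (v , u)) (u <ᶠ v) (C (u , v))) ⟩
  ∑ V (λ u → χ (C (v , u)) + χ (C (u , v)))
    ≡⟨ ∑-+ V _ _ ⟩
  ∑ V (λ u → χ (C (v , u))) + ∑ V (λ u → χ (C (u , v)))
    ≡⟨ cong₂ _+_ (at (λ a → ∑ V (λ b → χ (C (a , b))))) (∑-cong V (λ u → at (λ b → χ (C (u , b))))) ⟨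
  ∑ V (λ a → χ (does (v Fin.≟ a)) * ∑ V (λ b → χ (C (a , b)))) + ∑ V (λ a → ∑ V (λ b → χ (does (v Fin.≟ b)) * χ (C (a , b))))
    ≡⟨ cong (_+ ∑ V (λ a → ∑ V (λ b → χ (does (v Fin.≟ b)) * χ (C (a , b))))) (∑-cong V (λ a → ∑-*ˡ V (χ (does (v Fin.≟ a))) _)) ⟨
  ∑ V (λ a → ∑ V (λ b → χ (does (v Fin.≟ a)) * χ (C (a , b)))) + ∑ V (λ a → ∑ V (λ b → χ (does (v Fin.≟ b)) * χ (C (a , b))))
    ≡⟨ trans (∑-cong V (λ a → ∑-+ V _ _)) (∑-+ V _ _) ⟨
  ∑ V (λ a → ∑ V (λ b → χ (does (v Fin.≟ a)) * χ (C (a , b)) + χ (does (v Fin.≟ b)) * χ (C (a , b))))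
    ≡⟨ ∑-cartesianProduct V V _ ⟨
  edge-degree C v ∎
  where
  open ≤-Reasoning
  V = allFin n
  at : ∀ f → ∑ V (λ b → χ (does (v Fin.≟ b)) * f b) ≡ f v
  at = ∑-δ* Fin._≟_ {V} (Fin-enumerated n) v
  pointwise : ∀ a b c d → χ ((a ∧ b) ∨ (c ∧ d)) ≤ χ b + χ d
  pointwise = ≤-tautology₄ refl

-- The connectivity hypothesis in terms of Boolean vertex sets

module _ (k₁ p m : ℕ) {n : ℕ} (G : Graph n) where
  open Local (adj G) k₁ m

  weakly-connectedᵇ : WeaklyConnected (suc k₁) ((4 * suc k₁ * p ∸ 2 * p) + 2 * m) G → WeaklyConnectedᵇ p
  weakly-connectedᵇ conn A B {a} {z} disjoint Aa Az Bz = begin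
    threshold p
      ≡⟨ numbers ⟨
    (4 * suc k₁ * p ∸ 2 * p) + 2 * m
      ≤⟨ conn (Vec.tabulate A) (Vec.tabulate B)
           (λ v (q , r) → disjoint v (trans (sym (lookup∘tabulate A v)) q) (trans (sym (lookup∘tabulate B v)) r))
           (a , lookup⇒[]= a (Vec.tabulate A) (trans (lookup∘tabulate A a) Aa))
           proper ⟩
    dMinus G (Vec.tabulate B) (Vec.tabulate A) + k * ∣ Vec.tabulate B ∣
      ≡⟨ cong₂ (λ x y → x + k * y) cut (∣tabulate∣ B) ⟩
    boundary A B + k * card B ∎
    where
    open ≤-Reasoning
    numbers : (4 * suc k₁ * p ∸ 2 * p) + 2 * m ≡ threshold p
    numbers = trans (cong (_+ 2 * m) (trans (cong (_∸ 2 * p) (expand k₁ p)) (m+n∸n≡m (2 * (p * suc (2 * k₁))) (2 * p)))) (collect p (suc (2 * k₁)) m)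
      where
      expand : ∀ k₁ p → 4 * suc k₁ * p ≡ 2 * (p * suc (2 * k₁)) + 2 * p
      expand = solve-∀
      collect : ∀ p κ m → 2 * (p * κ) + 2 * m ≡ 2 * (p * κ + m)
      collect = solve-∀
    proper : (Vec.tabulate A ∪ˢ Vec.tabulate B) ≢ ⊤
    proper eq = bool-contradiction (trans (cong (λ X → Vec.lookup X z) eq) (lookup-replicate z true))
      (trans (lookup-zipWith _∨_ z (Vec.tabulate A) (Vec.tabulate B))
        (cong₂ _∨_ (trans (lookup∘tabulate A z) Az) (trans (lookup∘tabulate B z) Bz)))
    -- Each edge of the cut is oriented away from `A`. That its end in `A` avoids `B` is automatic,
    -- because `A` and `B` are disjoint.
    cut : dMinus G (Vec.tabulate B) (Vec.tabulate A) ≡ boundary A B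
    cut = trans (∑-cong V λ u → ∑-cong V λ v → pointwise u v)
            (sym (∑-unordered (λ v u → χ (A v ∧ adj G v u ∧ not (A u) ∧ not (B u))) loop))
      where
      loop : ∀ v → χ (A v ∧ adj G v v ∧ not (A v) ∧ not (B v)) ≡ 0
      loop v rewrite irrefl G v | ∧-zeroʳ (A v) = refl
      by-cases : ∀ l e au bu av bv → (au ≡ true → bu ≡ true → ⊥) → (av ≡ true → bv ≡ true → ⊥) →
        χ (l ∧ e ∧ not bu ∧ not bv ∧ (au xor av)) ≡
        χ l * (χ (au ∧ e ∧ not av ∧ not bv) + χ (av ∧ e ∧ not au ∧ not bu))
      by-cases false e     au    bu    av    bv    _ _ = refl
      by-cases true  false true  bu    true  bv    _ _ = refl
      by-cases true  false true  bu    false bv    _ _ = refl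
      by-cases true  false false bu    true  bv    _ _ = refl
      by-cases true  false false bu    false bv    _ _ = refl
      by-cases true  true  true  true  av    bv    f _ = ⊥-elim (f refl refl)
      by-cases true  true  au    bu    true  true  _ g = ⊥-elim (g refl refl)
      by-cases true  true  true  false true  false _ _ = refl
      by-cases true  true  true  false false true  _ _ = refl
      by-cases true  true  true  false false false _ _ = refl
      by-cases true  true  false true  true  false _ _ = refl
      by-cases true  true  false false true  false _ _ = refl
      by-cases true  true  false true  false bv    _ _ = refl
      by-cases true  true  false false false true  _ _ = refl
      by-cases true  true  false false false false _ _ = refl
      pointwise : ∀ u v →
        χ ((u <ᶠ v) ∧ adj G u v ∧ not (Vec.lookup (Vec.tabulate B) u) ∧ not (Vec.lookup (Vec.tabulate B) v)
             ∧ (Vec.lookup (Vec.tabulate A) u xor Vec.lookup (Vec.tabulate A) v))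
        ≡ χ (u <ᶠ v) * (χ (A u ∧ adj G u v ∧ not (A v) ∧ not (B v)) + χ (A v ∧ adj G v u ∧ not (A u) ∧ not (B u)))
      pointwise u v rewrite lookup∘tabulate A u | lookup∘tabulate A v | lookup∘tabulate B u | lookup∘tabulate B v
        | Graph.sym G v u = by-cases (u <ᶠ v) (adj G u v) (A u) (B u) (A v) (B v) (disjoint u) (disjoint v)

-- Verification of (∗) and extraction of the packing

module Main (k₁ : ℕ) (1≤k₁ : 1 ≤ k₁) (p m n : ℕ) (2≤n : 2 ≤ n)
            (v₀ v₁ : Fin n) (v₀≢v₁ : v₀ ≢ v₁) (G : Graph n)
            (weak : WeaklyConnected (suc k₁) ((4 * suc k₁ * p ∸ 2 * p) + 2 * m) G) where

  k : ℕ
  k = suc k₁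

  V : List (Fin n)
  V = allFin n

  P : List (Fin n × Fin n)
  P = pairs n

  Is : List (Fin p ⊎ Fin m)
  Is = copies p m

  open Local (adj G) k₁ m using (threshold; WeaklyConnectedᵇ)

  conn : WeaklyConnectedᵇ p
  conn = weakly-connectedᵇ k₁ p m G weak

  Edge : Set
  Edge = Fin n × Fin n

  Copy : Set
  Copy = Fin p ⊎ Fin m

  s t : Edge → Fin n
  s = proj₁
  t = proj₂

  open Covers s t

  κ : Copy → ℕ
  κ (inj₁ _) = k
  κ (inj₂ _) = 1

  E₀ : Edge → Bool
  E₀ (u , v) = (u <ᶠ v) ∧ adj G u v

  h : Fin n → ℕ
  h v = ⌈ degree G v /2⌉ + k * p + m

  R : ℕ
  R = ∑ Is (λ i → weight {n} (κ i) full)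

  module Pack = Packing pair-≟ P (pairs-enumerated n) copy-≟ Is (copies-enumerated p m)
                  (λ i → Covered (κ i)) (λ i → Covered-submodular (κ i))
  open Pack using (Total; class; assigned)

  module Deg = DegreeBound pair-≟ P (pairs-enumerated n) s t h R Total Pack.Total-submodular
  open Deg using (#; outside; free; capacity; Condition; condition)

  -- The identity 2cn = 2R + 2q; it ties the connectivity to the number of edges of the packing.
  R-value : 2 * (k * p + m) * n ≡ 2 * R + threshold p
  R-value = trans (by-size n 2≤n) (cong (λ x → 2 * x + threshold p) (sym R≡))
    where
    R≡ : R ≡ p * (k * (n ∸ 2) + 1) + m * (1 * (n ∸ 2) + 1)
    R≡ = trans (∑-copies p m _) (cong₂ _+_
      (trans (∑-const (allFin p) _) (cong₂ (λ a c → a * (k * (c ∸ 2) + 1)) (length-tabulate {n = p} (λ i → i)) (card-full n)))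
      (trans (∑-const (allFin m) _) (cong₂ (λ a c → a * (1 * (c ∸ 2) + 1)) (length-tabulate {n = m} (λ i → i)) (card-full n))))
    identity : ∀ k₁ p m n → 2 * (suc k₁ * p + m) * suc (suc n) ≡
               2 * (p * (suc k₁ * n + 1) + m * (1 * n + 1)) + 2 * (p * suc (2 * k₁) + m)
    identity = solve-∀
    by-size : ∀ n → 2 ≤ n → 2 * (k * p + m) * n ≡ 2 * (p * (k * (n ∸ 2) + 1) + m * (1 * (n ∸ 2) + 1)) + threshold p
    by-size (suc zero) (s≤s ())
    by-size (suc (suc n)) _ = identity k₁ p m n

  covers-sym : ∀ (𝓧 : List (VertexSet n)) u v → covers 𝓧 u v ≡ covers 𝓧 v u
  covers-sym []      u v = refl
  covers-sym (X ∷ 𝓧) u v = cong₂ _∨_ (∧-comm (X u) (X v)) (covers-sym 𝓧 u v)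

  Cover : (Edge → Bool) → Set
  Cover Z = ∃[ 𝓧 ] (AtLeast₂ 𝓧 × (∀ a → Z a ≡ true → s a ≢ t a → covers 𝓧 (s a) (t a) ≡ true))

  whole : ∀ Z → Cover Z
  -- Serves as the default when there is no copy; its cost is then multiplied by zero.
  whole Z = full ∷ [] , subst (2 ≤_) (sym (card-full n)) 2≤n ∷ [] , λ _ _ _ → refl

  -- The `q` covers belong to the same function `Covered j`, so one costing at most their average
  -- can replace them all.
  cheapest : ∀ {Z} q j (f : Fin q → ℕ) → (∀ i → Covered j Z (f i)) → Σ[ c ∈ Cover Z ] q * cost j (proj₁ c) ≤ ∑ (allFin q) f
  cheapest {Z} q j f F with c , le ← at-most-average {C = Cover Z} (cost j ∘ proj₁) (whole Z) (allFin q)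
                              (λ i → proj₁ (F i) , proj₁ (proj₂ (F i)) , proj₁ (proj₂ (proj₂ (F i)))) =
    c , ≤-trans (subst (λ x → x * cost j (proj₁ c) ≤ ∑ (allFin q) (λ i → cost j (proj₁ (F i)))) (length-tabulate {n = q} (λ i → i)) le) (∑-mono (allFin q) λ i → proj₂ (proj₂ (proj₂ (F i))))

  open Global (adj G) (irrefl G) k₁ 1≤k₁ m v₀ v₁ v₀≢v₁ using (doubly-uncovered; global-bound)

  -- Edge by edge: one avoiding `U` occurs in two degrees, one leaving `U` in one degree. An edge
  -- inside `U` that escapes one of the covers is not in `Z`, hence free, and is counted twice on
  -- both sides.
  degree-count : ∀ U {Z} (c₁ c₂ : Cover Z) →
    doubly-uncovered p conn U (proj₁ c₁) (proj₁ c₂) (proj₁ (proj₂ c₁)) (proj₁ (proj₂ c₂)) + 2 * # (outside E₀ U)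
    ≤ ∑ V (λ v → χ (not (U v)) * degree G v) + 2 * # (free E₀ U Z)
  degree-count U {Z} (𝓧 , ≥₂𝓧 , cov𝓧) (𝓦 , ≥₂𝓦 , cov𝓦) = subst₂ _≤_ left right
    (∑-mono V λ u → ∑-mono V λ v → pointwise u v)
    where
    g h′ : Fin n → Fin n → ℕ
    g v u = χ (U v ∧ adj G v u ∧ not (U u ∧ covers 𝓧 v u ∧ covers 𝓦 v u))
    h′ v u = χ (not (U v)) * χ (adj G v u)
    double : (Edge → Bool) → ℕ
    double Z = ∑ V (λ u → ∑ V (λ v → 2 * χ (Z (u , v))))
    double-# : ∀ Z → double Z ≡ 2 * # Z
    double-# Z = trans (∑-cong V (λ u → ∑-*ˡ V 2 _)) (trans (∑-*ˡ V 2 _) (cong (2 *_) (sym (∑-cartesianProduct V V (χ ∘ Z)))))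
    left : ∑ V (λ u → ∑ V (λ v → χ (u <ᶠ v) * (g u v + g v u) + 2 * χ (outside E₀ U (u , v))))
           ≡ doubly-uncovered p conn U 𝓧 𝓦 ≥₂𝓧 ≥₂𝓦 + 2 * # (outside E₀ U)
    left = trans (∑-cong V (λ u → ∑-+ V _ _)) (trans (∑-+ V _ _)
      (cong₂ _+_ (sym (∑-unordered g loop)) (double-# (outside E₀ U))))
      where
      loop : ∀ v → g v v ≡ 0
      loop v rewrite irrefl G v | ∧-zeroʳ (U v) = refl
    right : ∑ V (λ u → ∑ V (λ v → χ (u <ᶠ v) * (h′ u v + h′ v u) + 2 * χ (free E₀ U Z (u , v))))
            ≡ ∑ V (λ v → χ (not (U v)) * degree G v) + 2 * # (free E₀ U Z)
    right = trans (∑-cong V (λ u → ∑-+ V _ _)) (trans (∑-+ V _ _)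
      (cong₂ _+_ (trans (sym (∑-unordered h′ loop)) (∑-cong V (λ v → ∑-*ˡ V (χ (not (U v))) _))) (double-# (free E₀ U Z))))
      where
      loop : ∀ v → h′ v v ≡ 0
      loop v rewrite irrefl G v = *-zeroʳ (χ (not (U v)))
    uncovered-edge : ∀ l a x y c d → χ l * (χ (x ∧ a ∧ not (y ∧ c ∧ d)) + χ (y ∧ a ∧ not (x ∧ c ∧ d)))
      + 2 * χ ((l ∧ a) ∧ not x ∧ not y)
      ≤ χ l * (χ (not x) * χ a + χ (not y) * χ a) + 2 * χ ((l ∧ a) ∧ x ∧ y ∧ true)
    uncovered-edge = ≤-tautology₆ refl
    covered-edge : ∀ l a x y → χ l * (χ (x ∧ a ∧ not (y ∧ true)) + χ (y ∧ a ∧ not (x ∧ true)))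
      + 2 * χ ((l ∧ a) ∧ not x ∧ not y)
      ≤ χ l * (χ (not x) * χ a + χ (not y) * χ a) + 2 * χ ((l ∧ a) ∧ x ∧ y ∧ false)
    covered-edge = ≤-tautology₄ refl
    pointwise : ∀ u v → χ (u <ᶠ v) * (g u v + g v u) + 2 * χ (outside E₀ U (u , v))
                        ≤ χ (u <ᶠ v) * (h′ u v + h′ v u) + 2 * χ (free E₀ U Z (u , v))
    pointwise u v rewrite Graph.sym G v u | covers-sym 𝓧 v u | covers-sym 𝓦 v u with Z (u , v) in z | u <ᶠ v in lt
    ... | false | l     = uncovered-edge l (adj G u v) (U u) (U v) (covers 𝓧 u v) (covers 𝓦 u v)
    ... | true  | false = z≤n
    ... | true  | true rewrite cov𝓧 (u , v) z (<ᶠ⇒≢ lt) | cov𝓦 (u , v) z (<ᶠ⇒≢ lt) =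
      covered-edge true (adj G u v) (U u) (U v)

  capacity-bound : ∀ U → ∑ V (λ v → χ (not (U v)) * degree G v) + 2 * (k * p + m) * card (not ∘ U) ≤ 2 * capacity U
  capacity-bound U = subst₂ _≤_ (trans (∑-+ V _ _) (cong (∑ V (λ v → χ (not (U v)) * degree G v) +_) (∑-*ˡ V (2 * (k * p + m)) _)))
    (∑-*ˡ V 2 _) (∑-mono V λ v → pointwise (not (U v)) (degree G v))
    where
    half : ∀ d → d ≤ 2 * ⌈ d /2⌉
    half d = begin
      d                    ≡⟨ ⌊n/2⌋+⌈n/2⌉≡n d ⟨
      ⌊ d /2⌋ + ⌈ d /2⌉    ≤⟨ +-monoˡ-≤ ⌈ d /2⌉ (⌊n/2⌋≤⌈n/2⌉ d) ⟩
      ⌈ d /2⌉ + ⌈ d /2⌉    ≡⟨ cong (⌈ d /2⌉ +_) (sym (+-identityʳ _)) ⟩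
      2 * ⌈ d /2⌉          ∎
      where open ≤-Reasoning
    arithmetic : ∀ d c kp m → d ≤ 2 * c → 1 * d + 2 * (kp + m) * 1 ≤ 2 * (1 * (c + kp + m))
    arithmetic d c kp m le = farkas 0 le (identity d c kp m)
      where
      identity : ∀ d c kp m → 1 * d + 2 * (kp + m) * 1 + 2 * c + 0 ≡ 2 * (1 * (c + kp + m)) + d
      identity = solve-∀
    pointwise : ∀ b d → χ b * d + 2 * (k * p + m) * χ b ≤ 2 * (χ b * (⌈ d /2⌉ + k * p + m))
    pointwise false d = ≤-reflexive (*-zeroʳ (2 * (k * p + m)))
    pointwise true  d = arithmetic d ⌈ d /2⌉ (k * p) m (half d)

  initial-condition : Condition E₀
  initial-condition = condition holds
    where
    holds : ∀ U {Z c} → Total Z c → R + # (outside E₀ U) ≤ capacity U + c + # (free E₀ U Z)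
    holds U {Z} {c} (f , F , refl) = *-cancelˡ-≤ 2 (arithmetic R (# (outside E₀ U)) (capacity U) (# (free E₀ U Z)) (∑ Is f) (k * p + m)
          (card U) (card (not ∘ U)) n _ _ (threshold p) _ R-value (card-complement U)
          (global-bound p conn U (proj₁ c₁) (proj₁ c₂) (proj₁ (proj₂ c₁)) (proj₁ (proj₂ c₂)))
          (≤-trans (+-mono-≤ le₁ le₂) (≤-reflexive (sym (∑-copies p m f))))
          (degree-count U c₁ c₂) (capacity-bound U))
      where
      c₁ = proj₁ (cheapest p k (f ∘ inj₁) (λ i → F (inj₁ i)))
      le₁ = proj₂ (cheapest p k (f ∘ inj₁) (λ i → F (inj₁ i)))
      c₂ = proj₁ (cheapest m 1 (f ∘ inj₂) (λ i → F (inj₂ i)))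
      le₂ = proj₂ (cheapest m 1 (f ∘ inj₂) (λ i → F (inj₂ i)))
      arithmetic : ∀ R o cap f c K u u′ n x D l S → 2 * K * n ≡ 2 * R + l → u + u′ ≡ n →
        2 * K * u ≤ l + 2 * x + D → x ≤ c → D + 2 * o ≤ S + 2 * f → S + 2 * K * u′ ≤ 2 * cap →
        2 * (R + o) ≤ 2 * (cap + c + f)
      arithmetic R o cap f c K u u′ n x D l S e refl h₁ h₂ h₃ h₄ =
        farkas 0 (+-mono-≤ (≤-reflexive (sym e)) (+-mono-≤ (+-mono-≤ h₁ (*-monoʳ-≤ 2 h₂)) (+-mono-≤ h₃ h₄)))
          (identity R o cap f c K u u′ x D l S)
        where
        identity : ∀ R o cap f c K u u′ x D l S →
          2 * (R + o) + (2 * K * (u + u′) + ((l + 2 * x + D + 2 * c) + (S + 2 * f + 2 * cap))) + 0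
          ≡ 2 * (cap + c + f) + ((2 * R + l) + ((2 * K * u + 2 * x) + ((D + 2 * o) + (S + 2 * K * u′))))
        identity = solve-∀

  Total-full : Total full R
  Total-full = (λ i → weight {n} (κ i) full) ,
    (λ i → covered-by-set (κ i) {full} (subst (2 ≤_) (sym (card-full n)) 2≤n) (λ _ _ → refl)) , refl

  inside-class : (Edge → Maybe Copy) → Copy → VertexSet n → Edge → Bool
  inside-class asg i X a = class asg i a ∧ X (s a) ∧ X (t a)

  -- The certificate found by search. Vertex sets are vectors here rather than functions, which
  -- makes the quantifier over them decidable.
  record Good (asg : Edge → Maybe Copy) : Set where
    constructor good
    field
      within  : ∀ u v → assigned asg (u , v) ≡ true → E₀ (u , v) ≡ true
      sparse  : ∀ i (X : Subset n) → 2 ≤ card (Vec.lookup X) →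
                # (inside-class asg i (Vec.lookup X)) ≤ weight (κ i) (Vec.lookup X)
      sizes   : ∀ i → # (class asg i) ≡ weight {n} (κ i) full
      degrees : ∀ v → edge-degree (assigned asg) v ≤ h v

  Good? : ∀ asg → Dec (Good asg)
  Good? asg = map′ (λ (a , b , c , d) → good a b c d) (λ (good a b c d) → a , b , c , d)
    (Fin.all? (λ u → Fin.all? λ v → (assigned asg (u , v) Bool.≟ true) →-dec (E₀ (u , v) Bool.≟ true))
    ×-dec all-enumerated? Is copies-complete (λ i → all-Subset? λ X → (2 ≤? card (Vec.lookup X)) →-dec
            (# (inside-class asg i (Vec.lookup X)) ≤? weight (κ i) (Vec.lookup X)))
    ×-dec all-enumerated? Is copies-complete (λ i → # (class asg i) ≟ weight {n} (κ i) full)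
    ×-dec Fin.all? (λ v → edge-degree (assigned asg) v ≤? h v))
    where
    copies-complete : ∀ i → i ∈ Is
    copies-complete = Enumerates-∈ {_≟_ = copy-≟} {Is} (copies-enumerated p m)

  -- An assignment read back from its table agrees with the original one only pointwise.
  Good-ext : ∀ {asg asg′} → (∀ a → asg a ≡ asg′ a) → Good asg → Good asg′
  Good-ext {asg} {asg′} eq (good within sparse sizes degrees) = good
    (λ u v q → within u v (trans (cong is-just (eq (u , v))) q))
    (λ i X 2≤ → subst (_≤ weight (κ i) (Vec.lookup X))
      (∑-cong P λ a → cong (λ x → χ (Pack.label-is x i ∧ Vec.lookup X (s a) ∧ Vec.lookup X (t a))) (eq a)) (sparse i X 2≤))
    (λ i → trans (∑-cong P λ a → cong (λ x → χ (Pack.label-is x i)) (sym (eq a))) (sizes i))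
    (λ v → subst (_≤ h v)
      (∑-cong P λ a → cong (λ x → χ (does (v Fin.≟ s a)) * χ (is-just x) + χ (does (v Fin.≟ t a)) * χ (is-just x)) (eq a)) (degrees v))

  E₀-proper : ∀ a → E₀ a ≡ true → s a ≢ t a
  E₀-proper (u , v) q = <ᶠ⇒≢ (proj₁ (∧-true {u <ᶠ v} q))

  label-assigned : ∀ x i → Pack.label-is x i ≡ true → is-just x ≡ true
  label-assigned (just _) i _ = refl

  module _ {H : Edge → Bool} (H⊆E₀ : H ⊆ᵇ E₀) (cond : Condition H) (H≤R : # H ≤ R) where

    bound-full : ∀ {Z c} → Total Z c → R ≤ c + # (λ a → H a ∧ not (Z a))
    bound-full {Z} {c} total = ≤-trans (m≤m+n R _) (≤-trans (Condition.bound cond full total)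
      (≤-reflexive (cong (λ x → x + c + # (λ a → H a ∧ not (Z a))) (∑-zero V))))

    size-lower : R ≤ # H
    size-lower = ≤-trans (bound-full (Submodular.empty Pack.Total-submodular)) (∑-mono P λ a → χ-mono λ q → proj₁ (∧-true q))

    -- (∗) with the full vertex set and Z = Y gives R ≤ c + |H| - |Y|, and |H| ≤ R.
    nothing-assigned : Pack.Extendable H (λ _ → nothing)
    nothing-assigned = Pack.extendable λ Y Y⊆ c costs →
      arithmetic (# Y) _ (∑ Is c) R (# H) (# (λ a → H a ∧ not (Y a))) (∑-zero P)
        (bound-full (c , (λ i → Submodular.restrict (Covered-submodular (κ i)) (λ a q → ∨-left _ q) (costs i)) , refl)) H≤R
        (≤-trans (≤-reflexive (sym (∑-+ P _ _))) (∑-mono P λ a → pointwise (Y a) (H a) (λ q → proj₁ (Y⊆ a q))))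
      where
      pointwise : ∀ y x → (y ≡ true → x ≡ true) → χ y + χ (x ∧ not y) ≤ χ x
      pointwise false true  f = ≤-refl
      pointwise false false f = ≤-refl
      pointwise true  true  f = ≤-refl
      pointwise true  false f = case f refl of λ ()
      arithmetic : ∀ y z c R H d → z ≡ 0 → R ≤ c + d → H ≤ R → y + d ≤ H → y + z ≤ c
      arithmetic y z c R H d refl r₁ r₂ r₃ =
        +-cancelʳ-≤ d (y + 0) c (≤-trans (≤-reflexive (cong (_+ d) (+-identityʳ y))) (≤-trans r₃ (≤-trans r₂ r₁)))

    complete-good : (c : Pack.Complete H) → Good (Pack.Complete.asg c)
    complete-good (Pack.complete asg ext covered within) = good
      (λ u v q → H⊆E₀ (u , v) (within (u , v) q))
      (λ i X → sparse i (Vec.lookup X)) sizes degrees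
      where
      class-proper : ∀ i a → class asg i a ≡ true → a ∈ P × s a ≢ t a
      class-proper i a q = Enumerates-∈ {_≟_ = pair-≟} {P} (pairs-enumerated n) a ,
        E₀-proper a (H⊆E₀ a (within a (label-assigned (asg a) i q)))
      outside-class : Copy → VertexSet n → Edge → Bool
      outside-class i X a = class asg i a ∧ not (X (s a) ∧ X (t a))
      split-class : ∀ i X → # (class asg i) ≡ # (inside-class asg i X) + # (outside-class i X)
      split-class i X = trans (∑-cong P λ a → pointwise (class asg i a) (X (s a) ∧ X (t a))) (∑-+ P _ _)
        where
        pointwise : ∀ c x → χ c ≡ χ (c ∧ x) + χ (c ∧ not x)
        pointwise true  true  = refl
        pointwise true  false = refl
        pointwise false x     = refl
      sparse : ∀ i X → 2 ≤ card X → # (inside-class asg i X) ≤ weight (κ i) X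
      sparse i X 2≤X = +-cancelʳ-≤ (# (outside-class i X)) _ _ (begin
        # (inside-class asg i X) + # (outside-class i X)  ≡⟨ split-class i X ⟨
        # (class asg i)
          ≤⟨ Pack.class-bound H ext (λ j → covered-by-pairs (κ j) (class-proper j))
               (Submodular.restrict (Covered-submodular (κ i)) (λ a → either (class asg i a) (X (s a) ∧ X (t a))) (proj₁ (proj₂ (proj₂ w)))) ⟩
        proj₁ w                                           ≤⟨ m≤m+n _ _ ⟩
        proj₁ w + proj₁ (proj₂ w)                         ≤⟨ proj₂ (proj₂ (proj₂ (proj₂ w))) ⟩
        weight (κ i) X + # (outside-class i X)            ∎)
        where
        open ≤-Reasoning
        -- The class is covered by `X` together with the single edges not inside `X`; comparing with
        -- the size of the class leaves the bound for the edges inside.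
        w = Submodular.uncross (Covered-submodular (κ i))
              (covered-by-set (κ i) {X} {inside-class asg i X} 2≤X (λ a q → proj₂ (∧-true {class asg i a} q)))
              (covered-by-pairs (κ i) {P} {outside-class i X} (λ a q → class-proper i a (proj₁ (∧-true q))))
        either : ∀ c x → c ≡ true → (c ∧ x) ∨ (c ∧ not x) ≡ true
        either true true  _ = refl
        either true false _ = refl
      -- The classes have at least `R` edges together and at most their ranks separately, and the
      -- ranks sum to `R`; so each rank is attained.
      sizes : ∀ i → # (class asg i) ≡ weight {n} (κ i) full
      sizes i = ∑-attained Is upper lower (Enumerates-∈ {_≟_ = copy-≟} {Is} (copies-enumerated p m) i)
        where
        upper : ∀ i → # (class asg i) ≤ weight {n} (κ i) full
        upper i = ≤-trans (∑-mono P λ a → χ-mono λ q → cong (_∧ true) q)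
          (sparse i full (subst (2 ≤_) (sym (card-full n)) 2≤n))
        lower : R ≤ ∑ Is (λ i → # (class asg i))
        lower = ≤-trans size-lower (≤-trans (∑-mono P λ a → χ-mono (covered a)) (≤-reflexive (sym (Pack.∑-class asg))))
      degrees : ∀ v → edge-degree (assigned asg) v ≤ h v
      degrees v = arithmetic (edge-degree (assigned asg) v) (h v) (capacity U) (# (free H U ∅)) (# H) R (# (outside H U))
        at-v (Condition.bound cond U (Submodular.empty Pack.Total-submodular)) H≤R
        (≤-trans (≤-reflexive (sym (∑-+ P _ _))) (∑-mono P λ a → pointwise (H a) (assigned asg a) (within a)
          (v Fin.≟ s a) (v Fin.≟ t a) λ q → E₀-proper a (H⊆E₀ a q)))
        where
        U : VertexSet n
        U w = not (does (v Fin.≟ w))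
        at-v : capacity U ≡ h v
        at-v = trans (∑-cong V λ w → cong (λ b → χ b * h w) (Bool.not-involutive (does (v Fin.≟ w))))
                 (∑-δ* Fin._≟_ {V} (Fin-enumerated n) v h)
        pointwise : ∀ x y → (y ≡ true → x ≡ true) → ∀ {a b} (da : Dec (v ≡ a)) (db : Dec (v ≡ b)) → (x ≡ true → a ≢ b) →
          χ (x ∧ not (does da) ∧ not (does db) ∧ true) + (χ (does da) * χ y + χ (does db) * χ y) ≤ χ x
        pointwise true  y     f (yes refl) (yes refl) ne = contradiction refl (ne refl)
        pointwise true  true  f (yes _)    (no _)     ne = ≤-refl
        pointwise true  false f (yes _)    (no _)     ne = z≤n
        pointwise true  true  f (no _)     (yes _)    ne = ≤-refl
        pointwise true  false f (no _)     (yes _)    ne = z≤n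
        pointwise true  y     f (no _)     (no _)     ne = ≤-refl
        pointwise false true  f _          _          ne = case f refl of λ ()
        pointwise false false f da         db         ne = ≤-reflexive (cong₂ _+_ (*-zeroʳ (χ (does da))) (*-zeroʳ (χ (does db))))
        arithmetic : ∀ e h c f H R o → c ≡ h → R + o ≤ c + 0 + f → H ≤ R → f + e ≤ H → e ≤ h
        arithmetic e h c f H R o refl r₁ r₂ r₃ = farkas o (+-mono-≤ r₁ (+-mono-≤ r₂ r₃)) (identity e h f H R o)
          where
          identity : ∀ e h f H R o → e + (h + 0 + f + (R + H)) + o ≡ h + (R + o + (H + (f + e)))
          identity = solve-∀

  look : Vec (Vec (Maybe Copy) n) n → Edge → Maybe Copy
  look table (u , v) = Vec.lookup (Vec.lookup table u) v

  table-of : (Edge → Maybe Copy) → Vec (Vec (Maybe Copy) n) n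
  table-of asg = Vec.tabulate (λ u → Vec.tabulate (λ v → asg (u , v)))

  look-tabulate : ∀ (asg : Edge → Maybe Copy) a → asg a ≡ look (table-of asg) a
  look-tabulate asg (u , v) = sym (trans (cong (λ r → Vec.lookup r v) (lookup∘tabulate _ u)) (lookup∘tabulate _ v))

  good-table? : Dec (∃[ table ] Good (look table))
  good-table? = searchable-Vec (searchable-Vec search-label n) n (λ table → Good? (look table))
    where
    search-label : Searchable (Maybe Copy)
    search-label = searchable-list (nothing ∷ map just Is) λ where
      nothing  → here refl
      (just i) → there (∈-map⁺ just (Enumerates-∈ {_≟_ = copy-≟} {Is} (copies-enumerated p m) i))

  good-table : ¬ ¬ (∃[ table ] Good (look table))
  good-table none = Deg.spanning-subset Total-full (# E₀) E₀ ≤-refl initial-condition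
    λ (H , H⊆E₀ , cond , H≤R) → Pack.complete-packing H P (λ _ → nothing) (nothing-assigned H⊆E₀ cond H≤R) (λ _ ())
      (λ a _ _ → Enumerates-∈ {_≟_ = pair-≟} {P} (pairs-enumerated n) a)
      λ c → none (table-of (Pack.Complete.asg c) , Good-ext (look-tabulate (Pack.Complete.asg c)) (complete-good H⊆E₀ cond H≤R c))

  weight-bound : ∀ j {c} → 2 ≤ c → suc j * (c ∸ 2) + 1 ≡ suc j * c ∸ (2 * suc j ∸ 1)
  weight-bound j {suc zero} (s≤s ())
  weight-bound j {suc (suc c)} _ = sym (trans (cong (_∸ (2 * suc j ∸ 1)) (expand j c)) (m+n∸n≡m (suc j * c + 1) (j + (1 * suc j))))
    where
    expand : ∀ j c → suc j * suc (suc c) ≡ suc j * c + 1 + (j + (1 * suc j))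
    expand = solve-∀

  module _ {asg : Edge → Maybe Copy} (g : Good asg) where
    open Good g

    piece : Copy → Graph n
    piece i = graph-of (class asg i)

    class-⊆ : ∀ i → class asg i ⊆ᵇ assigned asg
    class-⊆ i a = label-assigned (asg a) i

    class-ordered : ∀ i → Ordered (class asg i)
    class-ordered i u v q = proj₁ (∧-true {u <ᶠ v} (within u v (class-⊆ i (u , v) q)))

    union-⊑ : graph-of (assigned asg) ⊑ G
    union-⊑ u v q = graph-of-elim {C = assigned asg} u v q
      (λ r → proj₂ (∧-true {u <ᶠ v} (within u v r)))
      (λ r → trans (Graph.sym G u v) (proj₂ (∧-true {v <ᶠ u} (within v u r))))

    piece-sparse : ∀ i (X : Subset n) → 2 ≤ ∣ X ∣ → eIn (piece i) X ≤ weight (κ i) (Vec.lookup X)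
    piece-sparse i X 2≤ = ≤-trans
      (≤-reflexive (graph-of-countPairs (class-ordered i) (λ u v → (u ∈ᵇ X) ∧ (v ∈ᵇ X))))
      (sparse i X (subst (2 ≤_) (∣∣≡card X) 2≤))

    piece-size : ∀ i → numEdges (piece i) ≡ weight {n} (κ i) full
    piece-size i = trans (trans (countPairs-cong {g = λ u v → adj (piece i) u v ∧ true} (λ u v → sym (Bool.∧-identityʳ _))) (trans (graph-of-countPairs (class-ordered i) (λ _ _ → true))
      (∑-cong P λ a → cong χ (Bool.∧-identityʳ _)))) (sizes i)

    rigid : ∀ j → KRigid k (piece (inj₁ j))
    rigid j = piece (inj₁ j) , (λ _ _ q → q) ,
      (λ X 2≤ → ≤-trans (piece-sparse (inj₁ j) X 2≤)
        (≤-reflexive (trans (cong (λ c → k * (c ∸ 2) + 1) (sym (∣∣≡card X))) (weight-bound k₁ 2≤)))) ,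
      trans (piece-size (inj₁ j)) (trans (cong (λ c → k * (c ∸ 2) + 1) (card-full n)) (weight-bound k₁ 2≤n))

    tree : ∀ i → IsSpanningTree (piece (inj₂ i))
    tree i = Tree.spanning-tree (piece (inj₂ i))
      (λ X 2≤ → ≤-trans (piece-sparse (inj₂ i) X 2≤)
        (≤-reflexive (trans (cong (λ c → 1 * (c ∸ 2) + 1) (sym (∣∣≡card X))) (trans (weight-bound 0 2≤) (cong (_∸ 1) (*-identityˡ ∣ X ∣))))))
      (trans (piece-size (inj₂ i)) (trans (cong (λ c → 1 * (c ∸ 2) + 1) (card-full n))
        (trans (weight-bound 0 2≤n) (cong (_∸ 1) (*-identityˡ n)))))

    disjoint : ∀ {i j} → i ≢ j → EdgeDisjoint (piece i) (piece j)
    disjoint {i} {j} i≢j = graph-of-disjoint λ a → apart (asg a)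
      where
      apart : ∀ x → Pack.label-is x i ≡ true → Pack.label-is x j ≡ true → ⊥
      apart (just l) q r = i≢j (trans (sym (does-sound (copy-≟ l i) q)) (does-sound (copy-≟ l j) r))

  conclusion :
    Σ[ H ∈ Graph n ] Σ[ T ∈ (Fin m → Graph n) ] Σ[ R ∈ (Fin p → Graph n) ]
      ( H ⊑ G
      × ((i : Fin m) → T i ⊑ H × IsSpanningTree (T i))
      × ((j : Fin p) → R j ⊑ H × KRigid k (R j))
      × ((i i′ : Fin m) → i ≢ i′ → EdgeDisjoint (T i) (T i′))
      × ((j j′ : Fin p) → j ≢ j′ → EdgeDisjoint (R j) (R j′))
      × ((i : Fin m) (j : Fin p) → EdgeDisjoint (T i) (R j))
      × ((v : Fin n) → degree H v ≤ ⌈ degree G v /2⌉ + k * p + m) )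
  conclusion = let table , g = decidable-stable good-table? good-table ; asg = look table in
      graph-of (assigned asg) , (λ i → piece g (inj₂ i)) , (λ j → piece g (inj₁ j))
    , union-⊑ g
    , (λ i → graph-of-mono (class-⊆ g (inj₂ i)) , tree g i)
    , (λ j → graph-of-mono (class-⊆ g (inj₁ j)) , rigid g j)
    , (λ i i′ i≢i′ → disjoint g (i≢i′ ∘ Sum.inj₂-injective))
    , (λ j j′ j≢j′ → disjoint g (j≢j′ ∘ Sum.inj₁-injective))
    , (λ i j → disjoint g λ ())
    , (λ v → ≤-trans (graph-of-degree (assigned asg) v) (Good.degrees g v))

-- Graphs with at most one vertex

module Trivial (k₁ p m n : ℕ) (n≤1 : n ≤ 1) (G : Graph n) where

  edgeless : Graph n
  edgeless = graph-of ∅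

  no-edge : ∀ u v → adj edgeless u v ≡ true → ⊥
  no-edge u v q = graph-of-elim {C = ∅} u v q (λ ()) (λ ())

  tree : IsSpanningTree edgeless
  tree = (λ u v → reach n≤1 u v) , λ { (v , a ∷ vs , _ , _ , va , _) → no-edge v a va }
    where
    reach : ∀ {n} {T : Graph n} → n ≤ 1 → ∀ u v → Reachable T u v
    reach (s≤s z≤n) zero zero = here

  -- For n ≤ 1 the number kn - (2k - 1) truncates to zero, and no set has two vertices.
  rigid : KRigid (suc k₁) edgeless
  rigid = edgeless , (λ _ _ q → q) ,
    (λ X 2≤ → contradiction (≤-trans 2≤ (≤-trans (∣p∣≤n X) n≤1)) λ { (s≤s ()) }) ,
    trans (trans (∑-cong (allFin n) λ u → trans (∑-cong (allFin n) λ v → cong χ (absent u v)) (∑-zero (allFin n))) (∑-zero (allFin n)))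
      (sym (m≤n⇒m∸n≡0 (≤-trans (*-monoʳ-≤ (suc k₁) n≤1) (≤-trans (≤-reflexive (*-identityʳ (suc k₁)))
        (≤-trans (m≤n+m (suc k₁) k₁) (≤-reflexive (cong (k₁ +_) (sym (*-identityˡ (suc k₁))))))))))
    where
    absent : ∀ u v → (u <ᶠ v) ∧ adj edgeless u v ≡ false
    absent u v with adj edgeless u v in a
    ... | true  = ⊥-elim (no-edge u v a)
    ... | false = ∧-zeroʳ (u <ᶠ v)

  conclusion :
    Σ[ H ∈ Graph n ] Σ[ T ∈ (Fin m → Graph n) ] Σ[ R ∈ (Fin p → Graph n) ]
      ( H ⊑ G
      × ((i : Fin m) → T i ⊑ H × IsSpanningTree (T i))
      × ((j : Fin p) → R j ⊑ H × KRigid (suc k₁) (R j))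
      × ((i i′ : Fin m) → i ≢ i′ → EdgeDisjoint (T i) (T i′))
      × ((j j′ : Fin p) → j ≢ j′ → EdgeDisjoint (R j) (R j′))
      × ((i : Fin m) (j : Fin p) → EdgeDisjoint (T i) (R j))
      × ((v : Fin n) → degree H v ≤ ⌈ degree G v /2⌉ + suc k₁ * p + m) )
  conclusion = edgeless , (λ _ → edgeless) , (λ _ → edgeless)
    , (λ u v q → ⊥-elim (no-edge u v q))
    , (λ _ → (λ _ _ q → q) , tree)
    , (λ _ → (λ _ _ q → q) , rigid)
    , (λ _ _ _ u v (q , _) → no-edge u v q)
    , (λ _ _ _ u v (q , _) → no-edge u v q)
    , (λ _ _ u v (q , _) → no-edge u v q)
    , (λ v → ≤-trans (graph-of-degree ∅ v) (≤-trans (≤-reflexive (trans (∑-cong (pairs n) λ (a , b) →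
        cong₂ _+_ (*-zeroʳ (χ (does (v Fin.≟ a)))) (*-zeroʳ (χ (does (v Fin.≟ b))))) (∑-zero (pairs n)))) z≤n))

theorem10p1 : (k p m : ℕ) → 2 ≤ k → (n : ℕ) → (G : Graph n) →
    WeaklyConnected k ((4 * k * p ∸ 2 * p) + 2 * m) G →
    Σ[ H ∈ Graph n ] Σ[ T ∈ (Fin m → Graph n) ] Σ[ R ∈ (Fin p → Graph n) ]
    ( H ⊑ G
    × ((i : Fin m) → T i ⊑ H × IsSpanningTree (T i))
    × ((j : Fin p) → R j ⊑ H × KRigid k (R j))
    × ((i i′ : Fin m) → i ≢ i′ → EdgeDisjoint (T i) (T i′))
    × ((j j′ : Fin p) → j ≢ j′ → EdgeDisjoint (R j) (R j′))
    × ((i : Fin m) (j : Fin p) → EdgeDisjoint (T i) (R j))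
    × ((v : Fin n) → degree H v ≤ ⌈ degree G v /2⌉ + k * p + m) )
theorem10p1 (suc k₁) p m (s≤s 1≤k₁) 0             G weak = Trivial.conclusion k₁ p m 0 z≤n G
theorem10p1 (suc k₁) p m (s≤s 1≤k₁) 1             G weak = Trivial.conclusion k₁ p m 1 ≤-refl G
theorem10p1 (suc k₁) p m (s≤s 1≤k₁) (suc (suc n)) G weak =
  Main.conclusion k₁ 1≤k₁ p m (suc (suc n)) (s≤s (s≤s z≤n)) zero (suc zero) (λ ()) G weak
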